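{- Let $q$ be an odd prime power and $n\ge3$ with $(q^n-1)/2$ even, and let $Q=(q^n-1)/(q-1)$. For every divisor $m$ of $Q$, $$\mathcal{N}_0(m)\ \ge\ \theta(m)\,q^{\frac n2-1}\Big\{q^{\frac n2}-2W(m)(q-1)\Big\}.$$ Consequently, if $q^{n/2}>2W(Q)(q-1)$, then $\mathcal{N}_0(q^n-1)>0$.
   Context: For a divisor $m$ of $q^n-1$, an element $\xi\in\mathbb{F}_{q^n}^*$ is $m$-free if $\xi=\zeta^d$ with $d\mid m$ and $\zeta\in\mathbb{F}_{q^n}^*$ implies $d=1$. For $\beta\in\mathbb{F}_q$, $\mathcal{N}_\beta(m)$ denotes the number of $m$-free $\xi\in\mathbb{F}_{q^n}^*$ with $\mathrm{Tr}(\xi^2)=\beta$, where $\mathrm{Tr}(\xi)=\sum_{i=0}^{n-1}\xi^{q^i}\in\mathbb{F}_q$. $\theta(m)=\phi(m)/m$ and $W(t)$ is the number of square-free divisors of $t$. -}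

module Defs where

open import Level using (0ℓ)
open import Data.Nat as ℕ using (ℕ; zero; suc; _∸_; _≤_; _<_)
open import Data.Nat.DivMod using (_/_)
open import Data.Nat.Divisibility using (_∣_; _∣?_)
open import Data.Nat.GCD using (gcd)
open import Data.Bool using (Bool; true; false; if_then_else_; not; _∧_)
open import Data.List using (List; length; filter; upTo; map)
open import Data.Bool.ListAction using (all)
open import Data.List.Membership.Propositional using (_∈_)
open import Data.List.Relation.Unary.Unique.Propositional using (Unique)
open import Data.Integer as ℤ using (ℤ; +_)
open import Data.Rational as ℚ using (ℚ)
open import Data.Product using (_×_)
open import Data.Sum using (_⊎_)
open import Relation.Nullary using (¬_; Dec; does)
open import Relation.Unary using (Decidable)
open import Relation.Binary.PropositionalEquality using (_≡_; _≢_)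
open import Algebra.Structures using (IsCommutativeRing)

record FiniteField : Set₁ where
  field
    Carrier : Set
    _+_ _*_ : Carrier → Carrier → Carrier
    -_      : Carrier → Carrier
    0# 1#   : Carrier
    isCommutativeRing : IsCommutativeRing _≡_ _+_ _*_ -_ 0# 1#
    0≢1     : 0# ≢ 1#
    inverse : ∀ x → x ≢ 0# → Data.Product.Σ Carrier (λ y → x * y ≡ 1#)
    _≟_     : (x y : Carrier) → Dec (x ≡ y)
    elems   : List Carrier
    complete : ∀ x → x ∈ elems
    unique  : Unique elems

  size : ℕ
  size = length elems

  _^_ : Carrier → ℕ → Carrier
  x ^ zero  = 1#
  x ^ suc k = x * (x ^ k)

  Tr : (q n : ℕ) → Carrier → Carrier
  Tr q zero    ξ = 0#
  Tr q (suc i) ξ = Tr q i ξ + (ξ ^ (q ℕ.^ i))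

  IsFree : ℕ → Carrier → Set
  IsFree m ξ = ∀ (d : ℕ) (ζ : Carrier) → d ∣ m → ζ ≢ 0# → ξ ≡ ζ ^ d → d ≡ 1

  Counted : (q n m : ℕ) (β : Carrier) → Carrier → Set
  Counted q n m β ξ = (ξ ≢ 0#) × IsFree m ξ × (Tr q n (ξ * ξ) ≡ β)

  -- 𝒩_β(m): the number of m-free ξ ∈ F* with Tr(ξ²) = β.
  -- It is computed using any decision procedure for the property
  -- (the result does not depend on the chosen procedure).
  𝒩 : (q n m : ℕ) (β : Carrier) → Decidable (Counted q n m β) → ℕ
  𝒩 q n m β dec = length (filter dec elems)

IsPrimePower : ℕ → Set
IsPrimePower q = Data.Product.Σ ℕ (λ p → Data.Product.Σ ℕ (λ k →
  Data.Nat.Primality.Prime p × 1 ≤ k × q ≡ p ℕ.^ k))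
  where import Data.Nat.Primality

divℕ : ℕ → ℕ → ℕ
divℕ a zero    = 0
divℕ a (suc b) = a / suc b

φ : ℕ → ℕ
φ m = length (filter (λ k → gcd (suc k) m ℕ.≟ 1) (upTo m))

-- square-free: no k ≥ 2 with k² ∣ d   (for d ≥ 1)
squareFree? : ℕ → Bool
squareFree? d = all (λ j → not (does ((suc (suc j)) ℕ.* (suc (suc j)) ∣? d))) (upTo d)

-- W(t): number of square-free divisors of t  (for t ≥ 1)
W : ℕ → ℕ
W t = length (filter (λ j → Data.Bool.Properties.T? (does (suc j ∣? t) ∧ squareFree? (suc j))) (upTo t))
  where import Data.Bool.Properties

θ : ℕ → ℚ
θ zero    = ℚ.0ℚ
θ (suc m) = (+ φ (suc m)) ℚ./ suc m

-- "x ≥ a - c·√r" for rationals x, a and c ≥ 0, r ≥ 0, expressed without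
-- square roots: either a ≤ x, or 0 ≤ a - x and (a - x)² ≤ c²·r.
GeMinusSqrt : (x a c r : ℚ) → Set
GeMinusSqrt x a c r = (a ℚ.≤ x) ⊎ ((a ℚ.- x) ℚ.* (a ℚ.- x) ℚ.≤ (c ℚ.* c) ℚ.* r)

toℚ : ℕ → ℚ
toℚ k = (+ k) ℚ./ 1

{-# OPTIONS --safe #-}

-- Write N = q^n − 1, and let H_L(i) be the Ramanujan sum of modulus ∏ L on ℤ/N, the exponents of a
-- generator g of F*. The indicator of the m-free elements is a combination of the H_L with L ranging over
-- the sets of primes dividing m, so it suffices to bound every X_L = ∑ H_L(i) β(2i), where β(k) is the
-- centred indicator of Tr(g^k) = 0. No characters are needed: H_L reproduces itself under convolution,
-- so Cauchy–Schwarz bounds X_L² by the second moment of k ↦ ∑ H_L(i) β(2i + k). Expanding the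
-- square leaves the numbers of z with Tr(xz) = Tr(yz) = 0, which are q^(n−2) or q^(n−1) according to
-- whether x/y lies outside or inside F_q; for squares x, y at most 2(q − 1) values of y are inside for each x.
-- For the second claim, a Q-free ξ with Tr(ξ²) = 0 is multiplied by an element of F_q* to become primitive.
module Submission where

open import Defs
open import Level using (0ℓ)
open import Function using (_∘_; id; mk⇔)
open import Data.Bool using (Bool; true; T; not; _∧_)
import Data.Bool.Properties
import Data.Bool.ListAction
open import Data.Unit using (tt)
open import Data.Maybe using (nothing)
open import Data.Product using (_×_; _,_; proj₁; proj₂; Σ; ∃)
open import Data.Sum using (_⊎_; inj₁; inj₂)
open import Data.Fin using (Fin; toℕ; fromℕ; inject₁)
import Data.Fin.Properties as Finₚ
open import Data.Nat using (ℕ; zero; suc; _+_; _*_; _∸_; _^_; _!; _≤_; _<_; z≤n; s≤s; NonZero)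
import Data.Nat as ℕ
import Data.Nat.Properties as ℕₚ
open import Data.Nat.Combinatorics using (_C_; nCn≡1; nCk≡n!/k![n-k]!; k![n∸k]!∣n!)
open import Data.Nat.Divisibility using (_∣_; _∤_; _∣?_; divides; ∣-refl; ∣-trans; ∣m∣n⇒∣m+n; ∣m+n∣m⇒∣n; ∣n⇒∣m*n; m∣m*n; ∣⇒≤; ∣1⇒≡1; *-cancelˡ-∣; *-monoʳ-∣; *-monoˡ-∣; n∣m⇒m%n≡0; m%n≡0⇒n∣m)
open import Data.Nat.DivMod using (_/_; _%_; m≡m%n+[m/n]*n; m%n<n; m*[n/m]≡n; m/n*n≡m)
open import Data.Nat.GCD using (gcd; gcd[m,n]∣m; gcd[m,n]∣n; gcd-greatest; gcd-zeroˡ; gcd-GCD; module Bézout)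
open import Data.Nat.ListAction using (product)
open import Data.Nat.ListAction.Properties using (∈⇒∣product)
open import Data.Nat.Primality using (Prime; prime?; prime[2]; euclidsLemma; prime⇒nonZero; prime⇒nonTrivial; prime⇒irreducible; productOfPrimes≥1; ¬prime[1])
open import Data.Nat.Primality.Factorisation using (factorise)
open import Data.Nat.Solver using (module +-*-Solver)
open import Data.Integer as ℤ using (ℤ; +_; 0ℤ; 1ℤ)
import Data.Integer.Properties as ℤₚ
open import Data.Integer.Tactic.RingSolver using (solve-∀)
open import Data.Rational as ℚ using (ℚ) renaming (_*_ to _*ℚ_)
import Data.Rational.Properties as ℚₚ
import Data.Rational.Solver
open import Data.Rational.Unnormalised as ℚᵘ using (mkℚᵘ; *≡*; *≤*)
import Data.Rational.Unnormalised.Properties as ℚᵘₚ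
open import Data.List using (List; []; _∷_; _++_; length; filter; foldr; map; downFrom; upTo; applyDownFrom)
open import Data.List.Properties using (reverse-upTo; length-map; length-++; length-downFrom; length-applyDownFrom; map-downFrom; ++-identityʳ)
open import Data.List.Membership.Propositional using (_∈_; find)
open import Data.List.Membership.Propositional.Properties using (∈-∃++; ∈-++⁻; ∈-map⁺; ∈-map⁻; ∈-filter⁺; ∈-filter⁻; ∈-upTo⁺; ∈-downFrom⁺; ∈-downFrom⁻; ∈-applyDownFrom⁻)
open import Data.List.Membership.Propositional.Properties.WithK using (unique∧set⇒bag)
open import Data.List.Relation.Unary.Any using (here; there; any?)
open import Data.List.Relation.Unary.All as All using (All; []; _∷_)
import Data.List.Relation.Unary.All.Properties as Allₚ
open import Data.List.Relation.Unary.Unique.Propositional using (Unique; []; _∷_)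
import Data.List.Relation.Unary.Unique.Propositional.Properties as Uniqueₚ
open import Data.List.Relation.Binary.BagAndSetEquality using (∼bag⇒↭)
open import Data.List.Relation.Binary.Permutation.Propositional as Perm using (_↭_; ↭-sym; ↭-trans; ↭-reflexive; ↭⇒↭ₛ)
open import Data.List.Relation.Binary.Permutation.Propositional.Properties using (shift; ↭-length; ↭-reverse; ∈-resp-↭; All-resp-↭)
open import Data.List.Relation.Binary.Permutation.Setoid.Properties using (Unique-resp-↭; foldr-commMonoid)
open import Relation.Nullary using (¬_; Dec; yes; no; does)
open import Relation.Nullary.Negation using (contradiction)
open import Relation.Unary using (Decidable)
open import Relation.Binary.Definitions using (DecidableEquality; tri<; tri≈; tri>)
open import Relation.Binary.PropositionalEquality using (_≡_; _≢_; refl; sym; trans; cong; cong₂; subst; subst₂; setoid; module ≡-Reasoning)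
open import Algebra.Bundles using (CommutativeRing)
import Algebra.Properties.AbelianGroup ℤₚ.+-0-abelianGroup as ℤ+
import Algebra.Properties.CommutativeMonoid.Sum
import Algebra.Properties.CommutativeSemigroup
import Algebra.Properties.CommutativeSemiring.Binomial
import Algebra.Properties.Group
import Algebra.Properties.Ring
import Algebra.Properties.Semiring.Exp
import Algebra.Properties.Semiring.Mult
import Tactic.RingSolver as RingSolver
open import Tactic.RingSolver.Core.AlmostCommutativeRing using (AlmostCommutativeRing; fromCommutativeRing)

-- Finite sums

-- Cauchy-Schwarz applied to X_L itself would bring in the norm √(N · Φ L) of H_L, where only Φ L is
-- affordable. Reproduction writes N · X_L as the inner product of H_L with x ↦ V(2x), where V is
-- the image of H_L under the operator with kernel β(2i + k). Now the norm of H_L occurs twice, and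
-- its square N · Φ L yields exactly the factor Φ L, as would a Gauss sum bound summed over the
-- characters behind H_L. The constant 2(q - 1) is the root of 2 · 2(q - 1) · (q - 1): a factor 2
-- for doubling, which is two-to-one on ℤ/N because N is even; the count 2(q - 1) of the last step;
-- and the gap q^(n-1) - q^(n-2) = (q - 1) r between the two kernel sizes, with r = q^(n-2). The
-- trace indicator is centred at A / N with A = q^(n-1), although its mean over the units is (A - 1)
-- / N. This makes the main term exactly θ(m) A, and the constant that it leaves in the second
-- moment has the sign that allows it to be dropped. Up to the passage to ℚ all inequalities are
-- scaled by N, ∏ L or m to stay in ℤ, and √r appears only squared.

infixr 5 ∑ ∑<

private variable
  I J : Set

∑ : List I → (I → ℤ) → ℤ
∑ []       f = 0ℤ
∑ (x ∷ xs) f = f x ℤ.+ ∑ xs f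

syntax ∑ xs (λ x → e) = ∑[ x ∈ xs ] e

∑< : ℕ → (ℕ → ℤ) → ℤ
∑< n f = ∑ (downFrom n) f

syntax ∑< n (λ i → e) = ∑[ i < n ] e

∑-cong : (xs : List I) {f g : I → ℤ} → (∀ x → f x ≡ g x) → ∑ xs f ≡ ∑ xs g
∑-cong []       e = refl
∑-cong (x ∷ xs) e = cong₂ ℤ._+_ (e x) (∑-cong xs e)

∑-cong-∈ : (xs : List I) {f g : I → ℤ} → (∀ x → x ∈ xs → f x ≡ g x) → ∑ xs f ≡ ∑ xs g
∑-cong-∈ []       e = refl
∑-cong-∈ (x ∷ xs) e = cong₂ ℤ._+_ (e x (here refl)) (∑-cong-∈ xs (λ y y∈ → e y (there y∈)))

∑-+ : (xs : List I) (f g : I → ℤ) → ∑ xs (λ x → f x ℤ.+ g x) ≡ ∑ xs f ℤ.+ ∑ xs g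
∑-+ []       f g = refl
∑-+ (x ∷ xs) f g rewrite ∑-+ xs f g = lemma (f x) (g x) (∑ xs f) (∑ xs g)
  where
  lemma : ∀ a b c d → (a ℤ.+ b) ℤ.+ (c ℤ.+ d) ≡ (a ℤ.+ c) ℤ.+ (b ℤ.+ d)
  lemma = solve-∀

∑-*ˡ : (xs : List I) (c : ℤ) (f : I → ℤ) → ∑ xs (λ x → c ℤ.* f x) ≡ c ℤ.* ∑ xs f
∑-*ˡ []       c f = sym (ℤₚ.*-zeroʳ c)
∑-*ˡ (x ∷ xs) c f rewrite ∑-*ˡ xs c f = sym (ℤₚ.*-distribˡ-+ c (f x) (∑ xs f))

∑-*ʳ : (xs : List I) (c : ℤ) (f : I → ℤ) → ∑ xs (λ x → f x ℤ.* c) ≡ ∑ xs f ℤ.* c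
∑-*ʳ xs c f = trans (∑-cong xs (λ x → ℤₚ.*-comm (f x) c))
                    (trans (∑-*ˡ xs c f) (ℤₚ.*-comm c _))

∑-- : (xs : List I) (f g : I → ℤ) → ∑ xs (λ x → f x ℤ.- g x) ≡ ∑ xs f ℤ.- ∑ xs g
∑-- []       f g = refl
∑-- (x ∷ xs) f g rewrite ∑-- xs f g = lemma (f x) (g x) (∑ xs f) (∑ xs g)
  where
  lemma : ∀ a b c d → (a ℤ.- b) ℤ.+ (c ℤ.- d) ≡ (a ℤ.+ c) ℤ.- (b ℤ.+ d)
  lemma = solve-∀

∑-const : (xs : List I) (c : ℤ) → ∑ xs (λ _ → c) ≡ + length xs ℤ.* c
∑-const []       c = refl
∑-const (x ∷ xs) c rewrite ∑-const xs c = sym (ℤₚ.suc-* (+ length xs) c)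

∑-swap : (xs : List I) (ys : List J) (f : I → J → ℤ) →
         (∑[ x ∈ xs ] ∑[ y ∈ ys ] f x y) ≡ (∑[ y ∈ ys ] ∑[ x ∈ xs ] f x y)
∑-swap []       ys f = sym (trans (∑-const ys 0ℤ) (ℤₚ.*-zeroʳ (+ length ys)))
∑-swap (x ∷ xs) ys f rewrite ∑-swap xs ys f = sym (∑-+ ys (f x) (λ y → ∑ xs (λ x → f x y)))

∑-↭ : {xs ys : List I} (f : I → ℤ) → xs ↭ ys → ∑ xs f ≡ ∑ ys f
∑-↭ f Perm.refl          = refl
∑-↭ f (Perm.prep x p)    = cong (ℤ._+_ (f x)) (∑-↭ f p)
∑-↭ f (Perm.swap {xs} {ys} x y p) rewrite ∑-↭ f p = lemma (f x) (f y) (∑ ys f)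
  where
  lemma : ∀ a b c → a ℤ.+ (b ℤ.+ c) ≡ b ℤ.+ (a ℤ.+ c)
  lemma = solve-∀
∑-↭ f (Perm.trans p p′)  = trans (∑-↭ f p) (∑-↭ f p′)

∑-map : (xs : List J) (h : J → I) (f : I → ℤ) → ∑ (map h xs) f ≡ ∑ xs (f ∘ h)
∑-map []       h f = refl
∑-map (x ∷ xs) h f = cong (ℤ._+_ (f (h x))) (∑-map xs h f)

∑-mono : (xs : List I) {f g : I → ℤ} → (∀ x → f x ℤ.≤ g x) → ∑ xs f ℤ.≤ ∑ xs g
∑-mono []       e = ℤₚ.≤-refl
∑-mono (x ∷ xs) e = ℤₚ.+-mono-≤ (e x) (∑-mono xs e)

∑-nonneg : (xs : List I) {f : I → ℤ} → (∀ x → 0ℤ ℤ.≤ f x) → 0ℤ ℤ.≤ ∑ xs f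
∑-nonneg []       e = ℤₚ.≤-refl
∑-nonneg (x ∷ xs) e = ℤₚ.+-mono-≤ (e x) (∑-nonneg xs e)

0≤i² : ∀ i → 0ℤ ℤ.≤ i ℤ.* i
0≤i² (+ n)      = subst (0ℤ ℤ.≤_) (ℤₚ.pos-* n n) (ℤ.+≤+ z≤n)
0≤i² ℤ.-[1+ n ] = ℤ.+≤+ z≤n

2ab≤a²+b² : ∀ a b → + 2 ℤ.* (a ℤ.* b) ℤ.≤ a ℤ.* a ℤ.+ b ℤ.* b
2ab≤a²+b² a b = ℤₚ.0≤i-j⇒j≤i (subst (0ℤ ℤ.≤_) (lemma a b) (0≤i² (a ℤ.- b)))
  where
  lemma : ∀ a b → (a ℤ.- b) ℤ.* (a ℤ.- b) ≡ a ℤ.* a ℤ.+ b ℤ.* b ℤ.- + 2 ℤ.* (a ℤ.* b)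
  lemma = solve-∀

∑-square-lin : (xs : List I) (a b : ℤ) (f g : I → ℤ) →
  ∑ xs (λ x → (a ℤ.* f x ℤ.+ b ℤ.* g x) ℤ.* (a ℤ.* f x ℤ.+ b ℤ.* g x)) ≡
  a ℤ.* a ℤ.* ∑ xs (λ x → f x ℤ.* f x) ℤ.+ + 2 ℤ.* a ℤ.* b ℤ.* ∑ xs (λ x → f x ℤ.* g x)
    ℤ.+ b ℤ.* b ℤ.* ∑ xs (λ x → g x ℤ.* g x)
∑-square-lin []       a b f g = lemma a b
  where
  lemma : ∀ a b → 0ℤ ≡ a ℤ.* a ℤ.* 0ℤ ℤ.+ + 2 ℤ.* a ℤ.* b ℤ.* 0ℤ ℤ.+ b ℤ.* b ℤ.* 0ℤ
  lemma = solve-∀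
∑-square-lin (x ∷ xs) a b f g rewrite ∑-square-lin xs a b f g = lemma a b (f x) (g x) _ _ _
  where
  lemma : ∀ a b u v s t w → (a ℤ.* u ℤ.+ b ℤ.* v) ℤ.* (a ℤ.* u ℤ.+ b ℤ.* v)
        ℤ.+ (a ℤ.* a ℤ.* s ℤ.+ + 2 ℤ.* a ℤ.* b ℤ.* t ℤ.+ b ℤ.* b ℤ.* w)
        ≡ a ℤ.* a ℤ.* (u ℤ.* u ℤ.+ s) ℤ.+ + 2 ℤ.* a ℤ.* b ℤ.* (u ℤ.* v ℤ.+ t) ℤ.+ b ℤ.* b ℤ.* (v ℤ.* v ℤ.+ w)
  lemma = solve-∀

-- Induction on the list: with head values `u` and `v`, the defect of the inequality grows by
-- `∑ (v f − u g)²` over the tail. This form needs no division.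
cauchy-schwarz : (xs : List I) (f g : I → ℤ) →
  ∑ xs (λ x → f x ℤ.* g x) ℤ.* ∑ xs (λ x → f x ℤ.* g x) ℤ.≤
  ∑ xs (λ x → f x ℤ.* f x) ℤ.* ∑ xs (λ x → g x ℤ.* g x)
cauchy-schwarz []       f g = ℤₚ.≤-refl
cauchy-schwarz (x ∷ xs) f g = ℤₚ.0≤i-j⇒j≤i (subst (0ℤ ℤ.≤_)
  (lemma (f x) (g x) _ _ _)
  (ℤₚ.+-mono-≤ (subst (0ℤ ℤ.≤_) (∑-square-lin xs (g x) (ℤ.- f x) f g) (∑-nonneg xs (λ y → 0≤i² (g x ℤ.* f y ℤ.+ ℤ.- f x ℤ.* g y))))
               (ℤₚ.i≤j⇒0≤j-i (cauchy-schwarz xs f g))))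
  where
  lemma : ∀ u v s t w →
    (v ℤ.* v ℤ.* s ℤ.+ + 2 ℤ.* v ℤ.* (ℤ.- u) ℤ.* t ℤ.+ (ℤ.- u) ℤ.* (ℤ.- u) ℤ.* w) ℤ.+ (s ℤ.* w ℤ.- t ℤ.* t)
    ≡ (u ℤ.* u ℤ.+ s) ℤ.* (v ℤ.* v ℤ.+ w) ℤ.- (u ℤ.* v ℤ.+ t) ℤ.* (u ℤ.* v ℤ.+ t)
  lemma = solve-∀

-- Schur's test: `2ab ≤ a² + b²` splits the form into two halves, which agree by symmetry of `D` and
-- are each bounded by the row sums.
∑²-kernel-bound : (xs : List I) (D : I → I → ℤ) (δ : ℤ) → (∀ x y → 0ℤ ℤ.≤ D x y) →
  (∀ x y → D x y ≡ D y x) → (∀ x → ∑ xs (D x) ℤ.≤ δ) → (h : I → ℤ) →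
  (∑[ x ∈ xs ] ∑[ y ∈ xs ] D x y ℤ.* (h x ℤ.* h y)) ℤ.≤ δ ℤ.* ∑ xs (λ x → h x ℤ.* h x)
∑²-kernel-bound xs D δ D≥0 D-sym row h = ℤₚ.*-cancelˡ-≤-pos _ _ (+ 2) (begin
  + 2 ℤ.* (∑[ x ∈ xs ] ∑[ y ∈ xs ] D x y ℤ.* (h x ℤ.* h y))
    ≡⟨ sym (∑-*ˡ xs (+ 2) _) ⟩
  (∑[ x ∈ xs ] + 2 ℤ.* (∑[ y ∈ xs ] D x y ℤ.* (h x ℤ.* h y)))
    ≡⟨ ∑-cong xs (λ x → sym (∑-*ˡ xs (+ 2) _)) ⟩
  (∑[ x ∈ xs ] ∑[ y ∈ xs ] + 2 ℤ.* (D x y ℤ.* (h x ℤ.* h y)))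
    ≤⟨ ∑-mono xs (λ x → ∑-mono xs (λ y → pointwise x y)) ⟩
  (∑[ x ∈ xs ] ∑[ y ∈ xs ] D x y ℤ.* h² x ℤ.+ D x y ℤ.* h² y)
    ≡⟨ ∑-cong xs (λ x → ∑-+ xs _ _) ⟩
  (∑[ x ∈ xs ] (∑[ y ∈ xs ] D x y ℤ.* h² x) ℤ.+ (∑[ y ∈ xs ] D x y ℤ.* h² y))
    ≡⟨ ∑-+ xs _ _ ⟩
  (∑[ x ∈ xs ] ∑[ y ∈ xs ] D x y ℤ.* h² x) ℤ.+ (∑[ x ∈ xs ] ∑[ y ∈ xs ] D x y ℤ.* h² y)
    ≡⟨ cong (ℤ._+_ (∑[ x ∈ xs ] ∑[ y ∈ xs ] D x y ℤ.* h² x)) (trans (∑-swap xs xs _)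
         (∑-cong xs (λ y → ∑-cong xs (λ x → cong (ℤ._* h² y) (D-sym x y))))) ⟩
  (∑[ x ∈ xs ] ∑[ y ∈ xs ] D x y ℤ.* h² x) ℤ.+ (∑[ x ∈ xs ] ∑[ y ∈ xs ] D x y ℤ.* h² x)
    ≤⟨ ℤₚ.+-mono-≤ half half ⟩
  δ ℤ.* ∑ xs h² ℤ.+ δ ℤ.* ∑ xs h²
    ≡⟨ double (δ ℤ.* ∑ xs h²) ⟩
  + 2 ℤ.* (δ ℤ.* ∑ xs h²) ∎)
  where
  open ℤₚ.≤-Reasoning
  h² : _ → ℤ
  h² x = h x ℤ.* h x
  double : ∀ a → a ℤ.+ a ≡ + 2 ℤ.* a
  double = solve-∀
  rearrange : ∀ d a b → d ℤ.* (+ 2 ℤ.* (a ℤ.* b)) ≡ + 2 ℤ.* (d ℤ.* (a ℤ.* b))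
  rearrange = solve-∀
  pointwise : ∀ x y → + 2 ℤ.* (D x y ℤ.* (h x ℤ.* h y)) ℤ.≤ D x y ℤ.* h² x ℤ.+ D x y ℤ.* h² y
  pointwise x y = subst₂ ℤ._≤_ (rearrange (D x y) (h x) (h y)) (ℤₚ.*-distribˡ-+ (D x y) (h² x) (h² y))
    (ℤₚ.*-monoˡ-≤-nonNeg (D x y) {{ℤ.nonNegative (D≥0 x y)}} (2ab≤a²+b² (h x) (h y)))
  half : (∑[ x ∈ xs ] ∑[ y ∈ xs ] D x y ℤ.* h² x) ℤ.≤ δ ℤ.* ∑ xs h²
  half = subst₂ ℤ._≤_ (∑-cong xs (λ x → sym (∑-*ʳ xs (h² x) (D x)))) (∑-*ˡ xs δ h²)
    (∑-mono xs (λ x → ℤₚ.*-monoʳ-≤-nonNeg (h² x) {{ℤ.nonNegative (0≤i² (h x))}} (row x)))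

-- Sums over a full period

Periodic : ℕ → (ℕ → ℤ) → Set
Periodic N f = ∀ i → f (i + N) ≡ f i

periodic-* : ∀ {N f} → Periodic N f → ∀ k i → f (i + k * N) ≡ f i
periodic-* {N} {f} per zero    i = cong f (ℕₚ.+-identityʳ i)
periodic-* {N} {f} per (suc k) i = trans (cong f (trans (cong (_+_ i) (ℕₚ.+-comm N (k * N))) (sym (ℕₚ.+-assoc i (k * N) N))))
  (trans (per (i + k * N)) (periodic-* {N} {f} per k i))

∑<-suc : ∀ N (f : ℕ → ℤ) → (∑[ i < N ] f (suc i)) ℤ.+ f 0 ≡ f N ℤ.+ ∑< N f
∑<-suc zero    f = ℤₚ.+-comm 0ℤ (f 0)
∑<-suc (suc N) f = trans (ℤₚ.+-assoc (f (suc N)) _ (f 0)) (cong (ℤ._+_ (f (suc N))) (∑<-suc N f))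

∑<-shift : ∀ N f → Periodic N f → ∀ k → (∑[ i < N ] f (i + k)) ≡ ∑< N f
∑<-shift N f per zero    = ∑-cong (downFrom N) (λ i → cong f (ℕₚ.+-identityʳ i))
∑<-shift N f per (suc k) = trans (ℤ+.∙-cancelʳ (g 0) _ _ step) (∑<-shift N f per k)
  where
  g : ℕ → ℤ
  g i = f (i + k)
  step : (∑[ i < N ] f (i + suc k)) ℤ.+ g 0 ≡ ∑< N g ℤ.+ g 0
  step = begin
    (∑[ i < N ] f (i + suc k)) ℤ.+ g 0  ≡⟨ cong (ℤ._+ g 0) (∑-cong (downFrom N) (λ i → cong f (ℕₚ.+-suc i k))) ⟩
    (∑[ i < N ] g (suc i)) ℤ.+ g 0      ≡⟨ ∑<-suc N g ⟩
    g N ℤ.+ ∑< N g                      ≡⟨ cong (ℤ._+ ∑< N g) (trans (cong f (ℕₚ.+-comm N k)) (per k)) ⟩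
    g 0 ℤ.+ ∑< N g                      ≡⟨ ℤₚ.+-comm (g 0) _ ⟩
    ∑< N g ℤ.+ g 0                      ∎
    where open ≡-Reasoning

∑<-+ : ∀ M N (f : ℕ → ℤ) → ∑< (M + N) f ≡ (∑[ i < M ] f (i + N)) ℤ.+ ∑< N f
∑<-+ zero    N f = sym (ℤₚ.+-identityˡ _)
∑<-+ (suc M) N f = trans (cong (ℤ._+_ (f (M + N))) (∑<-+ M N f)) (sym (ℤₚ.+-assoc (f (M + N)) _ _))

∑<-* : ∀ k N f → Periodic N f → ∑< (k * N) f ≡ + k ℤ.* ∑< N f
∑<-* zero    N f per = refl
∑<-* (suc k) N f per = begin
  ∑< (N + k * N) f                                ≡⟨ ∑<-+ N (k * N) f ⟩
  (∑[ i < N ] f (i + k * N)) ℤ.+ ∑< (k * N) f     ≡⟨ cong₂ ℤ._+_ (∑-cong (downFrom N) (periodic-* {N} {f} per k)) (∑<-* k N f per) ⟩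
  ∑< N f ℤ.+ + k ℤ.* ∑< N f                       ≡⟨ sym (ℤₚ.suc-* (+ k) (∑< N f)) ⟩
  + suc k ℤ.* ∑< N f                              ∎
  where open ≡-Reasoning

∑<-even≤ : ∀ M (f : ℕ → ℤ) → (∀ i → 0ℤ ℤ.≤ f i) → (∑[ i < M ] f (2 * i)) ℤ.≤ ∑< (2 * M) f
∑<-even≤ zero    f f≥0 = ℤₚ.≤-refl
∑<-even≤ (suc M) f f≥0 = begin
  f (2 * M) ℤ.+ ∑< M (λ i → f (2 * i))                  ≤⟨ ℤₚ.+-monoʳ-≤ (f (2 * M)) (∑<-even≤ M f f≥0) ⟩
  ∑< (suc (2 * M)) f                                    ≡⟨ sym (ℤₚ.+-identityˡ (∑< (suc (2 * M)) f)) ⟩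
  0ℤ ℤ.+ ∑< (suc (2 * M)) f                             ≤⟨ ℤₚ.+-monoˡ-≤ (∑< (suc (2 * M)) f) (f≥0 (suc (2 * M))) ⟩
  ∑< (suc (suc (2 * M))) f                              ≡⟨ cong (λ k → ∑< (suc k) f) (sym (ℕₚ.+-suc M (M + 0))) ⟩
  ∑< (2 * suc M) f                                      ∎
  where open ℤₚ.≤-Reasoning

-- Doubling runs twice through the even residues mod `2 * M`, and these are only a part of the full
-- period. One of the factors 2 of the final constant arises here.
∑<-double≤ : ∀ M (f : ℕ → ℤ) → (∀ i → 0ℤ ℤ.≤ f i) → Periodic (2 * M) f →
  (∑[ i < 2 * M ] f (2 * i)) ℤ.≤ + 2 ℤ.* ∑< (2 * M) f
∑<-double≤ M f f≥0 per = begin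
  ∑< (2 * M) (λ i → f (2 * i))      ≡⟨ ∑<-* 2 M (λ i → f (2 * i)) per′ ⟩
  + 2 ℤ.* ∑< M (λ i → f (2 * i))    ≤⟨ ℤₚ.*-monoˡ-≤-nonNeg (+ 2) (∑<-even≤ M f f≥0) ⟩
  + 2 ℤ.* ∑< (2 * M) f              ∎
  where
  open ℤₚ.≤-Reasoning
  per′ : Periodic M (λ i → f (2 * i))
  per′ i = trans (cong f (ℕₚ.*-distribˡ-+ 2 i M)) (per (2 * i))

-- Indicators and counting with duplicate-free lists

ind : {P : Set} → Dec P → ℤ
ind (yes _) = 1ℤ
ind (no _)  = 0ℤ

ind-yes : {P : Set} (d : Dec P) → P → ind d ≡ 1ℤ
ind-yes (yes _) p = refl
ind-yes (no ¬p) p = contradiction p ¬p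

ind-no : {P : Set} (d : Dec P) → ¬ P → ind d ≡ 0ℤ
ind-no (yes p) ¬p = contradiction p ¬p
ind-no (no _)  ¬p = refl

ind-cong : {P Q : Set} (d : Dec P) (e : Dec Q) → (P → Q) → (Q → P) → ind d ≡ ind e
ind-cong (yes p) e f g = sym (ind-yes e (f p))
ind-cong (no ¬p) e f g = sym (ind-no e (¬p ∘ g))

0≤ind : {P : Set} (d : Dec P) → 0ℤ ℤ.≤ ind d
0≤ind (yes _) = ℤ.+≤+ z≤n
0≤ind (no _)  = ℤₚ.≤-refl

∑-ind≡length-filter : {P : I → Set} (P? : Decidable P) (xs : List I) →
  (∑[ x ∈ xs ] ind (P? x)) ≡ + length (filter P? xs)
∑-ind≡length-filter P? [] = refl
∑-ind≡length-filter P? (x ∷ xs) with P? x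
... | yes _ = cong (ℤ._+_ 1ℤ) (∑-ind≡length-filter P? xs)
... | no  _ = trans (ℤₚ.+-identityˡ _) (∑-ind≡length-filter P? xs)

∑-ind-unique : {P : I → Set} (P? : Decidable P) {xs : List I} → Unique xs →
  ∀ {a} → a ∈ xs → P a → (∀ {x} → x ∈ xs → P x → x ≡ a) → (∑[ x ∈ xs ] ind (P? x)) ≡ 1ℤ
∑-ind-unique P? {x ∷ xs} (x∉ ∷ uxs) (here refl) Pa uniq =
  cong₂ ℤ._+_ (ind-yes (P? x) Pa)
    (trans (∑-cong-∈ xs (λ y y∈ → ind-no (P? y) (λ Py → All.lookup x∉ y∈ (sym (uniq (there y∈) Py)))))
      (trans (∑-const xs 0ℤ) (ℤₚ.*-zeroʳ (+ length xs))))
∑-ind-unique P? {x ∷ xs} (x∉ ∷ uxs) (there a∈) Pa uniq =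
  cong₂ ℤ._+_ (ind-no (P? x) (λ Px → All.lookup x∉ a∈ (uniq (here refl) Px)))
    (∑-ind-unique P? uxs a∈ Pa (λ y∈ → uniq (there y∈)))

unique-⊆⇒length≤ : {xs ys : List I} → Unique xs → (∀ {x} → x ∈ xs → x ∈ ys) → length xs ≤ length ys
unique-⊆⇒length≤ {xs = []}     u        sub = z≤n
unique-⊆⇒length≤ {xs = x ∷ xs} {ys} (x∉ ∷ u) sub with ∈-∃++ (sub (here refl))
... | ys₁ , ys₂ , refl = subst (suc (length xs) ≤_) (sym (↭-length (shift x ys₁ ys₂)))
  (s≤s (unique-⊆⇒length≤ u sub′))
  where
  sub′ : ∀ {y} → y ∈ xs → y ∈ ys₁ ++ ys₂
  sub′ y∈ with ∈-resp-↭ (shift x ys₁ ys₂) (sub (there y∈))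
  ... | here y≡x = contradiction (sym y≡x) (All.lookup x∉ y∈)
  ... | there y∈′ = y∈′

-- Pigeonhole: an element of `ys` missing from `xs` could be put in front of `xs`, which would then
-- be too long.
unique-⊆-length⇒⊇ : DecidableEquality I → {xs ys : List I} → Unique xs → (∀ {x} → x ∈ xs → x ∈ ys) →
  length ys ≤ length xs → ∀ {y} → y ∈ ys → y ∈ xs
unique-⊆-length⇒⊇ _≟_ {xs} {ys} u sub len {y} y∈ with any? (y ≟_) xs
... | yes y∈xs = y∈xs
... | no  y∉xs = contradiction len (ℕₚ.<⇒≱ (unique-⊆⇒length≤ {xs = y ∷ xs} {ys}
  (Allₚ.¬Any⇒All¬ xs y∉xs ∷ u) λ { (here refl) → y∈ ; (there x∈) → sub x∈ }))

unique-⊆⊇⇒↭ : {xs ys : List I} → Unique xs → Unique ys →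
  (∀ {x} → x ∈ xs → x ∈ ys) → (∀ {x} → x ∈ ys → x ∈ xs) → xs ↭ ys
unique-⊆⊇⇒↭ ux uy f g = ∼bag⇒↭ (unique∧set⇒bag ux uy (mk⇔ f g))

-- Prime divisors and square-free divisors

prime∣prime⇒≡ : ∀ {p l} → Prime p → Prime l → p ∣ l → p ≡ l
prime∣prime⇒≡ pp pl p∣l with prime⇒irreducible pl p∣l
... | inj₁ refl = contradiction pp ¬prime[1]
... | inj₂ p≡l  = p≡l

prime∤1 : ∀ {p} → Prime p → p ∤ 1
prime∤1 pp p∣1 with refl ← ∣1⇒≡1 p∣1 = ¬prime[1] pp

prime-factor : ∀ n → n ≢ 0 → n ≢ 1 → ∃ λ p → Prime p × p ∣ n
prime-factor zero      n≢0 n≢1 = contradiction refl n≢0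
prime-factor n@(suc _) n≢0 n≢1 with factorise n
... | record { factors = [] ; isFactorisation = n≡ } = contradiction n≡ n≢1
... | record { factors = p ∷ ps ; isFactorisation = n≡ ; factorsPrime = pp ∷ _ } =
  p , pp , subst (p ∣_) (sym n≡) (m∣m*n (product ps))

no-common-prime⇒gcd≡1 : ∀ a m → m ≢ 0 → (∀ {p} → Prime p → p ∣ a → p ∤ m) → gcd a m ≡ 1
no-common-prime⇒gcd≡1 a m m≢0 none with gcd a m ℕ.≟ 1
... | yes e = e
... | no ¬e = contradiction (∣-trans p∣g (gcd[m,n]∣n a m)) (none pp (∣-trans p∣g (gcd[m,n]∣m a m)))
  where
  g≢0 : gcd a m ≢ 0
  g≢0 g≡0 with gcd[m,n]∣n a m
  ... | divides k m≡ = m≢0 (trans m≡ (trans (cong (k *_) g≡0) (ℕₚ.*-zeroʳ k)))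
  factor : ∃ λ p → Prime p × p ∣ gcd a m
  factor = prime-factor (gcd a m) g≢0 ¬e
  pp = proj₁ (proj₂ factor)
  p∣g = proj₂ (proj₂ factor)

prime∣product⇒∈ : ∀ {p} → Prime p → (L : List ℕ) → All Prime L → p ∣ product L → p ∈ L
prime∣product⇒∈ pp []      []         p∣ = contradiction p∣ (prime∤1 pp)
prime∣product⇒∈ pp (l ∷ L) (pl ∷ pL) p∣ with euclidsLemma l (product L) pp p∣
... | inj₁ p∣l = here (prime∣prime⇒≡ pp pl p∣l)
... | inj₂ p∣L = there (prime∣product⇒∈ pp L pL p∣L)

prime∤product : ∀ {l L} → Prime l → All Prime L → All (l ≢_) L → l ∤ product L
prime∤product {L = L} pl pL l∉ l∣ = All.lookup l∉ (prime∣product⇒∈ pl L pL l∣) refl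

product∣ : ∀ {m} (L : List ℕ) → All Prime L → Unique L → All (_∣ m) L → product L ∣ m
product∣ {m} []      []        []        []        = divides m (sym (ℕₚ.*-identityʳ m))
product∣ {m} (l ∷ L) (pl ∷ pL) (l∉ ∷ uL) (l∣m ∷ L∣m) with product∣ L pL uL L∣m
... | divides c refl with euclidsLemma c (product L) pl l∣m
...   | inj₁ l∣c = *-monoˡ-∣ (product L) l∣c
...   | inj₂ l∣L = contradiction l∣L (prime∤product pl pL l∉)

isPrimeDivisor? : ∀ m → Decidable (λ p → Prime p × p ∣ m)
isPrimeDivisor? m p with prime? p | p ∣? m
... | yes pp | yes p∣m = yes (pp , p∣m)
... | no ¬pp | _       = no (¬pp ∘ proj₁)
... | _      | no p∤m  = no (p∤m ∘ proj₂)

primes : ℕ → List ℕ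
primes m = filter (isPrimeDivisor? m) (upTo (suc m))

primes-prime : ∀ m → All Prime (primes m)
primes-prime m = All.tabulate (λ l∈ → proj₁ (proj₂ (∈-filter⁻ (isPrimeDivisor? m) {xs = upTo (suc m)} l∈)))

primes-∣ : ∀ m → All (_∣ m) (primes m)
primes-∣ m = All.tabulate (λ l∈ → proj₂ (proj₂ (∈-filter⁻ (isPrimeDivisor? m) {xs = upTo (suc m)} l∈)))

primes-unique : ∀ m → Unique (primes m)
primes-unique m = Uniqueₚ.filter⁺ (isPrimeDivisor? m) (Uniqueₚ.upTo⁺ (suc m))

∈-primes : ∀ {m p} → m ≢ 0 → Prime p → p ∣ m → p ∈ primes m
∈-primes {m} {p} m≢0 pp p∣m = ∈-filter⁺ (isPrimeDivisor? m)
  (∈-upTo⁺ (s≤s (∣⇒≤ {{ℕ.≢-nonZero m≢0}} p∣m))) (pp , p∣m)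

-- Chinese remaindering: take for s the product of the primes of N not dividing i.
coprime-lift : ∀ i Q N → Q ∣ N → N ≢ 0 → gcd i Q ≡ 1 → ∃ λ s → gcd (i + Q * s) N ≡ 1
coprime-lift i Q N Q∣N N≢0 gcd≡1 = s , no-common-prime⇒gcd≡1 (i + Q * s) N N≢0 none
  where
  ∤i? : Decidable (λ l → l ∤ i)
  ∤i? l with l ∣? i
  ... | yes l∣i = no (λ l∤i → l∤i l∣i)
  ... | no  l∤i = yes l∤i
  L = filter ∤i? (primes N)
  s = product L
  L-prime : All Prime L
  L-prime = Allₚ.filter⁺ ∤i? (primes-prime N)
  none : ∀ {p} → Prime p → p ∣ i + Q * s → p ∤ N
  none {p} pp p∣ p∣N with p ∣? i
  ... | no  p∤i = p∤i (∣m+n∣m⇒∣n (subst (p ∣_) (ℕₚ.+-comm i (Q * s)) p∣)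
                    (∣n⇒∣m*n Q (∈⇒∣product (∈-filter⁺ ∤i? (∈-primes N≢0 pp p∣N) p∤i))))
  ... | yes p∣i with euclidsLemma Q s pp (∣m+n∣m⇒∣n p∣ p∣i)
  ...   | inj₁ p∣Q = prime∤1 pp (subst (p ∣_) gcd≡1 (gcd-greatest p∣i p∣Q))
  ...   | inj₂ p∣s = proj₂ (∈-filter⁻ ∤i? {xs = primes N} (prime∣product⇒∈ pp L L-prime p∣s)) p∣i

products : List ℕ → List ℕ
products []      = 1 ∷ []
products (l ∷ L) = products L ++ map (l *_) (products L)

length-products : ∀ L → length (products L) ≡ 2 ^ length L
length-products []      = refl
length-products (l ∷ L) = begin
  length (products L ++ map (l *_) (products L))             ≡⟨ length-++ (products L) ⟩
  length (products L) + length (map (l *_) (products L))     ≡⟨ cong₂ _+_ (length-products L) (trans (length-map (l *_) (products L)) (length-products L)) ⟩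
  2 ^ length L + 2 ^ length L                                ≡⟨ cong (λ k → 2 ^ length L + k) (sym (ℕₚ.+-identityʳ _)) ⟩
  2 ^ length (l ∷ L)                                         ∎
  where open ≡-Reasoning

products-∣ : ∀ L {d} → d ∈ products L → d ∣ product L
products-∣ []      (here refl) = ∣-refl
products-∣ (l ∷ L) {d} d∈ with ∈-++⁻ (products L) d∈
... | inj₁ d∈L = ∣n⇒∣m*n l (products-∣ L d∈L)
... | inj₂ d∈lL with ∈-map⁻ (l *_) d∈lL
...   | e , e∈ , refl = *-monoʳ-∣ l (products-∣ L e∈)

products-unique : ∀ L → All Prime L → Unique L → Unique (products L)
products-unique []      []        []        = [] ∷ []
products-unique (l ∷ L) (pl ∷ pL) (l∉ ∷ uL) = Uniqueₚ.++⁺ (products-unique L pL uL)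
  (Uniqueₚ.map⁺ (ℕₚ.*-cancelˡ-≡ _ _ l {{prime⇒nonZero pl}}) (products-unique L pL uL)) disjoint
  where
  disjoint : ∀ {d} → ¬ (d ∈ products L × d ∈ map (l *_) (products L))
  disjoint (d∈ , d∈l) with ∈-map⁻ (l *_) d∈l
  ... | e , _ , refl = prime∤product pl pL l∉ (∣-trans (m∣m*n e) (products-∣ L d∈))

products-squareFree : ∀ L → All Prime L → Unique L → ∀ {d} → d ∈ products L → ∀ {p} → Prime p → p * p ∤ d
products-squareFree []      []        []        (here refl) {p} pp p²∣ = prime∤1 pp (∣-trans (m∣m*n p) p²∣)
products-squareFree (l ∷ L) (pl ∷ pL) (l∉ ∷ uL) d∈ {p} pp p²∣ with ∈-++⁻ (products L) d∈
... | inj₁ d∈L = products-squareFree L pL uL d∈L pp p²∣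
... | inj₂ d∈lL with ∈-map⁻ (l *_) d∈lL
...   | e , e∈ , refl with p ℕ.≟ l
...     | yes refl = prime∤product pl pL l∉ (∣-trans (*-cancelˡ-∣ p {{prime⇒nonZero pp}} p²∣) (products-∣ L e∈))
...     | no p≢l with euclidsLemma l e pp (∣-trans (m∣m*n p) p²∣)
...       | inj₁ p∣l = p≢l (prime∣prime⇒≡ pp pl p∣l)
...       | inj₂ (divides f refl) = products-squareFree L pL uL e∈ pp (*-monoˡ-∣ p p∣f)
  where
  p∣lf : p ∣ l * f
  p∣lf = *-cancelˡ-∣ p {{prime⇒nonZero pp}} (subst (p * p ∣_) (lemma l f p) p²∣)
    where
    lemma : ∀ l f p → l * (f * p) ≡ p * (l * f)
    lemma = +-*-Solver.solve 3 (λ l f p → l :* (f :* p) := p :* (l :* f)) refl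
      where open +-*-Solver
  p∣f : p ∣ f
  p∣f with euclidsLemma l f pp p∣lf
  ... | inj₁ p∣l = contradiction (prime∣prime⇒≡ pp pl p∣l) p≢l
  ... | inj₂ p∣f = p∣f

T-all : {A : Set} (b : A → Bool) (xs : List A) → (∀ x → T (b x)) → T (Data.Bool.ListAction.all b xs)
T-all b []       t = tt
T-all b (x ∷ xs) t with b x | t x
... | true | _ = T-all b xs t

T-not-does : {P : Set} (d : Dec P) → ¬ P → T (not (does d))
T-not-does (yes p) ¬p = contradiction p ¬p
T-not-does (no _)  ¬p = tt

T-does-∧ : {P : Set} {b : Bool} (d : Dec P) → P → T b → T (does d ∧ b)
T-does-∧ (yes _) p t = t
T-does-∧ (no ¬p) p t = contradiction p ¬p

-- This is the direction that the sieve wants: it produces one error term for each set of primes of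
-- `m`, and the products of these sets are distinct square-free divisors.
2^ω≤W : ∀ m → m ≢ 0 → 2 ^ length (primes m) ≤ W m
2^ω≤W m m≢0 = subst₂ _≤_ (length-products L) (length-map suc squareFreeDivisors)
  (unique-⊆⇒length≤ (products-unique L (primes-prime m) (primes-unique m)) sub)
  where
  L = primes m
  squareFreeDivisors : List ℕ
  squareFreeDivisors = filter (λ j → Data.Bool.Properties.T? (does (suc j ∣? m) ∧ squareFree? (suc j))) (upTo m)
  product∣m : product L ∣ m
  product∣m = product∣ L (primes-prime m) (primes-unique m) (primes-∣ m)
  square∤ : ∀ {d} → d ∈ products L → ∀ j → suc (suc j) * suc (suc j) ∤ d
  square∤ d∈ j k²∣d with prime-factor (suc (suc j)) (λ ()) (λ ())
  ... | p , pp , p∣k = products-squareFree L (primes-prime m) (primes-unique m) d∈ pp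
    (∣-trans (∣-trans (*-monoʳ-∣ p p∣k) (*-monoˡ-∣ (suc (suc j)) p∣k)) k²∣d)
  sub : ∀ {d} → d ∈ products L → d ∈ map suc squareFreeDivisors
  sub {zero}  d∈ with ∣-trans (products-∣ L d∈) product∣m
  ... | divides k m≡ = contradiction (trans m≡ (ℕₚ.*-zeroʳ k)) m≢0
  sub {suc j} d∈ = ∈-map⁺ suc (∈-filter⁺ _ (∈-upTo⁺ (∣⇒≤ {{ℕ.≢-nonZero m≢0}} d∣m))
    (T-does-∧ (suc j ∣? m) d∣m (T-all _ (upTo (suc j)) (λ i → T-not-does (_ ∣? _) (square∤ d∈ i)))))
    where
    d∣m : suc j ∣ m
    d∣m = ∣-trans (products-∣ L d∈) product∣m

-- Ramanujan sums

-- Truncated subtraction does no harm: for `a < b` the difference is 0. The users below arrange the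
-- order so that it is a true difference.
%-≡⇒∣∸ : ∀ {a b l} .{{_ : NonZero l}} → a % l ≡ b % l → l ∣ a ∸ b
%-≡⇒∣∸ {a} {b} {l} e = divides (a / l ∸ b / l) (begin
  a ∸ b                                          ≡⟨ cong₂ _∸_ (m≡m%n+[m/n]*n a l) (m≡m%n+[m/n]*n b l) ⟩
  (a % l + a / l * l) ∸ (b % l + b / l * l)      ≡⟨ cong (λ r → (r + a / l * l) ∸ (b % l + b / l * l)) e ⟩
  (b % l + a / l * l) ∸ (b % l + b / l * l)      ≡⟨ ℕₚ.[m+n]∸[m+o]≡n∸o (b % l) _ _ ⟩
  a / l * l ∸ b / l * l                          ≡⟨ sym (ℕₚ.*-distribʳ-∸ l (a / l) (b / l)) ⟩
  (a / l ∸ b / l) * l                            ∎)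
  where open ≡-Reasoning

progression-∸ : ∀ y z i j → (y + i * z) ∸ (y + j * z) ≡ (i ∸ j) * z
progression-∸ y z i j = trans (ℕₚ.[m+n]∸[m+o]≡n∸o y (i * z) (j * z)) (sym (ℕₚ.*-distribʳ-∸ z i j))

∤-<-∸ : ∀ {i j l} → j < i → i < l → l ∤ i ∸ j
∤-<-∸ {i} {j} j<i i<l l∣ = ℕₚ.<⇒≱ (ℕₚ.≤-<-trans (ℕₚ.m∸n≤m i j) i<l)
  (∣⇒≤ {{ℕ.≢-nonZero (ℕₚ.m>n⇒m∸n≢0 j<i)}} l∣)

∤-progression-∸ : ∀ {l} → Prime l → ∀ {z} → l ∤ z → ∀ y {i j} → j < i → i < l → l ∤ (y + i * z) ∸ (y + j * z)
∤-progression-∸ {l} pl {z} l∤z y {i} {j} j<i i<l l∣ with euclidsLemma (i ∸ j) z pl (subst (l ∣_) (progression-∸ y z i j) l∣)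
... | inj₁ l∣i-j = ∤-<-∸ j<i i<l l∣i-j
... | inj₂ l∣z   = l∤z l∣z

-- `z` is invertible mod `l`, but no inverse is computed: the `l` residues are distinct, so by
-- pigeonhole exactly one of them is 0.
∑-progression : ∀ {l} → Prime l → ∀ {z} → l ∤ z → ∀ y → (∑[ k < l ] ind (l ∣? (y + k * z))) ≡ 1ℤ
∑-progression {l} pl {z} l∤z y = hit (∈-applyDownFrom⁻ residue 0∈)
  where
  instance
    l≢0 : NonZero l
    l≢0 = prime⇒nonZero pl
  residue : ℕ → ℕ
  residue k = (y + k * z) % l
  residues-unique : Unique (applyDownFrom residue l)
  residues-unique = Uniqueₚ.applyDownFrom⁺₁ residue l
    (λ j<i i<l e → ∤-progression-∸ pl l∤z y j<i i<l (%-≡⇒∣∸ e))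
  0∈ : 0 ∈ applyDownFrom residue l
  0∈ = unique-⊆-length⇒⊇ ℕ._≟_ residues-unique sub
    (ℕₚ.≤-reflexive (trans (length-downFrom l) (sym (length-applyDownFrom residue l))))
    (∈-downFrom⁺ {l} (ℕₚ.n≢0⇒n>0 (ℕ.≢-nonZero⁻¹ l)))
    where
    sub : ∀ {x} → x ∈ applyDownFrom residue l → x ∈ downFrom l
    sub x∈ with ∈-applyDownFrom⁻ residue x∈
    ... | k , _ , refl = ∈-downFrom⁺ (m%n<n (y + k * z) l)
  hit : (∃ λ k → k < l × 0 ≡ residue k) → (∑[ k < l ] ind (l ∣? (y + k * z))) ≡ 1ℤ
  hit (a , a<l , e) = ∑-ind-unique (λ k → l ∣? (y + k * z)) (Uniqueₚ.downFrom⁺ l) (∈-downFrom⁺ a<l)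
    (m%n≡0⇒n∣m _ l (sym e)) (λ x∈ l∣ → same (∈-downFrom⁻ x∈) l∣)
    where
    same : ∀ {x} → x < l → l ∣ y + x * z → x ≡ a
    same {x} x<l l∣ with ℕₚ.<-cmp x a
    ... | tri< x<a _ _ = contradiction (%-≡⇒∣∸ (trans (sym e) (sym (n∣m⇒m%n≡0 _ l l∣)))) (∤-progression-∸ pl l∤z y x<a a<l)
    ... | tri≈ _ x≡a _ = x≡a
    ... | tri> _ _ a<x = contradiction (%-≡⇒∣∸ (trans (n∣m⇒m%n≡0 _ l l∣) e)) (∤-progression-∸ pl l∤z y a<x x<l)

-- A substitute for the Chinese remainder theorem: shifts by multiples of `z` leave `u` fixed, so
-- `w` may be replaced by its sum along the shifts. It is applied with `z` a product of primes other
-- than `l` and with `w` of period `l`, so that the shifts run through all residues mod `l`.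
∑<-average : ∀ N l z (w u : ℕ → ℤ) → Periodic N w → Periodic N u → Periodic z u →
  + l ℤ.* ∑< N (λ x → w x ℤ.* u x) ≡ (∑[ x < N ] (∑[ k < l ] w (x + k * z)) ℤ.* u x)
∑<-average N l z w u perw peru perz = sym (begin
  (∑[ x < N ] (∑[ k < l ] w (x + k * z)) ℤ.* u x)
    ≡⟨ ∑-cong (downFrom N) (λ x → sym (∑-*ʳ (downFrom l) (u x) (λ k → w (x + k * z)))) ⟩
  (∑[ x < N ] ∑[ k < l ] w (x + k * z) ℤ.* u x)
    ≡⟨ ∑-swap (downFrom N) (downFrom l) _ ⟩
  (∑[ k < l ] ∑[ x < N ] w (x + k * z) ℤ.* u x)
    ≡⟨ ∑-cong (downFrom l) (λ k → ∑-cong (downFrom N) (λ x → cong (w (x + k * z) ℤ.*_) (sym (periodic-* {z} {u} perz k x)))) ⟩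
  (∑[ k < l ] ∑[ x < N ] w (x + k * z) ℤ.* u (x + k * z))
    ≡⟨ ∑-cong (downFrom l) (λ k → ∑<-shift N (λ x → w x ℤ.* u x) (λ x → cong₂ ℤ._*_ (perw x) (peru x)) (k * z)) ⟩
  (∑[ k < l ] ∑< N (λ x → w x ℤ.* u x))
    ≡⟨ ∑-const (downFrom l) _ ⟩
  + length (downFrom l) ℤ.* ∑< N (λ x → w x ℤ.* u x)
    ≡⟨ cong (λ k → + k ℤ.* _) (length-downFrom l) ⟩
  + l ℤ.* ∑< N (λ x → w x ℤ.* u x) ∎)
  where open ≡-Reasoning

-- h l is the Ramanujan sum i ↦ c_l(i) for a prime l, and H L that of the modulus ∏ L.
h : ℕ → ℕ → ℤ
h l i = + l ℤ.* ind (l ∣? i) ℤ.- 1ℤ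

H : List ℕ → ℕ → ℤ
H []      i = 1ℤ
H (l ∷ L) i = h l i ℤ.* H L i

free : List ℕ → ℕ → ℤ
free []      i = 1ℤ
free (l ∷ L) i = (1ℤ ℤ.- ind (l ∣? i)) ℤ.* free L i

-- Euler's function of `product L` when the primes in `L` are distinct.
Φ : List ℕ → ℤ
Φ []      = 1ℤ
Φ (l ∷ L) = (+ l ℤ.- 1ℤ) ℤ.* Φ L

ind-∣-cong : ∀ {l i j} → (l ∣ i → l ∣ j) → (l ∣ j → l ∣ i) → ind (l ∣? i) ≡ ind (l ∣? j)
ind-∣-cong {l} {i} {j} = ind-cong (l ∣? i) (l ∣? j)

ind-∣-periodic : ∀ {l z} → l ∣ z → ∀ i → ind (l ∣? (i + z)) ≡ ind (l ∣? i)
ind-∣-periodic {l} {z} l∣z i = ind-∣-cong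
  (λ l∣ → ∣m+n∣m⇒∣n (subst (l ∣_) (ℕₚ.+-comm i z) l∣) l∣z) (λ l∣i → ∣m∣n⇒∣m+n l∣i l∣z)

H-periodic : ∀ {z} L → All (_∣ z) L → Periodic z (H L)
H-periodic []      []          i = refl
H-periodic (l ∷ L) (l∣z ∷ L∣z) i =
  cong₂ ℤ._*_ (cong (λ t → + l ℤ.* t ℤ.- 1ℤ) (ind-∣-periodic l∣z i)) (H-periodic L L∣z i)

free-periodic : ∀ {z} L → All (_∣ z) L → Periodic z (free L)
free-periodic []      []          i = refl
free-periodic (l ∷ L) (l∣z ∷ L∣z) i =
  cong₂ ℤ._*_ (cong (λ t → 1ℤ ℤ.- t) (ind-∣-periodic l∣z i)) (free-periodic L L∣z i)

H[0]≡Φ : ∀ L → H L 0 ≡ Φ L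
H[0]≡Φ []      = refl
H[0]≡Φ (l ∷ L) = cong₂ ℤ._*_
  (cong (ℤ._- 1ℤ) (trans (cong (+ l ℤ.*_) (ind-yes (l ∣? 0) (divides 0 refl))) (ℤₚ.*-identityʳ (+ l)))) (H[0]≡Φ L)

∣product-all : ∀ L → All (_∣ product L) L
∣product-all L = All.tabulate ∈⇒∣product

periodic-affine : ∀ {z} {f : ℕ → ℤ} → Periodic z f → ∀ i ν → Periodic z (λ x → f (i + ν * x))
periodic-affine {z} {f} per i ν x = trans (cong f (lemma i ν x z)) (periodic-* {z} {f} per ν (i + ν * x))
  where
  lemma : ∀ i ν x z → i + ν * (x + z) ≡ i + ν * x + ν * z
  lemma = +-*-Solver.solve 4 (λ i ν x z → i :+ ν :* (x :+ z) := i :+ ν :* x :+ ν :* z) refl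
    where open +-*-Solver

-- The one-prime case of the reproducing property. Each indicator alone sums to 1 over the
-- progression, so only the product of the two carries information, and that product is governed by
-- whether `l` divides `i`.
∑-h-correlation : ∀ {l} → Prime l → ∀ {ν z} → l ∤ ν → l ∤ z → ∀ i x →
  (∑[ k < l ] h l (x + k * z) ℤ.* h l (i + ν * (x + k * z))) ≡ + l ℤ.* h l i
∑-h-correlation {l} pl {ν} {z} l∤ν l∤z i x = begin
  (∑[ k < l ] h l (x + k * z) ℤ.* h l (i + ν * (x + k * z)))
    ≡⟨ ∑-cong (downFrom l) pointwise ⟩
  (∑[ k < l ] (c ℤ.* a k ℤ.- + l ℤ.* b k) ℤ.+ 1ℤ)
    ≡⟨ trans (∑-+ (downFrom l) _ _) (cong₂ ℤ._+_ (trans (∑-- (downFrom l) _ _)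
         (cong₂ ℤ._-_ (trans (∑-*ˡ (downFrom l) c a) (cong (c ℤ.*_) (∑-progression pl l∤z x)))
                      (trans (∑-*ˡ (downFrom l) (+ l) b) (cong (+ l ℤ.*_) ∑b))))
         (trans (∑-const (downFrom l) 1ℤ) (cong (λ n → + n ℤ.* 1ℤ) (length-downFrom l)))) ⟩
  (c ℤ.* 1ℤ ℤ.- + l ℤ.* 1ℤ) ℤ.+ + l ℤ.* 1ℤ
    ≡⟨ collect (+ l) A ⟩
  + l ℤ.* h l i ∎
  where
  open ≡-Reasoning
  A = ind (l ∣? i)
  c = + l ℤ.* + l ℤ.* A ℤ.- + l
  a b : ℕ → ℤ
  a k = ind (l ∣? (x + k * z))
  b k = ind (l ∣? (i + ν * (x + k * z)))
  ∑b : ∑< l b ≡ 1ℤ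
  ∑b = trans (∑-cong (downFrom l) (λ k → cong (λ t → ind (l ∣? t)) (affine i ν x k z)))
    (∑-progression pl l∤νz (i + ν * x))
    where
    affine : ∀ i ν x k z → i + ν * (x + k * z) ≡ i + ν * x + k * (ν * z)
    affine = +-*-Solver.solve 5 (λ i ν x k z → i :+ ν :* (x :+ k :* z) := i :+ ν :* x :+ k :* (ν :* z)) refl
      where open +-*-Solver
    l∤νz : l ∤ ν * z
    l∤νz l∣ with euclidsLemma ν z pl l∣
    ... | inj₁ l∣ν = l∤ν l∣ν
    ... | inj₂ l∣z = l∤z l∣z
  -- On the support of `a` the argument `i + ν (x + kz)` is congruent to `i` mod `l`, so `b k`
  -- becomes the constant `A`.
  ab : ∀ k → a k ℤ.* b k ≡ a k ℤ.* A
  ab k with l ∣? (x + k * z)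
  ... | no _ = refl
  ... | yes l∣ = cong (1ℤ ℤ.*_) (ind-∣-cong
    (λ l∣i+ → ∣m+n∣m⇒∣n (subst (l ∣_) (ℕₚ.+-comm i _) l∣i+) (∣n⇒∣m*n ν l∣))
    (λ l∣i → ∣m∣n⇒∣m+n l∣i (∣n⇒∣m*n ν l∣)))
  expand : ∀ l a b → (l ℤ.* a ℤ.- 1ℤ) ℤ.* (l ℤ.* b ℤ.- 1ℤ) ≡ l ℤ.* l ℤ.* (a ℤ.* b) ℤ.- l ℤ.* a ℤ.- l ℤ.* b ℤ.+ 1ℤ
  expand = solve-∀
  regroup : ∀ l a b A → l ℤ.* l ℤ.* (a ℤ.* A) ℤ.- l ℤ.* a ℤ.- l ℤ.* b ℤ.+ 1ℤ ≡ ((l ℤ.* l ℤ.* A ℤ.- l) ℤ.* a ℤ.- l ℤ.* b) ℤ.+ 1ℤ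
  regroup = solve-∀
  collect : ∀ l A → ((l ℤ.* l ℤ.* A ℤ.- l) ℤ.* 1ℤ ℤ.- l ℤ.* 1ℤ) ℤ.+ l ℤ.* 1ℤ ≡ l ℤ.* (l ℤ.* A ℤ.- 1ℤ)
  collect = solve-∀
  pointwise : ∀ k → h l (x + k * z) ℤ.* h l (i + ν * (x + k * z)) ≡ (c ℤ.* a k ℤ.- + l ℤ.* b k) ℤ.+ 1ℤ
  pointwise k = trans (expand (+ l) (a k) (b k))
    (trans (cong (λ t → + l ℤ.* + l ℤ.* t ℤ.- + l ℤ.* a k ℤ.- + l ℤ.* b k ℤ.+ 1ℤ) (ab k)) (regroup (+ l) (a k) (b k) A))

Valid : ℕ → List ℕ → Set
Valid N L = All Prime L × Unique L × All (_∣ N) L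

valid-tail : ∀ {N l L} → Valid N (l ∷ L) → Valid N L
valid-tail (_ ∷ pL , _ ∷ uL , _ ∷ L∣N) = pL , uL , L∣N

-- For ν = −1 this says that H L / N is idempotent under convolution on ℤ/N, for ν = 1 it gives the norm of H L.
H-correlation : ∀ {N} ν L → Valid N L → All (_∤ ν) L → ∀ i →
  (∑[ x < N ] H L x ℤ.* H L (i + ν * x)) ≡ + N ℤ.* H L i
H-correlation {N} ν [] v [] i = trans (∑-const (downFrom N) 1ℤ) (cong (λ n → + n ℤ.* 1ℤ) (length-downFrom N))
H-correlation {N} ν (l ∷ L) (pl ∷ pL , l∉ ∷ uL , l∣N ∷ L∣N) (l∤ν ∷ L∤ν) i =
  ℤₚ.*-cancelˡ-≡ (+ l) _ _ {{prime⇒nonZero pl}} (begin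
    + l ℤ.* (∑[ x < N ] H (l ∷ L) x ℤ.* H (l ∷ L) (i + ν * x))
      ≡⟨ cong (+ l ℤ.*_) (∑-cong (downFrom N) (λ x → interchange (h l x) (H L x) (h l (i + ν * x)) (H L (i + ν * x)))) ⟩
    + l ℤ.* (∑[ x < N ] w x ℤ.* u x)
      -- The factors of modulus `product L` do not see shifts by `z`, so the correlation splits off
      -- the prime `l`.
      ≡⟨ ∑<-average N l z w u (per*aff (h l) per-h) (per*aff (H L) (H-periodic L L∣N)) perz ⟩
    (∑[ x < N ] (∑[ k < l ] w (x + k * z)) ℤ.* u x)
      ≡⟨ ∑-cong (downFrom N) (λ x → cong (ℤ._* u x) (∑-h-correlation pl l∤ν (prime∤product pl pL l∉) i x)) ⟩
    (∑[ x < N ] (+ l ℤ.* h l i) ℤ.* u x)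
      ≡⟨ ∑-*ˡ (downFrom N) (+ l ℤ.* h l i) u ⟩
    (+ l ℤ.* h l i) ℤ.* ∑< N u
      ≡⟨ cong ((+ l ℤ.* h l i) ℤ.*_) (H-correlation ν L (pL , uL , L∣N) L∤ν i) ⟩
    (+ l ℤ.* h l i) ℤ.* (+ N ℤ.* H L i)
      ≡⟨ regroup (+ l) (h l i) (+ N) (H L i) ⟩
    + l ℤ.* (+ N ℤ.* H (l ∷ L) i) ∎)
  where
  open ≡-Reasoning
  z = product L
  w u : ℕ → ℤ
  w x = h l x ℤ.* h l (i + ν * x)
  u x = H L x ℤ.* H L (i + ν * x)
  interchange : ∀ a b c d → (a ℤ.* b) ℤ.* (c ℤ.* d) ≡ (a ℤ.* c) ℤ.* (b ℤ.* d)
  interchange = solve-∀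
  regroup : ∀ a b c d → (a ℤ.* b) ℤ.* (c ℤ.* d) ≡ a ℤ.* (c ℤ.* (b ℤ.* d))
  regroup = solve-∀
  per-h : Periodic N (h l)
  per-h x = cong (λ t → + l ℤ.* t ℤ.- 1ℤ) (ind-∣-periodic l∣N x)
  per*aff : ∀ {M} (f : ℕ → ℤ) → Periodic M f → Periodic M (λ x → f x ℤ.* f (i + ν * x))
  per*aff {M} f per x = cong₂ ℤ._*_ (per x) (periodic-affine {M} {f} per i ν x)
  perz : Periodic z u
  perz = per*aff (H L) (H-periodic L (∣product-all L))

∑-H² : ∀ {N} L → Valid N L → (∑[ x < N ] H L x ℤ.* H L x) ≡ + N ℤ.* Φ L
∑-H² {N} L v = begin
  (∑[ x < N ] H L x ℤ.* H L x)              ≡⟨ ∑-cong (downFrom N) (λ x → cong (λ y → H L x ℤ.* H L y) (sym (ℕₚ.*-identityˡ x))) ⟩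
  (∑[ x < N ] H L x ℤ.* H L (0 + 1 * x))    ≡⟨ H-correlation 1 L v (All.map prime∤1 (proj₁ v)) 0 ⟩
  + N ℤ.* H L 0                             ≡⟨ cong (+ N ℤ.*_) (H[0]≡Φ L) ⟩
  + N ℤ.* Φ L                               ∎
  where open ≡-Reasoning

-- The density `∏ (1 − 1/l)`, cross-multiplied, again by averaging away one prime at a time. It
-- serves twice: for the main term on ℤ/N, and with `N = m` for `φ m`.
∑-free : ∀ {N} L → Valid N L → + product L ℤ.* ∑< N (free L) ≡ Φ L ℤ.* + N
∑-free {N} [] v = cong (1ℤ ℤ.*_) (trans (∑-const (downFrom N) 1ℤ)
  (trans (ℤₚ.*-identityʳ _) (cong +_ (length-downFrom N))))
∑-free {N} (l ∷ L) (pl ∷ pL , l∉ ∷ uL , l∣N ∷ L∣N) = begin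
  + (l * product L) ℤ.* ∑< N (free (l ∷ L))
    ≡⟨ cong (ℤ._* ∑< N (free (l ∷ L))) (trans (ℤₚ.pos-* l (product L)) (ℤₚ.*-comm (+ l) _)) ⟩
  + product L ℤ.* + l ℤ.* ∑< N (free (l ∷ L))
    ≡⟨ ℤₚ.*-assoc (+ product L) (+ l) _ ⟩
  + product L ℤ.* (+ l ℤ.* ∑< N (λ x → w x ℤ.* free L x))
    ≡⟨ cong (+ product L ℤ.*_) (begin
         + l ℤ.* ∑< N (λ x → w x ℤ.* free L x)
           ≡⟨ ∑<-average N l (product L) w (free L) (λ x → cong (λ t → 1ℤ ℤ.- t) (ind-∣-periodic l∣N x))
                (free-periodic L L∣N) (free-periodic L (∣product-all L)) ⟩
         (∑[ x < N ] (∑[ k < l ] w (x + k * product L)) ℤ.* free L x)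
           ≡⟨ ∑-cong (downFrom N) (λ x → cong (ℤ._* free L x) (inner x)) ⟩
         (∑[ x < N ] (+ l ℤ.- 1ℤ) ℤ.* free L x)
           ≡⟨ ∑-*ˡ (downFrom N) (+ l ℤ.- 1ℤ) (free L) ⟩
         (+ l ℤ.- 1ℤ) ℤ.* ∑< N (free L) ∎) ⟩
  + product L ℤ.* ((+ l ℤ.- 1ℤ) ℤ.* ∑< N (free L))
    ≡⟨ swap (+ product L) (+ l ℤ.- 1ℤ) (∑< N (free L)) ⟩
  (+ l ℤ.- 1ℤ) ℤ.* (+ product L ℤ.* ∑< N (free L))
    ≡⟨ cong ((+ l ℤ.- 1ℤ) ℤ.*_) (∑-free L (pL , uL , L∣N)) ⟩
  (+ l ℤ.- 1ℤ) ℤ.* (Φ L ℤ.* + N)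
    ≡⟨ sym (ℤₚ.*-assoc (+ l ℤ.- 1ℤ) (Φ L) (+ N)) ⟩
  Φ (l ∷ L) ℤ.* + N ∎
  where
  open ≡-Reasoning
  w : ℕ → ℤ
  w x = 1ℤ ℤ.- ind (l ∣? x)
  swap : ∀ a b c → a ℤ.* (b ℤ.* c) ≡ b ℤ.* (a ℤ.* c)
  swap = solve-∀
  inner : ∀ x → (∑[ k < l ] w (x + k * product L)) ≡ + l ℤ.- 1ℤ
  inner x = trans (∑-- (downFrom l) (λ _ → 1ℤ) (λ k → ind (l ∣? (x + k * product L))))
    (cong₂ ℤ._-_ (trans (∑-const (downFrom l) 1ℤ) (trans (ℤₚ.*-identityʳ _) (cong +_ (length-downFrom l))))
      (∑-progression pl (prime∤product pl pL l∉) x))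

free≡1 : ∀ {i} L → All (_∤ i) L → free L i ≡ 1ℤ
free≡1     []      []          = refl
free≡1 {i} (l ∷ L) (l∤i ∷ L∤i) = cong₂ (λ t s → (1ℤ ℤ.- t) ℤ.* s) (ind-no (l ∣? i) l∤i) (free≡1 L L∤i)

free≡0 : ∀ {i l} L → l ∈ L → l ∣ i → free L i ≡ 0ℤ
free≡0 {i} (l ∷ L) (here refl) l∣i = cong (λ t → (1ℤ ℤ.- t) ℤ.* free L i) (ind-yes (l ∣? i) l∣i)
free≡0 {i} (l ∷ L) (there l∈)  l∣i =
  trans (cong ((1ℤ ℤ.- ind (l ∣? i)) ℤ.*_) (free≡0 L l∈ l∣i)) (ℤₚ.*-zeroʳ (1ℤ ℤ.- ind (l ∣? i)))

free-primes : ∀ m → m ≢ 0 → ∀ i → free (primes m) i ≡ ind (gcd i m ℕ.≟ 1)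
free-primes m m≢0 i with gcd i m ℕ.≟ 1
... | yes gcd≡1 = free≡1 (primes m) (All.tabulate (λ {l} l∈ l∣i →
  prime∤1 (All.lookup (primes-prime m) l∈) (subst (l ∣_) gcd≡1 (gcd-greatest l∣i (All.lookup (primes-∣ m) l∈)))))
... | no gcd≢1 with any? (_∣? i) (primes m)
...   | yes l∈ with find l∈
...     | l , l∈L , l∣i = free≡0 (primes m) l∈L l∣i
free-primes m m≢0 i | no gcd≢1 | no none = contradiction
  (no-common-prime⇒gcd≡1 i m m≢0 (λ pp p∣i p∣m → All.lookup (Allₚ.¬Any⇒All¬ _ none) (∈-primes m≢0 pp p∣m) p∣i)) gcd≢1

primes-valid : ∀ {m N} → m ∣ N → Valid N (primes m)
primes-valid {m} m∣N = primes-prime m , primes-unique m , All.map (λ l∣m → ∣-trans l∣m m∣N) (primes-∣ m)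

φ-product : ∀ m → m ≢ 0 → + product (primes m) ℤ.* + φ m ≡ Φ (primes m) ℤ.* + m
φ-product m m≢0 = trans (cong (+ product (primes m) ℤ.*_) (begin
    + φ m                                                  ≡⟨ sym (∑-ind≡length-filter (λ k → gcd (suc k) m ℕ.≟ 1) (upTo m)) ⟩
    (∑[ k ∈ upTo m ] ind (gcd (suc k) m ℕ.≟ 1))           ≡⟨ ∑-↭ _ (↭-trans (↭-sym (↭-reverse (upTo m))) (↭-reflexive (reverse-upTo m))) ⟩
    (∑[ k < m ] ind (gcd (suc k) m ℕ.≟ 1))                 ≡⟨ ∑-cong (downFrom m) (λ k → sym (trans (cong (free (primes m)) (ℕₚ.+-comm k 1)) (free-primes m m≢0 (suc k)))) ⟩
    -- `φ` runs over 1, ..., `m` and `∑<` over 0, ..., `m − 1`; periodicity absorbs the offset.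
    (∑[ k < m ] free (primes m) (k + 1))                   ≡⟨ ∑<-shift m (free (primes m)) (free-periodic (primes m) (primes-∣ m)) 1 ⟩
    ∑< m (free (primes m))                                 ∎))
  (∑-free (primes m) (primes-valid ∣-refl))
  where open ≡-Reasoning

-- The large sieve inequality

∑-*-∑ : (xs : List I) (ys : List J) (f : I → ℤ) (g : J → ℤ) →
  ∑ xs f ℤ.* ∑ ys g ≡ (∑[ x ∈ xs ] ∑[ y ∈ ys ] f x ℤ.* g y)
∑-*-∑ xs ys f g = trans (sym (∑-*ʳ xs (∑ ys g) f)) (∑-cong xs (λ x → sym (∑-*ˡ ys (f x) g)))

∑<-square : ∀ N K (u : ℕ → ℤ) (β : ℕ → ℕ → ℤ) →
  (∑[ k < K ] (∑[ i < N ] u i ℤ.* β i k) ℤ.* (∑[ i < N ] u i ℤ.* β i k)) ≡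
  (∑[ i < N ] ∑[ j < N ] (∑[ k < K ] β i k ℤ.* β j k) ℤ.* (u i ℤ.* u j))
∑<-square N K u β = begin
  (∑[ k < K ] (∑[ i < N ] u i ℤ.* β i k) ℤ.* (∑[ i < N ] u i ℤ.* β i k))
    ≡⟨ ∑-cong (downFrom K) (λ k → ∑-*-∑ (downFrom N) (downFrom N) _ _) ⟩
  (∑[ k < K ] ∑[ i < N ] ∑[ j < N ] (u i ℤ.* β i k) ℤ.* (u j ℤ.* β j k))
    ≡⟨ ∑-swap (downFrom K) (downFrom N) _ ⟩
  (∑[ i < N ] ∑[ k < K ] ∑[ j < N ] (u i ℤ.* β i k) ℤ.* (u j ℤ.* β j k))
    ≡⟨ ∑-cong (downFrom N) (λ i → ∑-swap (downFrom K) (downFrom N) _) ⟩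
  (∑[ i < N ] ∑[ j < N ] ∑[ k < K ] (u i ℤ.* β i k) ℤ.* (u j ℤ.* β j k))
    ≡⟨ ∑-cong (downFrom N) (λ i → ∑-cong (downFrom N) (λ j →
         trans (∑-cong (downFrom K) (λ k → interchange (u i) (β i k) (u j) (β j k))) (∑-*ʳ (downFrom K) (u i ℤ.* u j) _))) ⟩
  (∑[ i < N ] ∑[ j < N ] (∑[ k < K ] β i k ℤ.* β j k) ℤ.* (u i ℤ.* u j)) ∎
  where
  open ≡-Reasoning
  interchange : ∀ a b c d → (a ℤ.* b) ℤ.* (c ℤ.* d) ≡ (b ℤ.* d) ℤ.* (a ℤ.* c)
  interchange = solve-∀

i-j≤i : ∀ i {j} → 0ℤ ℤ.≤ j → i ℤ.- j ℤ.≤ i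
i-j≤i i {j} 0≤j = subst (i ℤ.- j ℤ.≤_) (ℤₚ.+-identityʳ i) (ℤₚ.+-monoʳ-≤ i (ℤₚ.neg-mono-≤ 0≤j))

-- Large sieve: the convolution operator u ↦ (k ↦ ∑ u(i) β(2i + k)) has operator norm at most √(κδ),
-- and H L reproduces itself under convolution, so that N · ∑ H(i) β(2i) is an inner product with its image.
large-sieve : ∀ M ν (β : ℕ → ℤ) → suc ν ≡ 2 * M → Periodic (2 * M) β →
  (D : ℕ → ℕ → ℤ) (κ ρ δ : ℤ) → 0ℤ ℤ.≤ κ → 0ℤ ℤ.≤ ρ →
  (∀ i j → 0ℤ ℤ.≤ D i j) → (∀ i j → D i j ≡ D j i) → (∀ i → ∑< (2 * M) (D i) ℤ.≤ δ) →
  (∀ i j → (∑[ k < 2 * M ] β (2 * i + k) ℤ.* β (2 * j + k)) ≡ κ ℤ.* D i j ℤ.- ρ) →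
  ∀ L → Valid (2 * M) L →
  (∑[ i < 2 * M ] H L i ℤ.* β (2 * i)) ℤ.* (∑[ i < 2 * M ] H L i ℤ.* β (2 * i)) ℤ.≤
  + 2 ℤ.* (κ ℤ.* δ) ℤ.* (Φ L ℤ.* Φ L)
large-sieve M ν β sν≡ per D κ ρ δ 0≤κ 0≤ρ D≥0 D-sym row Γ L valid@(pL , _ , L∣N) =
  cancel (begin
    (+ N ℤ.* X) ℤ.* (+ N ℤ.* X)                                     ≡⟨ cong₂ ℤ._*_ N*X N*X ⟩
    ∑< N (λ x → H L x ℤ.* V (2 * x)) ℤ.* ∑< N (λ x → H L x ℤ.* V (2 * x))
                                                                    ≤⟨ cauchy-schwarz (downFrom N) (H L) (λ x → V (2 * x)) ⟩
    S ℤ.* ∑< N (λ x → V (2 * x) ℤ.* V (2 * x))                      ≤⟨ ℤₚ.*-monoˡ-≤-nonNeg S {{ℤ.nonNegative 0≤S}}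
                                                                         (∑<-double≤ M (λ k → V k ℤ.* V k) (λ k → 0≤i² (V k)) V²-periodic) ⟩
    S ℤ.* (+ 2 ℤ.* ∑< N (λ k → V k ℤ.* V k))                        ≤⟨ ℤₚ.*-monoˡ-≤-nonNeg S {{ℤ.nonNegative 0≤S}}
                                                                         (ℤₚ.*-monoˡ-≤-nonNeg (+ 2) ∑V²≤) ⟩
    S ℤ.* (+ 2 ℤ.* (κ ℤ.* (δ ℤ.* S)))                               ≡⟨ cong (λ s → s ℤ.* (+ 2 ℤ.* (κ ℤ.* (δ ℤ.* s)))) (∑-H² L valid) ⟩
    (+ N ℤ.* Φ L) ℤ.* (+ 2 ℤ.* (κ ℤ.* (δ ℤ.* (+ N ℤ.* Φ L))))       ≡⟨ regroup (+ N) (Φ L) κ δ ⟩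
    (+ N ℤ.* + N) ℤ.* (+ 2 ℤ.* (κ ℤ.* δ) ℤ.* (Φ L ℤ.* Φ L))         ∎)
  where
  open ℤₚ.≤-Reasoning
  N = 2 * M
  X = ∑[ i < N ] H L i ℤ.* β (2 * i)
  V : ℕ → ℤ
  V k = ∑[ i < N ] H L i ℤ.* β (2 * i + k)
  S = ∑[ x < N ] H L x ℤ.* H L x
  0≤S : 0ℤ ℤ.≤ S
  0≤S = ∑-nonneg (downFrom N) (λ x → 0≤i² (H L x))
  regroup : ∀ n p k d → (n ℤ.* p) ℤ.* (+ 2 ℤ.* (k ℤ.* (d ℤ.* (n ℤ.* p)))) ≡ (n ℤ.* n) ℤ.* (+ 2 ℤ.* (k ℤ.* d) ℤ.* (p ℤ.* p))
  regroup = solve-∀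
  cancel : ∀ {Y} → (+ N ℤ.* X) ℤ.* (+ N ℤ.* X) ℤ.≤ (+ N ℤ.* + N) ℤ.* Y → X ℤ.* X ℤ.≤ Y
  cancel {Y} le = ℤₚ.*-cancelˡ-≤-pos (X ℤ.* X) Y (+ N ℤ.* + N) {{pos}}
    (subst (ℤ._≤ (+ N ℤ.* + N) ℤ.* Y) (square (+ N) X) le)
    where
    square : ∀ n x → (n ℤ.* x) ℤ.* (n ℤ.* x) ≡ (n ℤ.* n) ℤ.* (x ℤ.* x)
    square = solve-∀
    pos : ℤ.Positive (+ N ℤ.* + N)
    pos = subst (λ k → ℤ.Positive (+ k ℤ.* + k)) sν≡ _
  V-periodic : Periodic N V
  V-periodic k = ∑-cong (downFrom N) (λ i → cong (H L i ℤ.*_)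
    (trans (cong β (sym (ℕₚ.+-assoc (2 * i) k N))) (per (2 * i + k))))
  V²-periodic : Periodic N (λ k → V k ℤ.* V k)
  V²-periodic k = cong₂ ℤ._*_ (V-periodic k) (V-periodic k)
  -- `ν = N − 1` plays the role of -1 among natural exponents: a prime dividing `N = ν + 1` cannot
  -- divide `ν`.
  L∤ν : All (_∤ ν) L
  L∤ν = All.tabulate (λ {l} l∈ l∣ν → prime∤1 (All.lookup pL l∈)
    (∣m+n∣m⇒∣n (subst (l ∣_) (trans (sym sν≡) (ℕₚ.+-comm 1 ν)) (All.lookup L∣N l∈)) l∣ν))
  -- Substituting `i − x`, encoded as `i + ν * x`, moves the shift from `β` to `H L`, because
  -- `2(i + νx) + 2x = 2i + 2xN`. The substitution works only for even arguments of `V`.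
  V[2x] : ∀ x → V (2 * x) ≡ (∑[ i < N ] H L (i + ν * x) ℤ.* β (2 * i))
  V[2x] x = trans (sym (∑<-shift N (λ i → H L i ℤ.* β (2 * i + 2 * x)) G-periodic (ν * x)))
    (∑-cong (downFrom N) (λ i → cong (H L (i + ν * x) ℤ.*_)
      (trans (cong β (trans (index i ν x) (cong (λ n → 2 * i + 2 * x * n) sν≡))) (periodic-* {N} {β} per (2 * x) (2 * i)))))
    where
    index : ∀ i ν x → 2 * (i + ν * x) + 2 * x ≡ 2 * i + 2 * x * suc ν
    index = +-*-Solver.solve 3 (λ i ν x → con 2 :* (i :+ ν :* x) :+ con 2 :* x := con 2 :* i :+ con 2 :* x :* (con 1 :+ ν)) refl
      where open +-*-Solver
    G-periodic : Periodic N (λ i → H L i ℤ.* β (2 * i + 2 * x))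
    G-periodic i = cong₂ ℤ._*_ (H-periodic L L∣N i) (trans (cong β (index′ i N x)) (periodic-* {N} {β} per 2 (2 * i + 2 * x)))
      where
      index′ : ∀ i N x → 2 * (i + N) + 2 * x ≡ 2 * i + 2 * x + 2 * N
      index′ = +-*-Solver.solve 3 (λ i N x → con 2 :* (i :+ N) :+ con 2 :* x := con 2 :* i :+ con 2 :* x :+ con 2 :* N) refl
        where open +-*-Solver
  N*X : + N ℤ.* X ≡ ∑< N (λ x → H L x ℤ.* V (2 * x))
  N*X = sym (begin-equality
    ∑< N (λ x → H L x ℤ.* V (2 * x))
      ≡⟨ ∑-cong (downFrom N) (λ x → trans (cong (H L x ℤ.*_) (V[2x] x)) (sym (∑-*ˡ (downFrom N) (H L x) _))) ⟩
    (∑[ x < N ] ∑[ i < N ] H L x ℤ.* (H L (i + ν * x) ℤ.* β (2 * i)))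
      ≡⟨ ∑-swap (downFrom N) (downFrom N) _ ⟩
    (∑[ i < N ] ∑[ x < N ] H L x ℤ.* (H L (i + ν * x) ℤ.* β (2 * i)))
      ≡⟨ ∑-cong (downFrom N) (λ i → trans (∑-cong (downFrom N) (λ x → sym (ℤₚ.*-assoc (H L x) (H L (i + ν * x)) (β (2 * i)))))
           (∑-*ʳ (downFrom N) (β (2 * i)) _)) ⟩
    (∑[ i < N ] (∑[ x < N ] H L x ℤ.* H L (i + ν * x)) ℤ.* β (2 * i))
      ≡⟨ ∑-cong (downFrom N) (λ i → trans (cong (ℤ._* β (2 * i)) (H-correlation ν L valid L∤ν i)) (ℤₚ.*-assoc (+ N) (H L i) (β (2 * i)))) ⟩
    (∑[ i < N ] + N ℤ.* (H L i ℤ.* β (2 * i)))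
      ≡⟨ ∑-*ˡ (downFrom N) (+ N) _ ⟩
    + N ℤ.* X ∎)
  HH : ℕ → ℕ → ℤ
  HH i j = H L i ℤ.* H L j
  split : ∀ i j → (∑[ k < N ] β (2 * i + k) ℤ.* β (2 * j + k)) ℤ.* HH i j ≡ κ ℤ.* (D i j ℤ.* HH i j) ℤ.- ρ ℤ.* HH i j
  split i j = trans (cong (ℤ._* HH i j) (Γ i j)) (distrib κ (D i j) ρ (HH i j))
    where
    distrib : ∀ k d r t → (k ℤ.* d ℤ.- r) ℤ.* t ≡ k ℤ.* (d ℤ.* t) ℤ.- r ℤ.* t
    distrib = solve-∀
  ∑V²≤ : ∑< N (λ k → V k ℤ.* V k) ℤ.≤ κ ℤ.* (δ ℤ.* S)
  ∑V²≤ = begin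
    ∑< N (λ k → V k ℤ.* V k)
      ≡⟨ ∑<-square N N (H L) (λ i k → β (2 * i + k)) ⟩
    (∑[ i < N ] ∑[ j < N ] (∑[ k < N ] β (2 * i + k) ℤ.* β (2 * j + k)) ℤ.* HH i j)
      ≡⟨ ∑-cong (downFrom N) (λ i → trans (∑-cong (downFrom N) (split i))
           (trans (∑-- (downFrom N) _ _) (cong₂ ℤ._-_ (∑-*ˡ (downFrom N) κ _) (∑-*ˡ (downFrom N) ρ _)))) ⟩
    (∑[ i < N ] κ ℤ.* (∑[ j < N ] D i j ℤ.* HH i j) ℤ.- ρ ℤ.* (∑[ j < N ] HH i j))
      ≡⟨ trans (∑-- (downFrom N) _ _) (cong₂ ℤ._-_ (∑-*ˡ (downFrom N) κ _)
           (trans (∑-*ˡ (downFrom N) ρ _) (cong (ρ ℤ.*_) (sym (∑-*-∑ (downFrom N) (downFrom N) (H L) (H L)))))) ⟩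
    κ ℤ.* (∑[ i < N ] ∑[ j < N ] D i j ℤ.* HH i j) ℤ.- ρ ℤ.* (∑< N (H L) ℤ.* ∑< N (H L))
      -- The constant `−ρ` in the kernel contributes `−ρ (∑ H L)²`, which is nonpositive.
      ≤⟨ i-j≤i _ (subst (ℤ._≤ ρ ℤ.* (∑< N (H L) ℤ.* ∑< N (H L))) (ℤₚ.*-zeroʳ ρ)
           (ℤₚ.*-monoˡ-≤-nonNeg ρ {{ℤ.nonNegative 0≤ρ}} (0≤i² (∑< N (H L))))) ⟩
    κ ℤ.* (∑[ i < N ] ∑[ j < N ] D i j ℤ.* HH i j)
      ≤⟨ ℤₚ.*-monoˡ-≤-nonNeg κ {{ℤ.nonNegative 0≤κ}} (∑²-kernel-bound (downFrom N) D δ D≥0 D-sym row (H L)) ⟩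
    κ ℤ.* (δ ℤ.* S) ∎

-- Bounds by square roots, and the sieve over the primes

0≤i*j : ∀ {i j} → 0ℤ ℤ.≤ i → 0ℤ ℤ.≤ j → 0ℤ ℤ.≤ i ℤ.* j
0≤i*j {i} {j} 0≤i 0≤j = subst (ℤ._≤ i ℤ.* j) (ℤₚ.*-zeroʳ i) (ℤₚ.*-monoˡ-≤-nonNeg i {{ℤ.nonNegative 0≤i}} 0≤j)

square-mono : ∀ {x y} → 0ℤ ℤ.≤ x → x ℤ.≤ y → x ℤ.* x ℤ.≤ y ℤ.* y
square-mono {x} {y} 0≤x x≤y = ℤₚ.≤-trans (ℤₚ.*-monoˡ-≤-nonNeg x {{ℤ.nonNegative 0≤x}} x≤y)
  (ℤₚ.*-monoʳ-≤-nonNeg y {{ℤ.nonNegative (ℤₚ.≤-trans 0≤x x≤y)}} x≤y)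

square-cancel-≤ : ∀ {x y} → 0ℤ ℤ.≤ y → x ℤ.* x ℤ.≤ y ℤ.* y → x ℤ.≤ y
square-cancel-≤ {x} {y} 0≤y x²≤y² = ℤₚ.≮⇒≥ (λ y<x → ℤₚ.<⇒≱ (strict y<x) x²≤y²)
  where
  strict : y ℤ.< x → y ℤ.* y ℤ.< x ℤ.* x
  strict y<x = ℤₚ.≤-<-trans (ℤₚ.*-monoˡ-≤-nonNeg y {{ℤ.nonNegative 0≤y}} (ℤₚ.<⇒≤ y<x))
    (ℤₚ.*-monoʳ-<-pos x {{ℤ.positive (ℤₚ.≤-<-trans 0≤y y<x)}} y<x)

-- Bounded r a c encodes |a| ≤ c√r.
record Bounded (r a c : ℤ) : Set where
  constructor _,_
  field
    0≤c : 0ℤ ℤ.≤ c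
    a²≤c²r : a ℤ.* a ℤ.≤ c ℤ.* c ℤ.* r

bounded-* : ∀ {r a c} k → 0ℤ ℤ.≤ k → Bounded r a c → Bounded r (k ℤ.* a) (k ℤ.* c)
bounded-* {r} {a} {c} k 0≤k (0≤c , a²≤) = 0≤i*j 0≤k 0≤c ,
  subst₂ ℤ._≤_ (lhs k a) (rhs k c r) (ℤₚ.*-monoˡ-≤-nonNeg (k ℤ.* k) {{ℤ.nonNegative (0≤i² k)}} a²≤)
  where
  lhs : ∀ k a → (k ℤ.* k) ℤ.* (a ℤ.* a) ≡ (k ℤ.* a) ℤ.* (k ℤ.* a)
  lhs = solve-∀
  rhs : ∀ k c r → (k ℤ.* k) ℤ.* (c ℤ.* c ℤ.* r) ≡ (k ℤ.* c) ℤ.* (k ℤ.* c) ℤ.* r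
  rhs = solve-∀

bounded-neg : ∀ {r a c} → Bounded r a c → Bounded r (ℤ.- a) c
bounded-neg {r} {a} {c} (0≤c , a²≤) = 0≤c , subst (ℤ._≤ c ℤ.* c ℤ.* r) (lemma a) a²≤
  where
  lemma : ∀ a → a ℤ.* a ≡ (ℤ.- a) ℤ.* (ℤ.- a)
  lemma = solve-∀

-- The triangle inequality without roots: the cross term needs `ab ≤ cdr`, which is obtained by
-- multiplying the two hypotheses and comparing squares.
bounded-+ : ∀ {r a b c d} → 0ℤ ℤ.≤ r → Bounded r a c → Bounded r b d → Bounded r (a ℤ.+ b) (c ℤ.+ d)
bounded-+ {r} {a} {b} {c} {d} 0≤r (0≤c , a²≤) (0≤d , b²≤) = ℤₚ.+-mono-≤ 0≤c 0≤d ,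
  subst₂ ℤ._≤_ (lhs a b) (rhs c d r) (ℤₚ.+-mono-≤ (ℤₚ.+-mono-≤ a²≤ (ℤₚ.*-monoˡ-≤-nonNeg (+ 2) ab≤cdr)) b²≤)
  where
  lhs : ∀ a b → a ℤ.* a ℤ.+ + 2 ℤ.* (a ℤ.* b) ℤ.+ b ℤ.* b ≡ (a ℤ.+ b) ℤ.* (a ℤ.+ b)
  lhs = solve-∀
  rhs : ∀ c d r → c ℤ.* c ℤ.* r ℤ.+ + 2 ℤ.* (c ℤ.* d ℤ.* r) ℤ.+ d ℤ.* d ℤ.* r ≡ (c ℤ.+ d) ℤ.* (c ℤ.+ d) ℤ.* r
  rhs = solve-∀
  interchange : ∀ a b → (a ℤ.* a) ℤ.* (b ℤ.* b) ≡ (a ℤ.* b) ℤ.* (a ℤ.* b)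
  interchange = solve-∀
  regroup : ∀ c d r → (c ℤ.* c ℤ.* r) ℤ.* (d ℤ.* d ℤ.* r) ≡ (c ℤ.* d ℤ.* r) ℤ.* (c ℤ.* d ℤ.* r)
  regroup = solve-∀
  ab≤cdr : a ℤ.* b ℤ.≤ c ℤ.* d ℤ.* r
  ab≤cdr = square-cancel-≤ (0≤i*j (0≤i*j 0≤c 0≤d) 0≤r)
    (subst₂ ℤ._≤_ (interchange a b) (regroup c d r)
      (ℤₚ.≤-trans (ℤₚ.*-monoˡ-≤-nonNeg (a ℤ.* a) {{ℤ.nonNegative (0≤i² a)}} b²≤)
                  (ℤₚ.*-monoʳ-≤-nonNeg (d ℤ.* d ℤ.* r) {{ℤ.nonNegative (0≤i*j (0≤i² d) 0≤r)}} a²≤)))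

0≤l-1 : ∀ {l} → Prime l → 0ℤ ℤ.≤ + l ℤ.- 1ℤ
0≤l-1 {zero}  pl = contradiction refl (ℕ.≢-nonZero⁻¹ 0 {{prime⇒nonZero pl}})
0≤l-1 {suc l} pl = subst (0ℤ ℤ.≤_) (lemma (+ l)) (ℤ.+≤+ z≤n)
  where
  lemma : ∀ a → a ≡ 1ℤ ℤ.+ a ℤ.- 1ℤ
  lemma = solve-∀

0≤Φ : ∀ L → All Prime L → 0ℤ ℤ.≤ Φ L
0≤Φ []      []        = ℤ.+≤+ z≤n
0≤Φ (l ∷ L) (pl ∷ pL) = 0≤i*j (0≤l-1 pl) (0≤Φ L pL)

valid-shift : ∀ {N} l K L → Valid N (l ∷ K ++ L) → Valid N (K ++ l ∷ L)
valid-shift l K L (p , u , d) = All-resp-↭ perm p , Unique-resp-↭ (setoid ℕ) (↭⇒↭ₛ perm) u , All-resp-↭ perm d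
  where
  perm : l ∷ K ++ L ↭ K ++ l ∷ L
  perm = ↭-sym (shift l K L)

-- l · (1 − [l ∣ i]) = (l − 1) − h l i removes the primes of K one at a time.
sieve-bound : ∀ N (β : ℕ → ℤ) r B → 0ℤ ℤ.≤ r →
  (∀ L → Valid N L → Bounded r (∑[ i < N ] H L i ℤ.* β i) (Φ L ℤ.* B)) →
  ∀ K L → Valid N (K ++ L) →
  Bounded r (+ product K ℤ.* (∑[ i < N ] free K i ℤ.* (H L i ℤ.* β i))) (+ (2 ^ length K) ℤ.* (Φ K ℤ.* (Φ L ℤ.* B)))
sieve-bound N β r B 0≤r base [] L v = subst₂ (Bounded r)
  (sym (trans (ℤₚ.*-identityˡ _) (∑-cong (downFrom N) (λ i → ℤₚ.*-identityˡ _))))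
  (sym (trans (ℤₚ.*-identityˡ _) (ℤₚ.*-identityˡ _))) (base L v)
sieve-bound N β r B 0≤r base (l ∷ K) L v@(pl ∷ _ , _ , _) = subst₂ (Bounded r) lhs rhs
  -- The constant `l − 1` and the sum `h l` cost the same, since `Φ (l ∷ L) = (l − 1) Φ L`. Hence
  -- each prime doubles the bound, and one unit of error is left for each set of primes.
  (bounded-+ 0≤r (bounded-* (+ l ℤ.- 1ℤ) (0≤l-1 pl) (sieve-bound N β r B 0≤r base K L (valid-tail v)))
                 (bounded-neg (sieve-bound N β r B 0≤r base K (l ∷ L) (valid-shift l K L v))))
  where
  open ≡-Reasoning
  X : List ℕ → List ℕ → ℤ
  X K L = ∑[ i < N ] free K i ℤ.* (H L i ℤ.* β i)
  pointwise : ∀ l a F h b → (l ℤ.- 1ℤ) ℤ.* (F ℤ.* (h ℤ.* b)) ℤ.- F ℤ.* ((l ℤ.* a ℤ.- 1ℤ) ℤ.* h ℤ.* b)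
    ≡ l ℤ.* ((1ℤ ℤ.- a) ℤ.* F ℤ.* (h ℤ.* b))
  pointwise = solve-∀
  step : (+ l ℤ.- 1ℤ) ℤ.* X K L ℤ.- X K (l ∷ L) ≡ + l ℤ.* X (l ∷ K) L
  step = begin
    (+ l ℤ.- 1ℤ) ℤ.* X K L ℤ.- X K (l ∷ L)
      ≡⟨ cong (ℤ._- X K (l ∷ L)) (sym (∑-*ˡ (downFrom N) (+ l ℤ.- 1ℤ) _)) ⟩
    (∑[ i < N ] (+ l ℤ.- 1ℤ) ℤ.* (free K i ℤ.* (H L i ℤ.* β i))) ℤ.- X K (l ∷ L)
      ≡⟨ sym (∑-- (downFrom N) _ _) ⟩
    (∑[ i < N ] (+ l ℤ.- 1ℤ) ℤ.* (free K i ℤ.* (H L i ℤ.* β i)) ℤ.- free K i ℤ.* (H (l ∷ L) i ℤ.* β i))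
      ≡⟨ ∑-cong (downFrom N) (λ i → pointwise (+ l) (ind (l ∣? i)) (free K i) (H L i) (β i)) ⟩
    (∑[ i < N ] + l ℤ.* (free (l ∷ K) i ℤ.* (H L i ℤ.* β i)))
      ≡⟨ ∑-*ˡ (downFrom N) (+ l) _ ⟩
    + l ℤ.* X (l ∷ K) L ∎
  factor : ∀ m p x y → m ℤ.* (p ℤ.* x) ℤ.+ ℤ.- (p ℤ.* y) ≡ p ℤ.* (m ℤ.* x ℤ.- y)
  factor = solve-∀
  lhs : (+ l ℤ.- 1ℤ) ℤ.* (+ product K ℤ.* X K L) ℤ.+ ℤ.- (+ product K ℤ.* X K (l ∷ L)) ≡ + product (l ∷ K) ℤ.* X (l ∷ K) L
  lhs = begin
    (+ l ℤ.- 1ℤ) ℤ.* (+ product K ℤ.* X K L) ℤ.+ ℤ.- (+ product K ℤ.* X K (l ∷ L))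
      ≡⟨ factor (+ l ℤ.- 1ℤ) (+ product K) (X K L) (X K (l ∷ L)) ⟩
    + product K ℤ.* ((+ l ℤ.- 1ℤ) ℤ.* X K L ℤ.- X K (l ∷ L))
      ≡⟨ cong (+ product K ℤ.*_) step ⟩
    + product K ℤ.* (+ l ℤ.* X (l ∷ K) L)
      ≡⟨ sym (ℤₚ.*-assoc (+ product K) (+ l) _) ⟩
    + product K ℤ.* + l ℤ.* X (l ∷ K) L
      ≡⟨ cong (ℤ._* X (l ∷ K) L) (trans (ℤₚ.*-comm (+ product K) (+ l)) (sym (ℤₚ.pos-* l (product K)))) ⟩
    + product (l ∷ K) ℤ.* X (l ∷ K) L ∎
  collect : ∀ m w k p b → m ℤ.* (w ℤ.* (k ℤ.* (p ℤ.* b))) ℤ.+ w ℤ.* (k ℤ.* (m ℤ.* p ℤ.* b)) ≡ + 2 ℤ.* w ℤ.* (m ℤ.* k ℤ.* (p ℤ.* b))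
  collect = solve-∀
  rhs : (+ l ℤ.- 1ℤ) ℤ.* (+ (2 ^ length K) ℤ.* (Φ K ℤ.* (Φ L ℤ.* B))) ℤ.+ + (2 ^ length K) ℤ.* (Φ K ℤ.* (Φ (l ∷ L) ℤ.* B))
    ≡ + (2 ^ length (l ∷ K)) ℤ.* (Φ (l ∷ K) ℤ.* (Φ L ℤ.* B))
  rhs = trans (collect (+ l ℤ.- 1ℤ) (+ (2 ^ length K)) (Φ K) (Φ L) B)
    (cong (ℤ._* (Φ (l ∷ K) ℤ.* (Φ L ℤ.* B))) (sym (ℤₚ.pos-* 2 (2 ^ length K))))

-- Finite fields

prime∤! : ∀ {p} → Prime p → ∀ k → k < p → p ∤ k !
prime∤! pp zero    k<p p∣ = prime∤1 pp p∣
prime∤! pp (suc k) k<p p∣ with euclidsLemma (suc k) (k !) pp p∣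
... | inj₁ p∣sk = ℕₚ.<⇒≱ k<p (∣⇒≤ p∣sk)
... | inj₂ p∣k! = prime∤! pp k (ℕₚ.<-trans (ℕₚ.n<1+n k) k<p) p∣k!

prime∣C : ∀ {p} → Prime p → ∀ k → 0 < k → k < p → p ∣ p C k
prime∣C {p@(suc p-1)} pp k 0<k k<p with euclidsLemma (k ! * (p ∸ k) !) (p C k) pp (subst (p ∣_) (sym factors) (m∣m*n (p-1 !)))
  where
  instance
    _ = k ℕₚ.!* (p ∸ k) !≢0
  factors : k ! * (p ∸ k) ! * (p C k) ≡ p !
  factors = trans (cong (k ! * (p ∸ k) ! *_) (nCk≡n!/k![n-k]! (ℕₚ.<⇒≤ k<p)))
    (m*[n/m]≡n (k![n∸k]!∣n! (ℕₚ.<⇒≤ k<p)))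
... | inj₂ p∣C = p∣C
... | inj₁ p∣!! with euclidsLemma (k !) ((p ∸ k) !) pp p∣!!
...   | inj₁ p∣k! = contradiction p∣k! (prime∤! pp k k<p)
...   | inj₂ p∣p-k! = contradiction p∣p-k! (prime∤! pp (p ∸ k) (ℕₚ.∸-monoʳ-< 0<k (ℕₚ.<⇒≤ k<p)))

module FieldTheory (F : FiniteField) where

  open FiniteField F public using (Carrier; isCommutativeRing; 0≢1; inverse; elems; complete; size; Tr; IsFree; Counted)
    renaming (_≟_ to infix 4 _≟ꟳ_; unique to elems-unique; _^_ to infixr 8 _↑_)

  commutativeRing : CommutativeRing 0ℓ 0ℓ
  commutativeRing = record { isCommutativeRing = isCommutativeRing }

  ring : AlmostCommutativeRing 0ℓ 0ℓ
  ring = fromCommutativeRing commutativeRing (λ _ → nothing)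

  open AlmostCommutativeRing ring public using (0#; 1#) renaming (_+_ to _⊕_; _*_ to _⊗_; -_ to ⊖_)

  module R = CommutativeRing commutativeRing
  module R+ = Algebra.Properties.Group R.+-group
  module Rₚ = Algebra.Properties.Ring R.ring
  module Mult = Algebra.Properties.Semiring.Mult R.semiring
  module Exp = Algebra.Properties.Semiring.Exp R.semiring
  module Sum = Algebra.Properties.CommutativeMonoid.Sum R.+-commutativeMonoid
  module Binomial = Algebra.Properties.CommutativeSemiring.Binomial R.commutativeSemiring

  1≢0 : 1# ≢ 0#
  1≢0 = 0≢1 ∘ sym

  ⊗-cancelˡ : ∀ {x y z} → x ≢ 0# → x ⊗ y ≡ x ⊗ z → y ≡ z
  ⊗-cancelˡ {x} {y} {z} x≢0 e with inverse x x≢0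
  ... | x⁻¹ , xx⁻¹≡1 = trans (expand y) (trans (cong (x⁻¹ ⊗_) e) (sym (expand z)))
    where
    expand : ∀ y → y ≡ x⁻¹ ⊗ (x ⊗ y)
    expand y = sym (trans (sym (R.*-assoc x⁻¹ x y)) (trans (cong (_⊗ y) (trans (R.*-comm x⁻¹ x) xx⁻¹≡1)) (R.*-identityˡ y)))

  ⊗≡0 : ∀ {x y} → x ≢ 0# → x ⊗ y ≡ 0# → y ≡ 0#
  ⊗≡0 {x} x≢0 e = ⊗-cancelˡ x≢0 (trans e (sym (R.zeroʳ x)))

  ⊗≢0 : ∀ {x y} → x ≢ 0# → y ≢ 0# → x ⊗ y ≢ 0#
  ⊗≢0 x≢0 y≢0 = y≢0 ∘ ⊗≡0 x≢0

  invertible⇒≢0 : ∀ {x y} → x ⊗ y ≡ 1# → y ≢ 0#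
  invertible⇒≢0 {x} e refl = 0≢1 (trans (sym (R.zeroʳ x)) e)

  ↑-+ : ∀ x m n → x ↑ (m + n) ≡ x ↑ m ⊗ x ↑ n
  ↑-+ x zero    n = sym (R.*-identityˡ (x ↑ n))
  ↑-+ x (suc m) n = trans (cong (x ⊗_) (↑-+ x m n)) (sym (R.*-assoc x (x ↑ m) (x ↑ n)))

  ↑-* : ∀ x m n → x ↑ (m * n) ≡ (x ↑ n) ↑ m
  ↑-* x zero    n = refl
  ↑-* x (suc m) n = trans (↑-+ x n (m * n)) (cong (x ↑ n ⊗_) (↑-* x m n))

  ↑-comm : ∀ x m n → (x ↑ m) ↑ n ≡ (x ↑ n) ↑ m
  ↑-comm x m n = trans (sym (↑-* x n m)) (trans (cong (x ↑_) (ℕₚ.*-comm n m)) (↑-* x m n))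

  ⊗-↑ : ∀ x y n → (x ⊗ y) ↑ n ≡ x ↑ n ⊗ y ↑ n
  ⊗-↑ x y zero    = sym (R.*-identityˡ 1#)
  ⊗-↑ x y (suc n) = trans (cong ((x ⊗ y) ⊗_) (⊗-↑ x y n)) (interchange x y (x ↑ n) (y ↑ n))
    where
    interchange : ∀ a b c d → (a ⊗ b) ⊗ (c ⊗ d) ≡ (a ⊗ c) ⊗ (b ⊗ d)
    interchange = RingSolver.solve-∀ ring

  1↑ : ∀ n → 1# ↑ n ≡ 1#
  1↑ zero    = refl
  1↑ (suc n) = trans (R.*-identityˡ (1# ↑ n)) (1↑ n)

  ↑≢0 : ∀ {x} → x ≢ 0# → ∀ n → x ↑ n ≢ 0#
  ↑≢0 x≢0 zero    = 1≢0
  ↑≢0 x≢0 (suc n) = ⊗≢0 x≢0 (↑≢0 x≢0 n)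

  -- f is a monic polynomial function of degree k, respectively one of degree < k, in Horner form.
  Monic LowDeg : ℕ → (Carrier → Carrier) → Set
  Monic zero    f = ∀ x → f x ≡ 1#
  Monic (suc k) f = Σ Carrier λ c → Σ (Carrier → Carrier) λ g → Monic k g × (∀ x → f x ≡ c ⊕ x ⊗ g x)
  LowDeg zero    f = ∀ x → f x ≡ 0#
  LowDeg (suc k) f = Σ Carrier λ c → Σ (Carrier → Carrier) λ g → LowDeg k g × (∀ x → f x ≡ c ⊕ x ⊗ g x)

  private
    add-horner : ∀ a x b c d → (a ⊕ x ⊗ b) ⊕ (c ⊕ x ⊗ d) ≡ (a ⊕ c) ⊕ x ⊗ (b ⊕ d)
    add-horner = RingSolver.solve-∀ ring

  monic-+ : ∀ k {f h} → Monic k f → LowDeg k h → Monic k (λ x → f x ⊕ h x)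
  monic-+ zero    f≡1 h≡0 x = trans (cong₂ _⊕_ (f≡1 x) (h≡0 x)) (R.+-identityʳ 1#)
  monic-+ (suc k) (c , f′ , mf′ , f≡) (d , h′ , lh′ , h≡) = c ⊕ d , (λ x → f′ x ⊕ h′ x) , monic-+ k mf′ lh′ ,
    λ x → trans (cong₂ _⊕_ (f≡ x) (h≡ x)) (add-horner c x (f′ x) d (h′ x))

  low-scale : ∀ k {f} r → LowDeg k f → LowDeg k (λ x → r ⊗ f x)
  low-scale zero    r f≡0 x = trans (cong (r ⊗_) (f≡0 x)) (R.zeroʳ r)
  low-scale (suc k) r (c , f′ , lf′ , f≡) = r ⊗ c , (λ x → r ⊗ f′ x) , low-scale k r lf′ ,
    λ x → trans (cong (r ⊗_) (f≡ x)) (distrib r c x (f′ x))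
    where
    distrib : ∀ r c x y → r ⊗ (c ⊕ x ⊗ y) ≡ r ⊗ c ⊕ x ⊗ (r ⊗ y)
    distrib = RingSolver.solve-∀ ring

  low-zero : ∀ k → LowDeg k (λ _ → 0#)
  low-zero zero    x = refl
  low-zero (suc k) = 0# , (λ _ → 0#) , low-zero k , λ x → sym (trans (R.+-identityˡ _) (R.zeroʳ x))

  low-const : ∀ {k} → 0 < k → ∀ c → LowDeg k (λ _ → c)
  low-const {suc k} _ c = c , (λ _ → 0#) , low-zero k , λ x → sym (trans (cong (c ⊕_) (R.zeroʳ x)) (R.+-identityʳ c))

  monic⇒low : ∀ {k j f} → k < j → Monic k f → LowDeg j f
  monic⇒low {zero}  {suc j} _         f≡1                  = 1# , (λ _ → 0#) , low-zero j ,
    λ x → trans (f≡1 x) (sym (trans (cong (1# ⊕_) (R.zeroʳ x)) (R.+-identityʳ 1#)))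
  monic⇒low {suc k} {suc j} (s≤s k<j) (c , f′ , mf′ , f≡) = c , f′ , monic⇒low k<j mf′ , f≡

  monic-cong : ∀ k {f g} → (∀ x → f x ≡ g x) → Monic k f → Monic k g
  monic-cong zero    f≡g f≡1                x = trans (sym (f≡g x)) (f≡1 x)
  monic-cong (suc k) f≡g (c , f′ , mf′ , f≡) = c , f′ , mf′ , λ x → trans (sym (f≡g x)) (f≡ x)

  monic-↑ : ∀ k → Monic k (_↑ k)
  monic-↑ zero    x = refl
  monic-↑ (suc k) = 0# , (_↑ k) , monic-↑ k , λ x → sym (R.+-identityˡ _)

  -- Division by `X − r`, with the argument written as `r ⊕ d` so that `d` stands for `X − r`. If
  -- `f = c + X g` and `h` is the quotient of `g`, then the quotient of `f` is `g + r h`.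
  factor-root : ∀ k {f} → Monic (suc k) f → ∀ r →
    Σ (Carrier → Carrier) λ h → Monic k h × (∀ d → f (r ⊕ d) ≡ f r ⊕ d ⊗ h (r ⊕ d))
  factor-root zero {f} (c , g , g≡1 , f≡) r = (λ _ → 1#) , (λ _ → refl) , λ d → begin
    f (r ⊕ d)                     ≡⟨ f≡ (r ⊕ d) ⟩
    c ⊕ (r ⊕ d) ⊗ g (r ⊕ d)       ≡⟨ cong (λ t → c ⊕ (r ⊕ d) ⊗ t) (g≡1 (r ⊕ d)) ⟩
    c ⊕ (r ⊕ d) ⊗ 1#              ≡⟨ expand c r d 1# ⟩
    (c ⊕ r ⊗ 1#) ⊕ d ⊗ 1#         ≡⟨ cong (λ t → (c ⊕ r ⊗ t) ⊕ d ⊗ 1#) (sym (g≡1 r)) ⟩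
    (c ⊕ r ⊗ g r) ⊕ d ⊗ 1#        ≡⟨ cong (_⊕ d ⊗ 1#) (sym (f≡ r)) ⟩
    f r ⊕ d ⊗ 1#                  ∎
    where
    open ≡-Reasoning
    expand : ∀ c r d u → c ⊕ (r ⊕ d) ⊗ u ≡ (c ⊕ r ⊗ u) ⊕ d ⊗ u
    expand = RingSolver.solve-∀ ring
  factor-root (suc k) {f} (c , g , mg , f≡) r with factor-root k mg r
  ... | h , mh , g≡ = (λ x → g x ⊕ r ⊗ h x) , monic-+ (suc k) mg (low-scale (suc k) r (monic⇒low (ℕₚ.n<1+n k) mh)) , λ d → begin
    f (r ⊕ d)                                                   ≡⟨ f≡ (r ⊕ d) ⟩
    c ⊕ (r ⊕ d) ⊗ g (r ⊕ d)                                     ≡⟨ split c r d (g (r ⊕ d)) ⟩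
    (c ⊕ r ⊗ g (r ⊕ d)) ⊕ d ⊗ g (r ⊕ d)                         ≡⟨ cong (λ t → (c ⊕ r ⊗ t) ⊕ d ⊗ g (r ⊕ d)) (g≡ d) ⟩
    (c ⊕ r ⊗ (g r ⊕ d ⊗ h (r ⊕ d))) ⊕ d ⊗ g (r ⊕ d)             ≡⟨ regroup c r d (g r) (h (r ⊕ d)) (g (r ⊕ d)) ⟩
    (c ⊕ r ⊗ g r) ⊕ d ⊗ (g (r ⊕ d) ⊕ r ⊗ h (r ⊕ d))             ≡⟨ cong (_⊕ d ⊗ (g (r ⊕ d) ⊕ r ⊗ h (r ⊕ d))) (sym (f≡ r)) ⟩
    f r ⊕ d ⊗ (g (r ⊕ d) ⊕ r ⊗ h (r ⊕ d))                       ∎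
    where
    open ≡-Reasoning
    split : ∀ c r d u → c ⊕ (r ⊕ d) ⊗ u ≡ (c ⊕ r ⊗ u) ⊕ d ⊗ u
    split = RingSolver.solve-∀ ring
    regroup : ∀ c r d u v w → (c ⊕ r ⊗ (u ⊕ d ⊗ v)) ⊕ d ⊗ w ≡ (c ⊕ r ⊗ u) ⊕ d ⊗ (w ⊕ r ⊗ v)
    regroup = RingSolver.solve-∀ ring

  r⊕[x⊖r]≡x : ∀ r x → r ⊕ (x ⊕ ⊖ r) ≡ x
  r⊕[x⊖r]≡x r x = begin
    r ⊕ (x ⊕ ⊖ r)     ≡⟨ R.+-comm r (x ⊕ ⊖ r) ⟩
    (x ⊕ ⊖ r) ⊕ r     ≡⟨ R.+-assoc x (⊖ r) r ⟩
    x ⊕ (⊖ r ⊕ r)     ≡⟨ cong (x ⊕_) (R.-‿inverseˡ r) ⟩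
    x ⊕ 0#            ≡⟨ R.+-identityʳ x ⟩
    x                 ∎
    where open ≡-Reasoning

  roots-bound : ∀ k {f} → Monic k f → ∀ {xs} → Unique xs → All (λ x → f x ≡ 0#) xs → length xs ≤ k
  roots-bound k       mf {[]}     u        z       = z≤n
  roots-bound zero    f≡1 {x ∷ xs} u        (fx ∷ z) = contradiction (trans (sym (f≡1 x)) fx) 1≢0
  roots-bound (suc k) {f} mf {r ∷ xs} (r∉ ∷ u) (fr ∷ z) with factor-root k mf r
  ... | h , mh , f≡ = s≤s (roots-bound k mh u (All.tabulate root))
    where
    root : ∀ {x} → x ∈ xs → h x ≡ 0#
    root {x} x∈ = trans (cong h (sym (r⊕[x⊖r]≡x r x))) (⊗≡0 d≢0 (begin
      d ⊗ h (r ⊕ d)            ≡⟨ sym (R.+-identityˡ _) ⟩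
      0# ⊕ d ⊗ h (r ⊕ d)       ≡⟨ cong (_⊕ d ⊗ h (r ⊕ d)) (sym fr) ⟩
      f r ⊕ d ⊗ h (r ⊕ d)      ≡⟨ sym (f≡ d) ⟩
      f (r ⊕ d)                ≡⟨ cong f (r⊕[x⊖r]≡x r x) ⟩
      f x                      ≡⟨ All.lookup z x∈ ⟩
      0#                       ∎))
      where
      open ≡-Reasoning
      d = x ⊕ ⊖ r
      d≢0 : d ≢ 0#
      d≢0 d≡0 = All.lookup r∉ x∈ (trans (sym (R.+-identityʳ r)) (trans (cong (r ⊕_) (sym d≡0)) (r⊕[x⊖r]≡x r x)))

  roots-count : ∀ k {f} → Monic k f → (∑[ x ∈ elems ] ind (f x ≟ꟳ 0#)) ℤ.≤ + k
  roots-count k {f} mf = subst (ℤ._≤ + k) (sym (∑-ind≡length-filter (λ x → f x ≟ꟳ 0#) elems))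
    (ℤ.+≤+ (roots-bound k mf (Uniqueₚ.filter⁺ _ elems-unique) (Allₚ.all-filter _ elems)))

  map-elems↭ : (σ τ : Carrier → Carrier) → (∀ x → τ (σ x) ≡ x) → (∀ x → σ (τ x) ≡ x) → map σ elems ↭ elems
  map-elems↭ σ τ τσ στ = unique-⊆⊇⇒↭
    (Uniqueₚ.map⁺ (λ {x} {y} e → trans (sym (τσ x)) (trans (cong τ e) (τσ y))) elems-unique) elems-unique
    (λ {x} _ → complete x) (λ {x} _ → subst (_∈ map σ elems) (στ x) (∈-map⁺ σ (complete (τ x))))

  x⊕a↭ : ∀ a → map (_⊕ a) elems ↭ elems
  x⊕a↭ a = map-elems↭ (_⊕ a) (_⊕ ⊖ a)
    (λ x → trans (R.+-assoc x a (⊖ a)) (trans (cong (x ⊕_) (R.-‿inverseʳ a)) (R.+-identityʳ x)))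
    (λ x → trans (R.+-assoc x (⊖ a) a) (trans (cong (x ⊕_) (R.-‿inverseˡ a)) (R.+-identityʳ x)))

  ∑-translate : ∀ a (f : Carrier → ℤ) → (∑[ z ∈ elems ] f (z ⊕ a)) ≡ ∑ elems f
  ∑-translate a f = trans (sym (∑-map elems (_⊕ a) f)) (∑-↭ f (x⊕a↭ a))

  ≢0? : Decidable (_≢ 0#)
  ≢0? x with x ≟ꟳ 0#
  ... | yes x≡0 = no (λ x≢0 → x≢0 x≡0)
  ... | no  x≢0 = yes x≢0

  units : List Carrier
  units = filter ≢0? elems

  units-unique : Unique units
  units-unique = Uniqueₚ.filter⁺ ≢0? elems-unique

  ∈-units : ∀ {x} → x ≢ 0# → x ∈ units
  ∈-units {x} x≢0 = ∈-filter⁺ ≢0? (complete x) x≢0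

  units-≢0 : ∀ {x} → x ∈ units → x ≢ 0#
  units-≢0 x∈ = proj₂ (∈-filter⁻ ≢0? {xs = elems} x∈)

  elems↭0∷units : elems ↭ 0# ∷ units
  elems↭0∷units = unique-⊆⊇⇒↭ elems-unique (All.tabulate (λ x∈ e → units-≢0 x∈ (sym e)) ∷ units-unique) to (λ {x} _ → complete x)
    where
    to : ∀ {x} → x ∈ elems → x ∈ 0# ∷ units
    to {x} _ with x ≟ꟳ 0#
    ... | yes x≡0 = here x≡0
    ... | no  x≢0 = there (∈-units x≢0)

  size≡1+units : size ≡ suc (length units)
  size≡1+units = ↭-length elems↭0∷units

  ∏ : List Carrier → Carrier
  ∏ = foldr _⊗_ 1#

  ∏-map : ∀ x us → ∏ (map (x ⊗_) us) ≡ x ↑ length us ⊗ ∏ us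
  ∏-map x []       = sym (R.*-identityˡ 1#)
  ∏-map x (u ∷ us) = trans (cong ((x ⊗ u) ⊗_) (∏-map x us)) (interchange x u (x ↑ length us) (∏ us))
    where
    interchange : ∀ x u y p → (x ⊗ u) ⊗ (y ⊗ p) ≡ (x ⊗ y) ⊗ (u ⊗ p)
    interchange = RingSolver.solve-∀ ring

  ∏≢0 : ∀ us → All (_≢ 0#) us → ∏ us ≢ 0#
  ∏≢0 []       []        = 1≢0
  ∏≢0 (u ∷ us) (u≢0 ∷ z) = ⊗≢0 u≢0 (∏≢0 us z)

  x↑#units≡1 : ∀ {x} → x ≢ 0# → x ↑ length units ≡ 1#
  x↑#units≡1 {x} x≢0 = ⊗-cancelˡ (∏≢0 units (Allₚ.all-filter ≢0? elems)) (begin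
    ∏ units ⊗ x ↑ length units    ≡⟨ R.*-comm (∏ units) _ ⟩
    x ↑ length units ⊗ ∏ units    ≡⟨ sym (∏-map x units) ⟩
    ∏ (map (x ⊗_) units)          ≡⟨ foldr-commMonoid (setoid Carrier) R.*-isCommutativeMonoid (↭⇒↭ₛ perm) ⟩
    ∏ units                       ≡⟨ sym (R.*-identityʳ (∏ units)) ⟩
    ∏ units ⊗ 1#                  ∎)
    where
    open ≡-Reasoning
    sub : ∀ {y} → y ∈ map (x ⊗_) units → y ∈ units
    sub y∈ with ∈-map⁻ (x ⊗_) y∈
    ... | u , u∈ , refl = ∈-units (⊗≢0 x≢0 (units-≢0 u∈))
    uniq : Unique (map (x ⊗_) units)
    uniq = Uniqueₚ.map⁺ (⊗-cancelˡ x≢0) units-unique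
    perm : map (x ⊗_) units ↭ units
    perm = unique-⊆⊇⇒↭ uniq units-unique sub
      (unique-⊆-length⇒⊇ _≟ꟳ_ uniq sub (ℕₚ.≤-reflexive (sym (length-map (x ⊗_) units))))

  x↑size≡x : ∀ x → x ↑ size ≡ x
  x↑size≡x x with x ≟ꟳ 0#
  ... | no x≢0 = trans (cong (x ↑_) size≡1+units) (trans (cong (x ⊗_) (x↑#units≡1 x≢0)) (R.*-identityʳ x))
  ... | yes refl = trans (cong (0# ↑_) size≡1+units) (R.zeroˡ (0# ↑ length units))

  -- Translation by 1 permutes the field, so the sum of all elements stays the same although each
  -- summand grows by 1. With `^×1≡0⇒×1≡0` this determines the characteristic from the number of
  -- elements.
  size×1≡0 : size Mult.× 1# ≡ 0#
  size×1≡0 = R+.∙-cancelʳ s (size Mult.× 1#) 0# (begin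
    size Mult.× 1# ⊕ s            ≡⟨ sym (sum-map elems) ⟩
    foldr _⊕_ 0# (map (_⊕ 1#) elems) ≡⟨ foldr-commMonoid (setoid Carrier) R.+-isCommutativeMonoid (↭⇒↭ₛ (x⊕a↭ 1#)) ⟩
    s                             ≡⟨ sym (R.+-identityˡ s) ⟩
    0# ⊕ s                        ∎)
    where
    open ≡-Reasoning
    s = foldr _⊕_ 0# elems
    sum-map : ∀ xs → foldr _⊕_ 0# (map (_⊕ 1#) xs) ≡ length xs Mult.× 1# ⊕ foldr _⊕_ 0# xs
    sum-map []       = sym (R.+-identityˡ 0#)
    sum-map (x ∷ xs) = trans (cong ((x ⊕ 1#) ⊕_) (sum-map xs)) (interchange x 1# (length xs Mult.× 1#) (foldr _⊕_ 0# xs))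
      where
      interchange : ∀ a b c d → (a ⊕ b) ⊕ (c ⊕ d) ≡ (b ⊕ c) ⊕ (a ⊕ d)
      interchange = RingSolver.solve-∀ ring

  ^×1≡0⇒×1≡0 : ∀ p j → (p ^ j) Mult.× 1# ≡ 0# → p Mult.× 1# ≡ 0#
  ^×1≡0⇒×1≡0 p zero    e = contradiction (trans (sym (R.+-identityʳ 1#)) e) 1≢0
  ^×1≡0⇒×1≡0 p (suc j) e with (p Mult.× 1#) ≟ꟳ 0#
  ... | yes p≡0 = p≡0
  ... | no  p≢0 = ^×1≡0⇒×1≡0 p j (⊗≡0 p≢0 (trans (sym (Mult.×1-homo-* p (p ^ j))) e))

  ×≡0 : ∀ {p n} → p Mult.× 1# ≡ 0# → p ∣ n → ∀ x → n Mult.× x ≡ 0#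
  ×≡0 {p} {n} p×1≡0 (divides k refl) x = begin
    (k * p) Mult.× x                   ≡⟨ cong ((k * p) Mult.×_) (sym (R.*-identityˡ x)) ⟩
    (k * p) Mult.× (1# ⊗ x)            ≡⟨ sym (Mult.×-assoc-* (k * p) 1# x) ⟩
    ((k * p) Mult.× 1#) ⊗ x            ≡⟨ cong (_⊗ x) (trans (Mult.×1-homo-* k p) (trans (cong (k Mult.× 1# ⊗_) p×1≡0) (R.zeroʳ _))) ⟩
    0# ⊗ x                             ≡⟨ R.zeroˡ x ⟩
    0#                                 ∎
    where open ≡-Reasoning

  ↑≡^ : ∀ x n → x ↑ n ≡ x Exp.^ n
  ↑≡^ x zero    = refl
  ↑≡^ x (suc n) = cong (x ⊗_) (↑≡^ x n)

  frobenius : ∀ {p} → Prime p → p Mult.× 1# ≡ 0# → ∀ x y → (x ⊕ y) ↑ p ≡ x ↑ p ⊕ y ↑ p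
  frobenius {p@(suc p-1)} pp p×1≡0 x y = begin
    (x ⊕ y) ↑ p                                                   ≡⟨ ↑≡^ (x ⊕ y) p ⟩
    (x ⊕ y) Exp.^ p                                               ≡⟨ Binomial.theorem p x y ⟩
    t Fin.zero ⊕ Sum.sum (t ∘ Fin.suc)                            ≡⟨ cong (t Fin.zero ⊕_) (Sum.sum-init-last (t ∘ Fin.suc)) ⟩
    t Fin.zero ⊕ (Sum.sum (t ∘ Fin.suc ∘ inject₁) ⊕ t (fromℕ p))   ≡⟨ cong (λ s → t Fin.zero ⊕ (s ⊕ t (fromℕ p)))
                                                                      (trans (Sum.sum-cong-≗ middle) (Sum.sum-replicate-zero p-1)) ⟩
    t Fin.zero ⊕ (0# ⊕ t (fromℕ p))                               ≡⟨ cong₂ _⊕_ first (trans (R.+-identityˡ _) last) ⟩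
    y Exp.^ p ⊕ x Exp.^ p                                         ≡⟨ R.+-comm _ _ ⟩
    x Exp.^ p ⊕ y Exp.^ p                                         ≡⟨ sym (cong₂ _⊕_ (↑≡^ x p) (↑≡^ y p)) ⟩
    x ↑ p ⊕ y ↑ p                                                 ∎
    where
    open ≡-Reasoning
    t : Fin (suc p) → Carrier
    t = Binomial.binomialTerm x y p
    first : t Fin.zero ≡ y Exp.^ p
    first = trans (R.+-identityʳ _) (R.*-identityˡ _)
    term : ℕ → Carrier
    term k = (p C k) Mult.× (x Exp.^ k ⊗ y Exp.^ (p ∸ k))
    last : t (fromℕ p) ≡ x Exp.^ p
    last = begin
      t (fromℕ p)                                      ≡⟨ cong term (Finₚ.toℕ-fromℕ p) ⟩
      (p C p) Mult.× (x Exp.^ p ⊗ y Exp.^ (p ∸ p))      ≡⟨ cong₂ (λ a b → a Mult.× (x Exp.^ p ⊗ y Exp.^ b)) (nCn≡1 p) (ℕₚ.n∸n≡0 p) ⟩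
      1 Mult.× (x Exp.^ p ⊗ 1#)                        ≡⟨ trans (R.+-identityʳ _) (R.*-identityʳ _) ⟩
      x Exp.^ p                                        ∎
    middle : ∀ i → t (Fin.suc (inject₁ i)) ≡ 0#
    middle i = ×≡0 p×1≡0 (prime∣C pp (suc (toℕ (inject₁ i))) (s≤s z≤n)
      (s≤s (subst (_< p-1) (sym (Finₚ.toℕ-inject₁ i)) (Finₚ.toℕ<n i)))) _

  frobenius-^ : ∀ {p} → Prime p → p Mult.× 1# ≡ 0# → ∀ j x y → (x ⊕ y) ↑ (p ^ j) ≡ x ↑ (p ^ j) ⊕ y ↑ (p ^ j)
  frobenius-^ pp p×1≡0 zero x y = trans (R.*-identityʳ _) (sym (cong₂ _⊕_ (R.*-identityʳ x) (R.*-identityʳ y)))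
  frobenius-^ {p} pp p×1≡0 (suc j) x y = begin
    (x ⊕ y) ↑ (p * p ^ j)                     ≡⟨ ↑-* (x ⊕ y) p (p ^ j) ⟩
    ((x ⊕ y) ↑ (p ^ j)) ↑ p                   ≡⟨ cong (_↑ p) (frobenius-^ pp p×1≡0 j x y) ⟩
    (x ↑ (p ^ j) ⊕ y ↑ (p ^ j)) ↑ p           ≡⟨ frobenius pp p×1≡0 _ _ ⟩
    (x ↑ (p ^ j)) ↑ p ⊕ (y ↑ (p ^ j)) ↑ p     ≡⟨ sym (cong₂ _⊕_ (↑-* x p (p ^ j)) (↑-* y p (p ^ j))) ⟩
    x ↑ (p * p ^ j) ⊕ y ↑ (p * p ^ j)         ∎
    where open ≡-Reasoning

  ↑-multiple : ∀ {x} k m → x ↑ m ≡ 1# → x ↑ (k * m) ≡ 1#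
  ↑-multiple {x} k m e = trans (↑-* x k m) (trans (cong (_↑ k) e) (1↑ k))

  ↑-bézout : ∀ {x} a b m n → x ↑ m ≡ 1# → x ↑ n ≡ 1# → ∀ {d} → d + b * n ≡ a * m → x ↑ d ≡ 1#
  ↑-bézout {x} a b m n xᵐ xⁿ {d} e = begin
    x ↑ d                     ≡⟨ sym (R.*-identityʳ _) ⟩
    x ↑ d ⊗ 1#                ≡⟨ cong (x ↑ d ⊗_) (sym (↑-multiple b n xⁿ)) ⟩
    x ↑ d ⊗ x ↑ (b * n)       ≡⟨ sym (↑-+ x d (b * n)) ⟩
    x ↑ (d + b * n)           ≡⟨ cong (x ↑_) e ⟩
    x ↑ (a * m)               ≡⟨ ↑-multiple a m xᵐ ⟩
    1#                        ∎
    where open ≡-Reasoning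

  ↑-gcd : ∀ {x} m n → x ↑ m ≡ 1# → x ↑ n ≡ 1# → x ↑ gcd m n ≡ 1#
  ↑-gcd m n xᵐ xⁿ with Bézout.identity (gcd-GCD m n)
  ... | Bézout.+- a b e = ↑-bézout a b m n xᵐ xⁿ e
  ... | Bézout.-+ a b e = ↑-bézout b a n m xⁿ xᵐ e

search : {A : Set} {P : A → Set} (P? : Decidable P) (xs : List A) → (∃ λ x → x ∈ xs × P x) ⊎ All (¬_ ∘ P) xs
search P? xs with any? P? xs
... | yes a = inj₁ (find a)
... | no ¬a = inj₂ (Allₚ.¬Any⇒All¬ xs ¬a)

-- Existence of a primitive element, discrete logarithms, and freeness as coprimality

module Generator (F : FiniteField) where

  open FieldTheory F

  N : ℕ
  N = length units

  N≢0 : N ≢ 0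
  N≢0 N≡0 with units | N≡0 | ∈-units 1≢0
  ... | [] | _ | ()

  -- Here `e` is `N / l`. For a prime `l` of `N` and nonzero `g` the condition says that the order
  -- of `g` contains the full power of `l` in `N`, so avoiding every such prime means having order
  -- `N`.
  Avoids : Carrier → ℕ → Set
  Avoids g l = ∀ e → N ≡ e * l → g ↑ e ≢ 1#

  nonroot : ∀ e → e ≢ 0 → e < N → ∃ λ x → x ≢ 0# × x ↑ e ≢ 1#
  nonroot zero e≢0 e<N = contradiction refl e≢0
  nonroot e@(suc _) e≢0 e<N with search ≢1? units
    where
    ≢1? : Decidable (λ x → x ↑ e ≢ 1#)
    ≢1? x with x ↑ e ≟ꟳ 1#
    ... | yes eq = no (λ ne → ne eq)
    ... | no  ne = yes ne
  ... | inj₁ (x , x∈ , ne) = x , units-≢0 x∈ , ne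
  ... | inj₂ none = contradiction (roots-bound e (monic-+ e (monic-↑ e) (low-const (s≤s z≤n) (⊖ 1#))) units-unique
          (All.map root none)) (ℕₚ.<⇒≱ e<N)
    where
    root : ∀ {x} → ¬ (x ↑ e ≢ 1#) → x ↑ e ⊕ ⊖ 1# ≡ 0#
    root {x} nn with x ↑ e ≟ꟳ 1#
    ... | yes eq = trans (cong (_⊕ ⊖ 1#) eq) (R.-‿inverseʳ 1#)
    ... | no  ne = contradiction ne nn

  -- If `g` fails at `l`, it is multiplied by `x ↑ M`, where `M = product L` and `x ↑ (N / l)` is
  -- not 1. Raised to `N / l′` with `l′` in `L` the new factor is 1, as `l′` divides `M`, so nothing
  -- already achieved is lost. Raised to `N / l` it is not 1, since `x ↑ (N / l)` has order `l`,
  -- which is prime to `M`. No factorisation into prime powers is involved.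
  avoiding : ∀ L → Valid N L → ∃ λ g → g ≢ 0# × All (Avoids g) L
  avoiding [] v = 1# , 1≢0 , []
  avoiding (l ∷ L) v@(pl ∷ pL , l∉ ∷ _ , divides e N≡ ∷ L∣N) with avoiding L (valid-tail v)
  ... | g , g≢0 , avoids with g ↑ e ≟ꟳ 1#
  ...   | no  gᵉ≢1 = g , g≢0 , avoids-l ∷ avoids
    where
    avoids-l : Avoids g l
    avoids-l e′ N≡′ = subst (λ e → g ↑ e ≢ 1#) (ℕₚ.*-cancelʳ-≡ e e′ l {{prime⇒nonZero pl}} (trans (sym N≡) N≡′)) gᵉ≢1
  ...   | yes gᵉ≡1 = g′ , ⊗≢0 g≢0 (↑≢0 x≢0 M) , avoids-l ∷ All.zipWith (λ { (l∣M , av) → keep l∣M av }) (∣product-all L , avoids)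
    where
    M = product L
    e≢0 : e ≢ 0
    e≢0 e≡0 = N≢0 (trans N≡ (cong (_* l) e≡0))
    e<N : e < N
    e<N = subst₂ _<_ (ℕₚ.*-identityʳ e) (sym N≡) (ℕₚ.*-monoʳ-< e {{ℕ.≢-nonZero e≢0}} (ℕ.nonTrivial⇒n>1 l {{prime⇒nonTrivial pl}}))
    found = nonroot e e≢0 e<N
    x = proj₁ found
    x≢0 = proj₁ (proj₂ found)
    xᵉ≢1 = proj₂ (proj₂ found)
    g′ = g ⊗ x ↑ M
    keep : ∀ {l′} → l′ ∣ M → Avoids g l′ → Avoids g′ l′
    keep {l′} (divides c M≡) av e′ N≡′ g′≡1 = av e′ N≡′ (begin
      g ↑ e′                     ≡⟨ sym (R.*-identityʳ _) ⟩
      g ↑ e′ ⊗ 1#                ≡⟨ cong (g ↑ e′ ⊗_) (sym (↑-multiple c N (x↑#units≡1 x≢0))) ⟩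
      g ↑ e′ ⊗ x ↑ (c * N)       ≡⟨ cong (λ k → g ↑ e′ ⊗ x ↑ k) exponent ⟩
      g ↑ e′ ⊗ x ↑ (e′ * M)      ≡⟨ cong (g ↑ e′ ⊗_) (↑-* x e′ M) ⟩
      g ↑ e′ ⊗ (x ↑ M) ↑ e′      ≡⟨ sym (⊗-↑ g (x ↑ M) e′) ⟩
      g′ ↑ e′                    ≡⟨ g′≡1 ⟩
      1#                         ∎)
      where
      open ≡-Reasoning
      exponent : c * N ≡ e′ * M
      exponent = trans (cong (c *_) N≡′) (trans (lemma c e′ l′) (cong (e′ *_) (sym M≡)))
        where
        lemma : ∀ c e l → c * (e * l) ≡ e * (c * l)
        lemma = +-*-Solver.solve 3 (λ c e l → c :* (e :* l) := e :* (c :* l)) refl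
          where open +-*-Solver
    gcd≡1 : gcd M l ≡ 1
    gcd≡1 = no-common-prime⇒gcd≡1 M l (ℕ.≢-nonZero⁻¹ l {{prime⇒nonZero pl}})
      (λ pp p∣M p∣l → prime∤product pl pL l∉ (subst (_∣ M) (prime∣prime⇒≡ pp pl p∣l) p∣M))
    avoids-l : Avoids g′ l
    avoids-l e′ N≡′ g′≡1 = xᵉ≢1 (begin
      x ↑ e                      ≡⟨ sym (R.*-identityʳ _) ⟩
      (x ↑ e) ↑ 1                ≡⟨ cong ((x ↑ e) ↑_) (sym gcd≡1) ⟩
      (x ↑ e) ↑ gcd M l          ≡⟨ ↑-gcd M l x↑eM x↑el ⟩
      1#                         ∎)
      where
      open ≡-Reasoning
      e′≡e : e′ ≡ e
      e′≡e = ℕₚ.*-cancelʳ-≡ e′ e l {{prime⇒nonZero pl}} (trans (sym N≡′) N≡)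
      x↑el : (x ↑ e) ↑ l ≡ 1#
      x↑el = trans (↑-comm x e l) (trans (sym (↑-* x e l)) (trans (cong (x ↑_) (sym N≡)) (x↑#units≡1 x≢0)))
      x↑eM : (x ↑ e) ↑ M ≡ 1#
      x↑eM = begin
        (x ↑ e) ↑ M              ≡⟨ ↑-comm x e M ⟩
        (x ↑ M) ↑ e              ≡⟨ sym (R.*-identityˡ _) ⟩
        1# ⊗ (x ↑ M) ↑ e         ≡⟨ cong (_⊗ (x ↑ M) ↑ e) (sym gᵉ≡1) ⟩
        g ↑ e ⊗ (x ↑ M) ↑ e      ≡⟨ sym (⊗-↑ g (x ↑ M) e) ⟩
        g′ ↑ e                   ≡⟨ cong (g′ ↑_) (sym e′≡e) ⟩
        g′ ↑ e′                  ≡⟨ g′≡1 ⟩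
        1#                       ∎

  generator : Carrier
  generator = proj₁ (avoiding (primes N) (primes-valid ∣-refl))

  generator≢0 : generator ≢ 0#
  generator≢0 = proj₁ (proj₂ (avoiding (primes N) (primes-valid ∣-refl)))

  -- The generator raised to `gcd i N` is 1. If the cofactor `c = N / gcd i N` had a prime factor
  -- `l`, then `N / l` would be a multiple of this gcd, contrary to `Avoids`.
  generator-order : ∀ i → generator ↑ i ≡ 1# → N ∣ i
  generator-order i gⁱ≡1 with gcd[m,n]∣n i N
  ... | divides c N≡ with c ℕ.≟ 1
  ...   | yes refl = subst (_∣ i) (sym (trans N≡ (ℕₚ.+-identityʳ _))) (gcd[m,n]∣m i N)
  ...   | no  c≢1 with prime-factor c (λ c≡0 → N≢0 (trans N≡ (cong (_* gcd i N) c≡0))) c≢1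
  ...     | l , pl , divides c′ c≡ = contradiction
    (↑-multiple c′ (gcd i N) (↑-gcd i N gⁱ≡1 (x↑#units≡1 generator≢0)))
    (All.lookup (proj₂ (proj₂ (avoiding (primes N) (primes-valid ∣-refl)))) (∈-primes N≢0 pl l∣N) (c′ * gcd i N) N≡′)
    where
    N≡′ : N ≡ c′ * gcd i N * l
    N≡′ = trans N≡ (trans (cong (_* gcd i N) c≡) (lemma c′ l (gcd i N)))
      where
      lemma : ∀ c l d → c * l * d ≡ c * d * l
      lemma = +-*-Solver.solve 3 (λ c l d → c :* l :* d := c :* d :* l) refl
        where open +-*-Solver
    l∣N : l ∣ N
    l∣N = divides (c′ * gcd i N) N≡′

  generator-∸ : ∀ {i j} → j ≤ i → generator ↑ i ≡ generator ↑ j → N ∣ i ∸ j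
  generator-∸ {i} {j} j≤i e = generator-order (i ∸ j) (⊗-cancelˡ (↑≢0 generator≢0 j) (begin
    generator ↑ j ⊗ generator ↑ (i ∸ j)   ≡⟨ sym (↑-+ generator j (i ∸ j)) ⟩
    generator ↑ (j + (i ∸ j))             ≡⟨ cong (generator ↑_) (ℕₚ.m+[n∸m]≡n j≤i) ⟩
    generator ↑ i                         ≡⟨ e ⟩
    generator ↑ j                         ≡⟨ sym (R.*-identityʳ _) ⟩
    generator ↑ j ⊗ 1#                    ∎))
    where open ≡-Reasoning

  powers : List Carrier
  powers = map (generator ↑_) (downFrom N)

  powers-unique : Unique powers
  powers-unique = subst Unique (sym (map-downFrom (generator ↑_) N))
    (Uniqueₚ.applyDownFrom⁺₁ (generator ↑_) N (λ j<i i<N e → ∤-<-∸ j<i i<N (generator-∸ (ℕₚ.<⇒≤ j<i) e)))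

  units↭powers : units ↭ powers
  units↭powers = ↭-sym (unique-⊆⊇⇒↭ powers-unique units-unique sub
    (unique-⊆-length⇒⊇ _≟ꟳ_ powers-unique sub
      (ℕₚ.≤-reflexive (sym (trans (length-map (generator ↑_) (downFrom N)) (length-downFrom N))))))
    where
    sub : ∀ {x} → x ∈ powers → x ∈ units
    sub x∈ with ∈-map⁻ (generator ↑_) x∈
    ... | i , _ , refl = ∈-units (↑≢0 generator≢0 i)

  log : ∀ {x} → x ≢ 0# → ∃ λ i → x ≡ generator ↑ i
  log x≢0 with ∈-map⁻ (generator ↑_) (∈-resp-↭ units↭powers (∈-units x≢0))
  ... | i , _ , e = i , e

  ∑-elems : (f : Carrier → ℤ) → ∑ elems f ≡ f 0# ℤ.+ (∑[ i < N ] f (generator ↑ i))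
  ∑-elems f = trans (∑-↭ f elems↭0∷units)
    (cong (ℤ._+_ (f 0#)) (trans (∑-↭ f units↭powers) (∑-map (downFrom N) (generator ↑_) f)))

  -- Exponents are determined only mod `N`, but `d ∣ m ∣ N`, so divisibility by `d` is a property of
  -- the element. For `to`, freeness is tested on the divisor `gcd i m` itself.
  free⇔coprime : ∀ m → m ∣ N → ∀ i → (IsFree m (generator ↑ i) → gcd i m ≡ 1) × (gcd i m ≡ 1 → IsFree m (generator ↑ i))
  free⇔coprime m m∣N i = to , from
    where
    to : IsFree m (generator ↑ i) → gcd i m ≡ 1
    to free with gcd[m,n]∣m i m
    ... | divides c i≡ = free (gcd i m) (generator ↑ c) (gcd[m,n]∣n i m) (↑≢0 generator≢0 c)
      (trans (cong (generator ↑_) (trans i≡ (ℕₚ.*-comm c (gcd i m)))) (↑-* generator (gcd i m) c))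
    from : gcd i m ≡ 1 → IsFree m (generator ↑ i)
    from gcd≡1 d ζ d∣m ζ≢0 e with log ζ≢0
    ... | j , refl = ∣1⇒≡1 (subst (d ∣_) gcd≡1 (gcd-greatest d∣i d∣m))
      where
      d∣N : d ∣ N
      d∣N = ∣-trans d∣m m∣N
      e′ : generator ↑ i ≡ generator ↑ (d * j)
      e′ = trans e (sym (↑-* generator d j))
      d∣i : d ∣ i
      d∣i with ℕₚ.≤-total (d * j) i
      ... | inj₁ dj≤i = subst (d ∣_) (ℕₚ.m+[n∸m]≡n dj≤i) (∣m∣n⇒∣m+n (m∣m*n j) (∣-trans d∣N (generator-∸ dj≤i e′)))
      ... | inj₂ i≤dj = ∣m+n∣m⇒∣n (subst (d ∣_) (sym (ℕₚ.m∸n+n≡m i≤dj)) (m∣m*n j)) (∣-trans d∣N (generator-∸ i≤dj (sym e′)))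

-- The trace form over F_q and the intersections of its kernels

product-tight : ∀ {a b c d} → a ≤ c → b ≤ d → 0 < c → 0 < d → a * b ≡ c * d → a ≡ c × b ≡ d
product-tight {a} {b} {c} {d} a≤c b≤d 0<c 0<d e = a≡c , b≡d
  where
  a≡c : a ≡ c
  a≡c with ℕₚ.m≤n⇒m<n∨m≡n a≤c
  ... | inj₂ a≡c = a≡c
  ... | inj₁ a<c = contradiction e (ℕₚ.<⇒≢ (ℕₚ.≤-<-trans (ℕₚ.*-monoʳ-≤ a b≤d) (ℕₚ.*-monoˡ-< d {{ℕ.>-nonZero 0<d}} a<c)))
  b≡d : b ≡ d
  b≡d = ℕₚ.*-cancelˡ-≡ b d c {{ℕ.>-nonZero 0<c}} (trans (cong (_* b) (sym a≡c)) e)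

module Trace (F : FiniteField) (q n-1 : ℕ) (q-prime-power : IsPrimePower q)
  (size≡ : FiniteField.size F ≡ q ^ suc n-1) where

  open FieldTheory F

  private
    module +-semigroup = Algebra.Properties.CommutativeSemigroup R.+-commutativeSemigroup
    module *-semigroup = Algebra.Properties.CommutativeSemigroup R.*-commutativeSemigroup

  n : ℕ
  n = suc n-1

  p k : ℕ
  p = proj₁ q-prime-power
  k = proj₁ (proj₂ q-prime-power)

  p-prime : Prime p
  p-prime = proj₁ (proj₂ (proj₂ q-prime-power))

  q≡p^k : q ≡ p ^ k
  q≡p^k = proj₂ (proj₂ (proj₂ (proj₂ q-prime-power)))

  1<q : 1 < q
  1<q = subst (1 <_) (sym q≡p^k) (ℕₚ.<-≤-trans (ℕ.nonTrivial⇒n>1 p {{prime⇒nonTrivial p-prime}})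
    (subst (_≤ p ^ k) (ℕₚ.*-identityʳ p)
      (ℕₚ.^-monoʳ-≤ p {{prime⇒nonZero p-prime}} (proj₁ (proj₂ (proj₂ (proj₂ q-prime-power)))))))

  instance
    q≢0 : NonZero q
    q≢0 = ℕ.>-nonZero (ℕₚ.<-trans (s≤s z≤n) 1<q)

  0<q^ : ∀ i → 0 < q ^ i
  0<q^ i = ℕₚ.m^n>0 q i

  p×1≡0 : p Mult.× 1# ≡ 0#
  p×1≡0 = ^×1≡0⇒×1≡0 p (k * n) (trans
    (cong (Mult._× 1#) (sym (trans size≡ (trans (cong (_^ n) q≡p^k) (ℕₚ.^-*-assoc p k n))))) size×1≡0)

  frobenius-q : ∀ i x y → (x ⊕ y) ↑ (q ^ i) ≡ x ↑ (q ^ i) ⊕ y ↑ (q ^ i)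
  frobenius-q i x y = subst (λ r → (x ⊕ y) ↑ r ≡ x ↑ r ⊕ y ↑ r)
    (sym (trans (cong (_^ i) q≡p^k) (ℕₚ.^-*-assoc p k i))) (frobenius-^ p-prime p×1≡0 (k * i) x y)

  frobenius-q₁ : ∀ x y → (x ⊕ y) ↑ q ≡ x ↑ q ⊕ y ↑ q
  frobenius-q₁ x y = subst (λ r → (x ⊕ y) ↑ r ≡ x ↑ r ⊕ y ↑ r) (ℕₚ.^-identityʳ q) (frobenius-q 1 x y)

  -- The subfield F_q, realised as the fixed points of the q-Frobenius; that there are exactly `q`
  -- of them comes out only with `#K≡q`.
  InK : Carrier → Set
  InK a = a ↑ q ≡ a

  inK? : Decidable InK
  inK? a = a ↑ q ≟ꟳ a

  inK-0 : InK 0#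
  inK-0 = trans (cong (0# ↑_) (sym (ℕₚ.suc-pred q))) (R.zeroˡ _)

  inK-^ : ∀ {a} → InK a → ∀ i → a ↑ (q ^ i) ≡ a
  inK-^ {a} aK zero    = R.*-identityʳ a
  inK-^ {a} aK (suc i) = trans (↑-* a q (q ^ i)) (trans (cong (_↑ q) (inK-^ aK i)) aK)

  inK-inverse : ∀ {a b} → a ≢ 0# → a ⊗ b ≡ 1# → InK a → InK b
  inK-inverse {a} {b} a≢0 ab≡1 aK = ⊗-cancelˡ a≢0 (begin
    a ⊗ b ↑ q        ≡⟨ cong (_⊗ b ↑ q) (sym aK) ⟩
    a ↑ q ⊗ b ↑ q    ≡⟨ sym (⊗-↑ a b q) ⟩
    (a ⊗ b) ↑ q      ≡⟨ cong (_↑ q) ab≡1 ⟩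
    1# ↑ q           ≡⟨ 1↑ q ⟩
    1#               ≡⟨ sym ab≡1 ⟩
    a ⊗ b            ∎)
    where open ≡-Reasoning

  inK-neg : ∀ {a} → InK a → InK (⊖ a)
  inK-neg {a} aK = R+.∙-cancelˡ a _ _ (begin
    a ⊕ (⊖ a) ↑ q          ≡⟨ cong (_⊕ (⊖ a) ↑ q) (sym aK) ⟩
    a ↑ q ⊕ (⊖ a) ↑ q      ≡⟨ sym (frobenius-q₁ a (⊖ a)) ⟩
    (a ⊕ ⊖ a) ↑ q          ≡⟨ cong (_↑ q) (R.-‿inverseʳ a) ⟩
    0# ↑ q                 ≡⟨ inK-0 ⟩
    0#                     ≡⟨ sym (R.-‿inverseʳ a) ⟩
    a ⊕ ⊖ a                ∎)
    where open ≡-Reasoning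

  tr : Carrier → Carrier
  tr = Tr q n

  tr-⊕ : ∀ x y → tr (x ⊕ y) ≡ tr x ⊕ tr y
  tr-⊕ x y = go n
    where
    go : ∀ i → Tr q i (x ⊕ y) ≡ Tr q i x ⊕ Tr q i y
    go zero    = sym (R.+-identityˡ 0#)
    go (suc i) = trans (cong₂ _⊕_ (go i) (frobenius-q i x y)) (+-semigroup.interchange _ _ _ _)

  tr-⊗ : ∀ {a} → InK a → ∀ x → tr (a ⊗ x) ≡ a ⊗ tr x
  tr-⊗ {a} aK x = go n
    where
    go : ∀ i → Tr q i (a ⊗ x) ≡ a ⊗ Tr q i x
    go zero    = sym (R.zeroʳ a)
    go (suc i) = trans (cong₂ _⊕_ (go i) (trans (⊗-↑ a x (q ^ i)) (cong (_⊗ x ↑ (q ^ i)) (inK-^ aK i))))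
      (sym (R.distribˡ a _ _))

  tr-0 : tr 0# ≡ 0#
  tr-0 = trans (cong tr (sym (R.zeroˡ 0#))) (trans (tr-⊗ inK-0 0#) (R.zeroˡ _))

  tr-⊖ : ∀ x → tr (⊖ x) ≡ ⊖ tr x
  tr-⊖ x = R+.∙-cancelˡ (tr x) _ _ (trans (sym (tr-⊕ x (⊖ x)))
    (trans (cong tr (R.-‿inverseʳ x)) (trans tr-0 (sym (R.-‿inverseʳ (tr x))))))

  -- Raising to the power `q` shifts the summands of the trace by one place. The sum with `x` added
  -- telescopes, and the new last term `x ↑ (q ^ n)` is `x` again.
  tr∈K : ∀ x → InK (tr x)
  tr∈K x = R+.∙-cancelʳ x _ _ (trans (go n) (cong (tr x ⊕_) (trans (cong (x ↑_) (sym size≡)) (x↑size≡x x))))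
    where
    go : ∀ i → (Tr q i x) ↑ q ⊕ x ≡ Tr q i x ⊕ x ↑ (q ^ i)
    go zero    = cong₂ _⊕_ inK-0 (sym (R.*-identityʳ x))
    go (suc i) = begin
      (Tr q i x ⊕ x ↑ (q ^ i)) ↑ q ⊕ x            ≡⟨ cong (_⊕ x) (frobenius-q₁ _ _) ⟩
      ((Tr q i x) ↑ q ⊕ (x ↑ (q ^ i)) ↑ q) ⊕ x    ≡⟨ +-semigroup.xy∙z≈xz∙y _ _ _ ⟩
      ((Tr q i x) ↑ q ⊕ x) ⊕ (x ↑ (q ^ i)) ↑ q    ≡⟨ cong₂ _⊕_ (go i) (sym (↑-* x q (q ^ i))) ⟩
      Tr q (suc i) x ⊕ x ↑ (q ^ suc i)            ∎
      where
      open ≡-Reasoning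

  Tr-low : ∀ i → LowDeg (q ^ i) (Tr q i)
  Tr-monic : ∀ i → Monic (q ^ i) (Tr q (suc i))
  Tr-low zero    = low-zero 1
  Tr-low (suc i) = monic⇒low (ℕₚ.^-monoʳ-< q 1<q (ℕₚ.n<1+n i)) (Tr-monic i)
  Tr-monic i = monic-cong (q ^ i) (λ x → R.+-comm (x ↑ (q ^ i)) (Tr q i x)) (monic-+ (q ^ i) (monic-↑ (q ^ i)) (Tr-low i))

  tr-monic : Monic (q ^ n-1) tr
  tr-monic = Tr-monic n-1

  -- As a polynomial `tr` is monic of degree `q ^ n-1`, less than the size of the field, so it takes
  -- a nonzero value. This value lies in F_q, whence linearity allows it to be scaled to 1.
  tr-onto-1 : ∃ λ v → tr v ≡ 1#
  tr-onto-1 with search (≢0? ∘ tr) elems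
  ... | inj₂ none = contradiction (roots-bound (q ^ n-1) tr-monic elems-unique (All.map zero-at none))
          (ℕₚ.<⇒≱ (subst (q ^ n-1 <_) (sym size≡) (ℕₚ.^-monoʳ-< q 1<q (ℕₚ.n<1+n n-1))))
    where
    zero-at : ∀ {x} → ¬ (tr x ≢ 0#) → tr x ≡ 0#
    zero-at {x} nn with tr x ≟ꟳ 0#
    ... | yes e = e
    ... | no ne = contradiction ne nn
  ... | inj₁ (u , _ , t≢0) with inverse (tr u) t≢0
  ...   | t⁻¹ , e = t⁻¹ ⊗ u , trans (tr-⊗ (inK-inverse t≢0 e (tr∈K u)) u) (trans (R.*-comm t⁻¹ (tr u)) e)

  tr-onto-1-scaled : ∀ {y} → y ≢ 0# → ∃ λ v → tr (y ⊗ v) ≡ 1#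
  tr-onto-1-scaled {y} y≢0 with inverse y y≢0 | tr-onto-1
  ... | y⁻¹ , e | v , tr≡1 = y⁻¹ ⊗ v , trans (cong tr (trans (sym (R.*-assoc y y⁻¹ v))
    (trans (cong (_⊗ v) e) (R.*-identityˡ v)))) tr≡1

  tr₀ : Carrier → Carrier → ℤ
  tr₀ y z = ind (tr (y ⊗ z) ≟ꟳ 0#)

  #K : ℤ
  #K = ∑[ a ∈ elems ] ind (inK? a)

  tr-line : ∀ y z a v → InK a → tr (y ⊗ (z ⊕ a ⊗ v)) ≡ tr (y ⊗ z) ⊕ a ⊗ tr (y ⊗ v)
  tr-line y z a v aK = trans (cong tr (trans (R.distribˡ y z (a ⊗ v)) (cong (y ⊗ z ⊕_) (*-semigroup.x∙yz≈y∙xz y a v)))) (trans (tr-⊕ _ _) (cong (tr (y ⊗ z) ⊕_) (tr-⊗ aK (y ⊗ v))))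

  -- The fibres of z ↦ tr(yz) over K are translates of each other along K·v.
  equal-fibres : ∀ y v (w : Carrier → ℤ) → tr (y ⊗ v) ≡ 1# → (∀ {a} → InK a → ∀ z → w (z ⊕ a ⊗ v) ≡ w z) →
    ∑ elems w ≡ #K ℤ.* (∑[ z ∈ elems ] w z ℤ.* tr₀ y z)
  equal-fibres y v w tr≡1 invariant = begin
    ∑ elems w
      ≡⟨ ∑-cong elems (λ z → trans (sym (ℤₚ.*-identityʳ (w z))) (trans (cong (w z ℤ.*_) (sym (one z))) (sym (∑-*ˡ elems (w z) _)))) ⟩
    (∑[ z ∈ elems ] ∑[ a ∈ elems ] w z ℤ.* (ind (inK? a) ℤ.* ind (tr (y ⊗ z) ≟ꟳ a)))
      ≡⟨ ∑-swap elems elems _ ⟩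
    (∑[ a ∈ elems ] ∑[ z ∈ elems ] w z ℤ.* (ind (inK? a) ℤ.* ind (tr (y ⊗ z) ≟ꟳ a)))
      ≡⟨ ∑-cong elems fibre ⟩
    (∑[ a ∈ elems ] ind (inK? a) ℤ.* (∑[ z ∈ elems ] w z ℤ.* tr₀ y z))
      ≡⟨ ∑-*ʳ elems _ (λ a → ind (inK? a)) ⟩
    #K ℤ.* (∑[ z ∈ elems ] w z ℤ.* tr₀ y z) ∎
    where
    open ≡-Reasoning
    one : ∀ z → (∑[ a ∈ elems ] ind (inK? a) ℤ.* ind (tr (y ⊗ z) ≟ꟳ a)) ≡ 1ℤ
    one z = trans (∑-cong elems absorb)
      (∑-ind-unique (λ a → tr (y ⊗ z) ≟ꟳ a) elems-unique (complete (tr (y ⊗ z))) refl (λ _ e → sym e))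
      where
      absorb : ∀ a → ind (inK? a) ℤ.* ind (tr (y ⊗ z) ≟ꟳ a) ≡ ind (tr (y ⊗ z) ≟ꟳ a)
      absorb a with tr (y ⊗ z) ≟ꟳ a
      ... | no  _    = ℤₚ.*-zeroʳ (ind (inK? a))
      ... | yes refl = trans (ℤₚ.*-identityʳ _) (ind-yes (inK? a) (tr∈K (y ⊗ z)))
    fibre : ∀ a → (∑[ z ∈ elems ] w z ℤ.* (ind (inK? a) ℤ.* ind (tr (y ⊗ z) ≟ꟳ a)))
      ≡ ind (inK? a) ℤ.* (∑[ z ∈ elems ] w z ℤ.* tr₀ y z)
    fibre a with inK? a
    ... | no _ = trans (∑-cong elems (λ z → ℤₚ.*-zeroʳ (w z))) (trans (∑-const elems 0ℤ) (ℤₚ.*-zeroʳ (+ length elems)))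
    ... | yes aK = begin
      (∑[ z ∈ elems ] w z ℤ.* (1ℤ ℤ.* ind (tr (y ⊗ z) ≟ꟳ a)))
        ≡⟨ sym (∑-translate (a ⊗ v) _) ⟩
      (∑[ z ∈ elems ] w (z ⊕ a ⊗ v) ℤ.* (1ℤ ℤ.* ind (tr (y ⊗ (z ⊕ a ⊗ v)) ≟ꟳ a)))
        ≡⟨ ∑-cong elems (λ z → cong₂ ℤ._*_ (invariant aK z) (trans (ℤₚ.*-identityˡ _) (ind-cong _ _ (to z) (from z)))) ⟩
      (∑[ z ∈ elems ] w z ℤ.* tr₀ y z)
        ≡⟨ sym (ℤₚ.*-identityˡ _) ⟩
      1ℤ ℤ.* (∑[ z ∈ elems ] w z ℤ.* tr₀ y z) ∎
      where
      shifted : ∀ z → tr (y ⊗ (z ⊕ a ⊗ v)) ≡ tr (y ⊗ z) ⊕ a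
      shifted z = trans (tr-line y z a v aK) (cong (tr (y ⊗ z) ⊕_) (trans (cong (a ⊗_) tr≡1) (R.*-identityʳ a)))
      to : ∀ z → tr (y ⊗ (z ⊕ a ⊗ v)) ≡ a → tr (y ⊗ z) ≡ 0#
      to z e = R+.∙-cancelʳ a _ _ (trans (sym (shifted z)) (trans e (sym (R.+-identityˡ a))))
      from : ∀ z → tr (y ⊗ z) ≡ 0# → tr (y ⊗ (z ⊕ a ⊗ v)) ≡ a
      from z e = trans (shifted z) (trans (cong (_⊕ a) e) (R.+-identityˡ a))

  q^n≡#K*kernel : ∀ {y} → y ≢ 0# → + (q ^ n) ≡ #K ℤ.* ∑ elems (tr₀ y)
  q^n≡#K*kernel {y} y≢0 with tr-onto-1-scaled y≢0
  ... | v , tr≡1 = begin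
    + (q ^ n)                                    ≡⟨ cong +_ (sym size≡) ⟩
    + size                                       ≡⟨ sym (trans (∑-const elems 1ℤ) (ℤₚ.*-identityʳ _)) ⟩
    (∑[ z ∈ elems ] 1ℤ)                          ≡⟨ equal-fibres y v (λ _ → 1ℤ) tr≡1 (λ _ _ → refl) ⟩
    #K ℤ.* (∑[ z ∈ elems ] 1ℤ ℤ.* tr₀ y z)       ≡⟨ cong (#K ℤ.*_) (∑-cong elems (λ z → ℤₚ.*-identityˡ (tr₀ y z))) ⟩
    #K ℤ.* ∑ elems (tr₀ y)                       ∎
    where open ≡-Reasoning

  #K≤q : #K ℤ.≤ + q
  #K≤q = subst (ℤ._≤ + q) (∑-cong elems (λ a → ind-cong _ _ (to a) (from a)))
    (roots-count q (monic-+ q (monic-↑ q) (low-scale q (⊖ 1#) (monic⇒low 1<q (monic-↑ 1)))))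
    where
    neg : ∀ a → ⊖ 1# ⊗ a ↑ 1 ≡ ⊖ a
    neg a = trans (Rₚ.-1*x≈-x (a ↑ 1)) (cong ⊖_ (R.*-identityʳ a))
    to : ∀ a → a ↑ q ⊕ ⊖ 1# ⊗ a ↑ 1 ≡ 0# → InK a
    to a e = R+.∙-cancelʳ (⊖ a) _ _ (trans (cong (a ↑ q ⊕_) (sym (neg a))) (trans e (sym (R.-‿inverseʳ a))))
    from : ∀ a → InK a → a ↑ q ⊕ ⊖ 1# ⊗ a ↑ 1 ≡ 0#
    from a aK = trans (cong₂ _⊕_ aK (neg a)) (R.-‿inverseʳ a)

  -- Counting roots gives at most `q` elements of F_q and at most `q ^ n-1` in the kernel of the
  -- trace. Since the product of the two numbers is `q ^ n`, both bounds are attained.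
  #K×#kernel : #K ≡ + q × ∑ elems (tr₀ 1#) ≡ + (q ^ n-1)
  #K×#kernel = trans #K≡ (cong +_ (proj₁ tight)) , trans #ker≡ (cong +_ (proj₂ tight))
    where
    a b : ℕ
    a = length (filter inK? elems)
    b = length (filter (λ x → tr x ≟ꟳ 0#) elems)
    #K≡ : #K ≡ + a
    #K≡ = ∑-ind≡length-filter inK? elems
    roots≡ : (∑[ x ∈ elems ] ind (tr x ≟ꟳ 0#)) ≡ + b
    roots≡ = ∑-ind≡length-filter (λ x → tr x ≟ꟳ 0#) elems
    #ker≡ : ∑ elems (tr₀ 1#) ≡ + b
    #ker≡ = trans (∑-cong elems (λ x → cong (λ t → ind (tr t ≟ꟳ 0#)) (R.*-identityˡ x))) roots≡
    tight : a ≡ q × b ≡ q ^ n-1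
    tight = product-tight (ℤₚ.drop‿+≤+ (subst (ℤ._≤ + q) #K≡ #K≤q))
      (ℤₚ.drop‿+≤+ (subst (ℤ._≤ + (q ^ n-1)) roots≡ (roots-count (q ^ n-1) tr-monic)))
      (ℕₚ.<-trans (s≤s z≤n) 1<q) (0<q^ n-1)
      (ℤₚ.+-injective (trans (ℤₚ.pos-* a b) (trans (sym (cong₂ ℤ._*_ #K≡ #ker≡)) (sym (q^n≡#K*kernel 1≢0)))))

  #K≡q : #K ≡ + q
  #K≡q = proj₁ #K×#kernel

  #kernel : ∀ {y} → y ≢ 0# → ∑ elems (tr₀ y) ≡ + (q ^ n-1)
  #kernel {y} y≢0 = sym (ℤₚ.*-cancelˡ-≡ (+ q) _ _ (trans (sym (ℤₚ.pos-* q (q ^ n-1)))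
    (trans (q^n≡#K*kernel y≢0) (cong (ℤ._* ∑ elems (tr₀ y)) #K≡q))))

  q-1 : ℕ
  q-1 = q ∸ 1

  ↑q≡ : ∀ x → x ↑ q ≡ x ⊗ x ↑ q-1
  ↑q≡ x = cong (x ↑_) (sym (ℕₚ.suc-pred q))

  inK-unit : ∀ {c} → c ↑ q-1 ≡ 1# → InK c
  inK-unit {c} e = trans (↑q≡ c) (trans (cong (c ⊗_) e) (R.*-identityʳ c))

  unit-inK : ∀ {c} → c ≢ 0# → InK c → c ↑ q-1 ≡ 1#
  unit-inK {c} c≢0 cK = ⊗-cancelˡ c≢0 (trans (sym (↑q≡ c)) (trans cK (sym (R.*-identityʳ c))))

  ind-idem : {P : Set} (d : Dec P) → ind d ℤ.* ind d ≡ ind d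
  ind-idem (yes _) = refl
  ind-idem (no _)  = refl

  -- Equality of the powers says that `y / x` lies in F_q, so the two forms have the same kernel.
  -- Proportionality is expressed by powers because it can then be counted as the roots of a
  -- polynomial.
  #kernels-dependent : ∀ {x y} → x ≢ 0# → y ≢ 0# → x ↑ q-1 ≡ y ↑ q-1 →
    (∑[ z ∈ elems ] tr₀ x z ℤ.* tr₀ y z) ≡ + (q ^ n-1)
  #kernels-dependent {x} {y} x≢0 y≢0 e with inverse x x≢0
  ... | x⁻¹ , xx⁻¹≡1 = trans (∑-cong elems (λ z → trans (cong (ℤ._* tr₀ y z) (same z)) (ind-idem (tr (y ⊗ z) ≟ꟳ 0#)))) (#kernel y≢0)
    where
    c = y ⊗ x⁻¹
    y≡cx : y ≡ c ⊗ x
    y≡cx = sym (trans (R.*-assoc y x⁻¹ x) (trans (cong (y ⊗_) (trans (R.*-comm x⁻¹ x) xx⁻¹≡1)) (R.*-identityʳ y)))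
    c≢0 : c ≢ 0#
    c≢0 = ⊗≢0 y≢0 (invertible⇒≢0 xx⁻¹≡1)
    cK : InK c
    cK = inK-unit (⊗-cancelˡ (↑≢0 x≢0 q-1) (begin
      x ↑ q-1 ⊗ c ↑ q-1   ≡⟨ R.*-comm _ _ ⟩
      c ↑ q-1 ⊗ x ↑ q-1   ≡⟨ sym (⊗-↑ c x q-1) ⟩
      (c ⊗ x) ↑ q-1       ≡⟨ cong (_↑ q-1) (sym y≡cx) ⟩
      y ↑ q-1             ≡⟨ sym e ⟩
      x ↑ q-1             ≡⟨ sym (R.*-identityʳ _) ⟩
      x ↑ q-1 ⊗ 1#        ∎))
      where open ≡-Reasoning
    tr-y : ∀ z → tr (y ⊗ z) ≡ c ⊗ tr (x ⊗ z)
    tr-y z = trans (cong tr (trans (cong (_⊗ z) y≡cx) (R.*-assoc c x z))) (tr-⊗ cK (x ⊗ z))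
    same : ∀ z → tr₀ x z ≡ tr₀ y z
    same z = ind-cong _ _ (λ e → trans (tr-y z) (trans (cong (c ⊗_) e) (R.zeroʳ c)))
      (λ e → ⊗≡0 c≢0 (trans (sym (tr-y z)) e))

  -- Suppose that no `z` has `tr (x ⊗ z)` zero and `tr (y ⊗ z)` nonzero, and take `w` with
  -- `tr (x ⊗ w) ≡ 1#`. Then `z − tr(xz) w` is killed by the first form, hence by the second, so
  -- `tr(yz) = tr(xz) c` with `c = tr(yw)` in F_q. Nondegeneracy of the trace gives `y = c x`, so
  -- that the powers agree.
  separate : ∀ {x y} → x ≢ 0# → y ≢ 0# → x ↑ q-1 ≢ y ↑ q-1 → ∃ λ v → tr (x ⊗ v) ≡ 0# × tr (y ⊗ v) ≡ 1#
  separate {x} {y} x≢0 y≢0 ne with search good? elems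
    where
    good? : Decidable (λ z → tr (x ⊗ z) ≡ 0# × tr (y ⊗ z) ≢ 0#)
    good? z with tr (x ⊗ z) ≟ꟳ 0# | tr (y ⊗ z) ≟ꟳ 0#
    ... | yes a | no b  = yes (a , b)
    ... | no ¬a | _     = no (¬a ∘ proj₁)
    ... | _     | yes b = no (λ ab → proj₂ ab b)
  ... | inj₁ (z , _ , a , t≢0) with inverse (tr (y ⊗ z)) t≢0
  ...   | t⁻¹ , e = t⁻¹ ⊗ z , trans (scale x) (trans (cong (t⁻¹ ⊗_) a) (R.zeroʳ t⁻¹)) , trans (scale y) (trans (R.*-comm t⁻¹ _) e)
    where
    scale : ∀ x → tr (x ⊗ (t⁻¹ ⊗ z)) ≡ t⁻¹ ⊗ tr (x ⊗ z)
    scale x = trans (cong tr (*-semigroup.x∙yz≈y∙xz x t⁻¹ z)) (tr-⊗ (inK-inverse t≢0 e (tr∈K (y ⊗ z))) (x ⊗ z))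
  separate {x} {y} x≢0 y≢0 ne | inj₂ none with tr-onto-1-scaled x≢0
  ... | w , trxw≡1 = contradiction dependent ne
    where
    open ≡-Reasoning
    kernel⊆ : ∀ z → tr (x ⊗ z) ≡ 0# → tr (y ⊗ z) ≡ 0#
    kernel⊆ z a with tr (y ⊗ z) ≟ꟳ 0#
    ... | yes b = b
    ... | no ¬b = contradiction (a , ¬b) (All.lookup none (complete z))
    c = tr (y ⊗ w)
    tr-y : ∀ z → tr (y ⊗ z) ≡ tr (x ⊗ z) ⊗ c
    tr-y z = R+.∙-cancelʳ (⊖ s ⊗ c) _ _ (trans (sym (tr-line y z (⊖ s) w (inK-neg (tr∈K (x ⊗ z)))))
      (trans (kernel⊆ (z ⊕ ⊖ s ⊗ w) in-kernel) (sym (trans (sym (R.distribʳ c s (⊖ s))) (trans (cong (_⊗ c) (R.-‿inverseʳ s)) (R.zeroˡ c))))))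
      where
      s = tr (x ⊗ z)
      in-kernel : tr (x ⊗ (z ⊕ ⊖ s ⊗ w)) ≡ 0#
      in-kernel = trans (tr-line x z (⊖ s) w (inK-neg (tr∈K (x ⊗ z))))
        (trans (cong (s ⊕_) (trans (cong (⊖ s ⊗_) trxw≡1) (R.*-identityʳ (⊖ s)))) (R.-‿inverseʳ s))
    annihilated : ∀ z → tr ((y ⊕ ⊖ (c ⊗ x)) ⊗ z) ≡ 0#
    annihilated z = begin
      tr ((y ⊕ ⊖ (c ⊗ x)) ⊗ z)              ≡⟨ cong tr (R.distribʳ z y (⊖ (c ⊗ x))) ⟩
      tr (y ⊗ z ⊕ ⊖ (c ⊗ x) ⊗ z)            ≡⟨ cong (λ t → tr (y ⊗ z ⊕ t)) (trans (sym (Rₚ.-‿distribˡ-* (c ⊗ x) z)) (cong ⊖_ (R.*-assoc c x z))) ⟩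
      tr (y ⊗ z ⊕ ⊖ (c ⊗ (x ⊗ z)))          ≡⟨ trans (tr-⊕ _ _) (cong (tr (y ⊗ z) ⊕_) (tr-⊖ _)) ⟩
      tr (y ⊗ z) ⊕ ⊖ tr (c ⊗ (x ⊗ z))       ≡⟨ cong₂ (λ a b → a ⊕ ⊖ b) (tr-y z) (trans (tr-⊗ (tr∈K (y ⊗ w)) (x ⊗ z)) (R.*-comm c _)) ⟩
      tr (x ⊗ z) ⊗ c ⊕ ⊖ (tr (x ⊗ z) ⊗ c)   ≡⟨ R.-‿inverseʳ _ ⟩
      0#                                    ∎
    y≡cx : y ≡ c ⊗ x
    y≡cx with (y ⊕ ⊖ (c ⊗ x)) ≟ꟳ 0#
    ... | yes e = R+.∙-cancelʳ (⊖ (c ⊗ x)) _ _ (trans e (sym (R.-‿inverseʳ (c ⊗ x))))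
    ... | no ≢0 with tr-onto-1-scaled ≢0
    ...   | v , tr≡1 = contradiction (trans (sym tr≡1) (annihilated v)) 1≢0
    c≢0 : c ≢ 0#
    c≢0 c≡0 = y≢0 (trans y≡cx (trans (cong (_⊗ x) c≡0) (R.zeroˡ x)))
    dependent : x ↑ q-1 ≡ y ↑ q-1
    dependent = sym (begin
      y ↑ q-1               ≡⟨ cong (_↑ q-1) y≡cx ⟩
      (c ⊗ x) ↑ q-1         ≡⟨ ⊗-↑ c x q-1 ⟩
      c ↑ q-1 ⊗ x ↑ q-1     ≡⟨ cong (_⊗ x ↑ q-1) (unit-inK c≢0 (tr∈K (y ⊗ w))) ⟩
      1# ⊗ x ↑ q-1          ≡⟨ R.*-identityˡ _ ⟩
      x ↑ q-1               ∎)

  -- Translations along the `v` of `separate` keep `tr (x ⊗ z)` and sweep out all values of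
  -- `tr (y ⊗ z)`, so the kernel of the first form is cut into `q` equal parts.
  #kernels-independent : ∀ {x y} → x ≢ 0# → y ≢ 0# → x ↑ q-1 ≢ y ↑ q-1 →
    + (q ^ n-1) ≡ + q ℤ.* (∑[ z ∈ elems ] tr₀ x z ℤ.* tr₀ y z)
  #kernels-independent {x} {y} x≢0 y≢0 ne with separate x≢0 y≢0 ne
  ... | v , trxv≡0 , tryv≡1 = trans (sym (#kernel x≢0))
    (trans (equal-fibres y v (tr₀ x) tryv≡1 (λ {a} aK z → cong (λ t → ind (t ≟ꟳ 0#)) (invariant aK z)))
      (cong (ℤ._* (∑[ z ∈ elems ] tr₀ x z ℤ.* tr₀ y z)) #K≡q))
    where
    invariant : ∀ {a} → InK a → ∀ z → tr (x ⊗ (z ⊕ a ⊗ v)) ≡ tr (x ⊗ z)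
    invariant {a} aK z = trans (tr-line x z a v aK)
      (trans (cong (tr (x ⊗ z) ⊕_) (trans (cong (a ⊗_) trxv≡0) (R.zeroʳ a))) (R.+-identityʳ _))

  tr-0⊗ : ∀ z → tr₀ z 0# ≡ 1ℤ
  tr-0⊗ z = ind-yes (tr (z ⊗ 0#) ≟ꟳ 0#) (trans (cong tr (R.zeroʳ z)) tr-0)

-- Counting free exponents with a trace condition

bounded-cancel : ∀ {r a c} k → 0ℤ ℤ.< k → Bounded r (k ℤ.* a) (k ℤ.* c) → Bounded r a c
bounded-cancel {r} {a} {c} k 0<k (0≤kc , le) =
  ℤₚ.*-cancelˡ-≤-pos 0ℤ c k {{ℤ.positive 0<k}} (subst (ℤ._≤ k ℤ.* c) (sym (ℤₚ.*-zeroʳ k)) 0≤kc) ,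
  ℤₚ.*-cancelˡ-≤-pos (a ℤ.* a) (c ℤ.* c ℤ.* r) (k ℤ.* k) {{ℤ.positive 0<k²}}
    (subst₂ ℤ._≤_ (lhs k a) (rhs k c r) le)
  where
  0<k² : 0ℤ ℤ.< k ℤ.* k
  0<k² = subst (ℤ._< k ℤ.* k) (ℤₚ.*-zeroʳ k) (ℤₚ.*-monoˡ-<-pos k {{ℤ.positive 0<k}} 0<k)
  lhs : ∀ k a → (k ℤ.* a) ℤ.* (k ℤ.* a) ≡ (k ℤ.* k) ℤ.* (a ℤ.* a)
  lhs = solve-∀
  rhs : ∀ k c r → (k ℤ.* c) ℤ.* (k ℤ.* c) ℤ.* r ≡ (k ℤ.* k) ℤ.* (c ℤ.* c ℤ.* r)
  rhs = solve-∀

bounded-mono : ∀ {r a c d} → 0ℤ ℤ.≤ r → c ℤ.≤ d → Bounded r a c → Bounded r a d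
bounded-mono {r} 0≤r c≤d (0≤c , le) = ℤₚ.≤-trans 0≤c c≤d ,
  ℤₚ.≤-trans le (ℤₚ.*-monoʳ-≤-nonNeg r {{ℤ.nonNegative 0≤r}} (square-mono 0≤c c≤d))

2∣or2∣suc : ∀ a → 2 ∣ a ⊎ 2 ∣ suc a
2∣or2∣suc zero    = inj₁ (divides 0 refl)
2∣or2∣suc (suc a) with 2∣or2∣suc a
... | inj₁ 2∣a  = inj₂ (∣m∣n⇒∣m+n (∣-refl {2}) 2∣a)
... | inj₂ 2∣sa = inj₁ 2∣sa

prime∤^ : ∀ {l a} → Prime l → l ∤ a → ∀ k → l ∤ a ^ k
prime∤^         pl l∤a zero    l∣ = prime∤1 pl l∣
prime∤^ {a = a} pl l∤a (suc k) l∣ with euclidsLemma a (a ^ k) pl l∣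
... | inj₁ l∣a  = l∤a l∣a
... | inj₂ l∣aᵏ = prime∤^ pl l∤a k l∣aᵏ

module Count (F : FiniteField) (q n-2 : ℕ) (q-prime-power : IsPrimePower q)
  (size≡ : FiniteField.size F ≡ q ^ suc (suc n-2)) (2∤q : 2 ∤ q) where

  open FieldTheory F
  open Generator F
  open Trace F q (suc n-2) q-prime-power size≡

  g : Carrier
  g = generator

  b : ℕ → ℤ
  b i = ind (tr (g ↑ i) ≟ꟳ 0#)

  -- `A` is `q^(n−1)`, written as a polynomial in `t` and `r` so that the identities among the
  -- counts are left to the ring solver.
  t r A : ℤ
  t = + q-1
  r = + (q ^ n-2)
  A = (1ℤ ℤ.+ t) ℤ.* r

  q≡1+t : + q ≡ 1ℤ ℤ.+ t
  q≡1+t = cong +_ (sym (ℕₚ.suc-pred q))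

  A≡ : + (q ^ suc n-2) ≡ A
  A≡ = trans (ℤₚ.pos-* q (q ^ n-2)) (cong (ℤ._* r) q≡1+t)

  1+N≡ : 1ℤ ℤ.+ + N ≡ (1ℤ ℤ.+ t) ℤ.* A
  1+N≡ = trans (cong +_ (trans (sym size≡1+units) size≡)) (trans (ℤₚ.pos-* q (q ^ suc n-2)) (cong₂ ℤ._*_ q≡1+t A≡))

  N≡ : + N ≡ (1ℤ ℤ.+ t) ℤ.* A ℤ.- 1ℤ
  N≡ = trans (shift-one (+ N)) (cong (ℤ._- 1ℤ) 1+N≡)
    where
    shift-one : ∀ a → a ≡ 1ℤ ℤ.+ a ℤ.- 1ℤ
    shift-one = solve-∀

  0<q-1 : 0 < q-1
  0<q-1 = ℕₚ.m<n⇒0<n∸m 1<q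

  0≤r : 0ℤ ℤ.≤ r
  0≤r = ℤ.+≤+ z≤n

  2∣N : 2 ∣ N
  2∣N with 2∣or2∣suc N
  ... | inj₁ 2∣N  = 2∣N
  ... | inj₂ 2∣sN = contradiction (subst (2 ∣_) (trans (sym size≡1+units) size≡) 2∣sN) (prime∤^ prime[2] 2∤q (suc (suc n-2)))

  half : ℕ
  half = _∣_.quotient 2∣N

  N≡2*half : N ≡ 2 * half
  N≡2*half = trans (_∣_.equality 2∣N) (ℕₚ.*-comm half 2)

  b-periodic : Periodic N b
  b-periodic i = cong (λ x → ind (tr x ≟ꟳ 0#))
    (trans (↑-+ g i N) (trans (cong (g ↑ i ⊗_) (x↑#units≡1 generator≢0)) (R.*-identityʳ _)))

  tr₀-powers : ∀ i k → tr₀ (g ↑ i) (g ↑ k) ≡ b (i + k)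
  tr₀-powers i k = cong (λ x → ind (tr x ≟ꟳ 0#)) (sym (↑-+ g i k))

  g↑≢0 : ∀ i → g ↑ i ≢ 0#
  g↑≢0 = ↑≢0 generator≢0

  ∑b : ∀ i → (∑[ k < N ] b (i + k)) ≡ A ℤ.- 1ℤ
  ∑b i = begin
    (∑[ k < N ] b (i + k))                                            ≡⟨ ∑-cong (downFrom N) (λ k → sym (tr₀-powers i k)) ⟩
    S                                                                 ≡⟨ cancel-one S ⟩
    -- The powers of `g` miss `z = 0`, which lies in every kernel; this accounts for the `− 1`, here
    -- and in `∑bb`.
    1ℤ ℤ.+ S ℤ.- 1ℤ                                                   ≡⟨ cong (λ u → u ℤ.+ S ℤ.- 1ℤ) (sym (tr-0⊗ (g ↑ i))) ⟩
    tr₀ (g ↑ i) 0# ℤ.+ S ℤ.- 1ℤ                                       ≡⟨ cong (ℤ._- 1ℤ) (trans (sym (∑-elems (tr₀ (g ↑ i)))) (trans (#kernel (g↑≢0 i)) A≡)) ⟩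
    A ℤ.- 1ℤ                                                          ∎
    where
    open ≡-Reasoning
    S = ∑[ k < N ] tr₀ (g ↑ i) (g ↑ k)
    cancel-one : ∀ s → s ≡ 1ℤ ℤ.+ s ℤ.- 1ℤ
    cancel-one = solve-∀

  -- Marks the pairs whose squares `g ↑ (2 * i)` and `g ↑ (2 * j)` are proportional over F_q.
  D : ℕ → ℕ → ℤ
  D i j = ind ((g ↑ (2 * i)) ↑ q-1 ≟ꟳ (g ↑ (2 * j)) ↑ q-1)

  ∑kernels : ∀ i j → (∑[ z ∈ elems ] tr₀ (g ↑ (2 * i)) z ℤ.* tr₀ (g ↑ (2 * j)) z) ≡ r ℤ.+ t ℤ.* r ℤ.* D i j
  ∑kernels i j with (g ↑ (2 * i)) ↑ q-1 ≟ꟳ (g ↑ (2 * j)) ↑ q-1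
  ... | yes e = trans (#kernels-dependent (g↑≢0 (2 * i)) (g↑≢0 (2 * j)) e) (trans A≡ (expand t r))
    where
    expand : ∀ t r → (1ℤ ℤ.+ t) ℤ.* r ≡ r ℤ.+ t ℤ.* r ℤ.* 1ℤ
    expand = solve-∀
  ... | no ne = trans (sym (ℤₚ.*-cancelˡ-≡ (+ q) _ _ (trans (sym (ℤₚ.pos-* q (q ^ n-2))) (#kernels-independent (g↑≢0 (2 * i)) (g↑≢0 (2 * j)) ne))))
    (expand t r)
    where
    expand : ∀ t r → r ≡ r ℤ.+ t ℤ.* r ℤ.* 0ℤ
    expand = solve-∀

  ∑bb : ∀ i j → (∑[ k < N ] b (2 * i + k) ℤ.* b (2 * j + k)) ≡ r ℤ.+ t ℤ.* r ℤ.* D i j ℤ.- 1ℤ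
  ∑bb i j = begin
    (∑[ k < N ] b (2 * i + k) ℤ.* b (2 * j + k))
      ≡⟨ ∑-cong (downFrom N) (λ k → sym (cong₂ ℤ._*_ (tr₀-powers (2 * i) k) (tr₀-powers (2 * j) k))) ⟩
    (∑[ k < N ] f (g ↑ k))
      ≡⟨ cancel-one (∑< N (λ k → f (g ↑ k))) ⟩
    1ℤ ℤ.+ (∑[ k < N ] f (g ↑ k)) ℤ.- 1ℤ
      ≡⟨ cong (λ u → u ℤ.+ (∑[ k < N ] f (g ↑ k)) ℤ.- 1ℤ) (sym (cong₂ ℤ._*_ (tr-0⊗ (g ↑ (2 * i))) (tr-0⊗ (g ↑ (2 * j))))) ⟩
    f 0# ℤ.+ (∑[ k < N ] f (g ↑ k)) ℤ.- 1ℤ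
      ≡⟨ cong (ℤ._- 1ℤ) (trans (sym (∑-elems f)) (∑kernels i j)) ⟩
    r ℤ.+ t ℤ.* r ℤ.* D i j ℤ.- 1ℤ ∎
    where
    open ≡-Reasoning
    f : Carrier → ℤ
    f z = tr₀ (g ↑ (2 * i)) z ℤ.* tr₀ (g ↑ (2 * j)) z
    cancel-one : ∀ s → s ≡ 1ℤ ℤ.+ s ℤ.- 1ℤ
    cancel-one = solve-∀

  D-row : ∀ i → ∑< N (D i) ℤ.≤ + 2 ℤ.* t
  D-row i = begin
    ∑< N (D i)                           ≡⟨ ∑-cong (downFrom N) (λ j → ind-cong _ _ (to j) (from j)) ⟩
    (∑[ j < N ] f (g ↑ j))               ≡⟨ sym (ℤₚ.+-identityˡ _) ⟩
    0ℤ ℤ.+ (∑[ j < N ] f (g ↑ j))        ≤⟨ ℤₚ.+-monoˡ-≤ (∑< N (λ j → f (g ↑ j))) (0≤ind (0# ↑ (q-1 * 2) ⊕ ⊖ c ≟ꟳ 0#)) ⟩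
    f 0# ℤ.+ (∑[ j < N ] f (g ↑ j))      ≡⟨ sym (∑-elems f) ⟩
    ∑ elems f                            ≤⟨ roots-count (q-1 * 2) (monic-+ (q-1 * 2) (monic-↑ (q-1 * 2)) (low-const (ℕₚ.*-mono-≤ 0<q-1 (s≤s (z≤n {1}))) (⊖ c))) ⟩
    + (q-1 * 2)                          ≡⟨ trans (ℤₚ.pos-* q-1 2) (ℤₚ.*-comm t (+ 2)) ⟩
    + 2 ℤ.* t                            ∎
    where
    open ℤₚ.≤-Reasoning
    c = (g ↑ (2 * i)) ↑ q-1
    f : Carrier → ℤ
    f x = ind (x ↑ (q-1 * 2) ⊕ ⊖ c ≟ꟳ 0#)
    exponents : ∀ j → (g ↑ (2 * j)) ↑ q-1 ≡ (g ↑ j) ↑ (q-1 * 2)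
    exponents j = trans (cong (_↑ q-1) (↑-* g 2 j)) (sym (↑-* (g ↑ j) q-1 2))
    to : ∀ j → c ≡ (g ↑ (2 * j)) ↑ q-1 → (g ↑ j) ↑ (q-1 * 2) ⊕ ⊖ c ≡ 0#
    to j e = trans (cong (_⊕ ⊖ c) (sym (trans e (exponents j)))) (R.-‿inverseʳ c)
    from : ∀ j → (g ↑ j) ↑ (q-1 * 2) ⊕ ⊖ c ≡ 0# → c ≡ (g ↑ (2 * j)) ↑ q-1
    from j e = trans (R+.∙-cancelʳ (⊖ c) _ _ (trans (R.-‿inverseʳ c) (sym e))) (sym (exponents j))

  -- N times the deviation of b from its mean over all of F.
  β : ℕ → ℤ
  β i = + N ℤ.* b i ℤ.- A

  β-periodic : Periodic N β
  β-periodic i = cong (λ u → + N ℤ.* u ℤ.- A) (b-periodic i)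

  -- `−ρ` is the correlation of `β` along independent forms, and `κ` is what dependence adds to it:
  -- `N²` times the gap `A − r = t r` between the two kernel counts.
  κ ρ : ℤ
  κ = + N ℤ.* + N ℤ.* (t ℤ.* r)
  ρ = + N ℤ.* (t ℤ.* t ℤ.* r ℤ.- 1ℤ)

  0≤ρ : 0ℤ ℤ.≤ ρ
  0≤ρ = 0≤i*j (ℤ.+≤+ (z≤n {N})) (ℤₚ.i≤j⇒0≤j-i (subst (1ℤ ℤ.≤_) (trans (ℤₚ.pos-* (q-1 * q-1) (q ^ n-2)) (cong (ℤ._* r) (ℤₚ.pos-* q-1 q-1)))
    (ℤ.+≤+ (ℕₚ.*-mono-≤ (ℕₚ.*-mono-≤ 0<q-1 0<q-1) (0<q^ n-2)))))

  ∑ββ : ∀ i j → (∑[ k < N ] β (2 * i + k) ℤ.* β (2 * j + k)) ≡ κ ℤ.* D i j ℤ.- ρ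
  ∑ββ i j = begin
    (∑[ k < N ] β (2 * i + k) ℤ.* β (2 * j + k))
      ≡⟨ ∑-cong (downFrom N) (λ k → expand (+ N) A (b (2 * i + k)) (b (2 * j + k))) ⟩
    (∑[ k < N ] (N² ℤ.* bb k ℤ.- NA ℤ.* (b (2 * i + k) ℤ.+ b (2 * j + k))) ℤ.+ A ℤ.* A)
      ≡⟨ trans (∑-+ (downFrom N) _ _) (cong₂ ℤ._+_ (trans (∑-- (downFrom N) _ _) (cong₂ ℤ._-_
           (trans (∑-*ˡ (downFrom N) N² bb) (cong (N² ℤ.*_) (∑bb i j)))
           (trans (∑-*ˡ (downFrom N) NA _) (cong (NA ℤ.*_) (trans (∑-+ (downFrom N) _ _) (cong₂ ℤ._+_ (∑b (2 * i)) (∑b (2 * j))))))))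
         (trans (∑-const (downFrom N) (A ℤ.* A)) (cong (λ k → + k ℤ.* (A ℤ.* A)) (length-downFrom N)))) ⟩
    (N² ℤ.* (r ℤ.+ t ℤ.* r ℤ.* D i j ℤ.- 1ℤ) ℤ.- NA ℤ.* ((A ℤ.- 1ℤ) ℤ.+ (A ℤ.- 1ℤ))) ℤ.+ + N ℤ.* (A ℤ.* A)
      ≡⟨ factor (+ N) t r (D i j) ⟩
    κ ℤ.* D i j ℤ.- + N ℤ.* ((+ 2 ℤ.* A ℤ.* (A ℤ.- 1ℤ) ℤ.- A ℤ.* A) ℤ.- + N ℤ.* (r ℤ.- 1ℤ))
      ≡⟨ cong (λ u → κ ℤ.* D i j ℤ.- + N ℤ.* ((+ 2 ℤ.* A ℤ.* (A ℤ.- 1ℤ) ℤ.- A ℤ.* A) ℤ.- u ℤ.* (r ℤ.- 1ℤ))) N≡ ⟩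
    κ ℤ.* D i j ℤ.- + N ℤ.* ((+ 2 ℤ.* A ℤ.* (A ℤ.- 1ℤ) ℤ.- A ℤ.* A) ℤ.- ((1ℤ ℤ.+ t) ℤ.* A ℤ.- 1ℤ) ℤ.* (r ℤ.- 1ℤ))
      -- Since `(1 + t) A r = A²`, the quadratic terms cancel and `(t − 1) A + r − 1` remains, which
      -- is `t² r − 1`.
      ≡⟨ cong (λ u → κ ℤ.* D i j ℤ.- + N ℤ.* u) (evaluate t r) ⟩
    κ ℤ.* D i j ℤ.- ρ ∎
    where
    open ≡-Reasoning
    N² NA : ℤ
    N² = + N ℤ.* + N
    NA = + N ℤ.* A
    bb : ℕ → ℤ
    bb k = b (2 * i + k) ℤ.* b (2 * j + k)
    expand : ∀ N A x y → (N ℤ.* x ℤ.- A) ℤ.* (N ℤ.* y ℤ.- A) ≡ (N ℤ.* N ℤ.* (x ℤ.* y) ℤ.- N ℤ.* A ℤ.* (x ℤ.+ y)) ℤ.+ A ℤ.* A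
    expand = solve-∀
    factor : ∀ N t r d → let A = (1ℤ ℤ.+ t) ℤ.* r in
      (N ℤ.* N ℤ.* (r ℤ.+ t ℤ.* r ℤ.* d ℤ.- 1ℤ) ℤ.- N ℤ.* A ℤ.* ((A ℤ.- 1ℤ) ℤ.+ (A ℤ.- 1ℤ))) ℤ.+ N ℤ.* (A ℤ.* A) ≡
      N ℤ.* N ℤ.* (t ℤ.* r) ℤ.* d ℤ.- N ℤ.* ((+ 2 ℤ.* A ℤ.* (A ℤ.- 1ℤ) ℤ.- A ℤ.* A) ℤ.- N ℤ.* (r ℤ.- 1ℤ))
    factor = solve-∀
    evaluate : ∀ t r → let A = (1ℤ ℤ.+ t) ℤ.* r in
      (+ 2 ℤ.* A ℤ.* (A ℤ.- 1ℤ) ℤ.- A ℤ.* A) ℤ.- ((1ℤ ℤ.+ t) ℤ.* A ℤ.- 1ℤ) ℤ.* (r ℤ.- 1ℤ) ≡ t ℤ.* t ℤ.* r ℤ.- 1ℤ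
    evaluate = solve-∀

  H-bound : ∀ L → Valid N L → Bounded r (∑[ i < N ] H L i ℤ.* β (2 * i)) (Φ L ℤ.* (+ N ℤ.* (+ 2 ℤ.* t)))
  H-bound L v = 0≤i*j (0≤Φ L (proj₁ v)) (0≤i*j (ℤ.+≤+ (z≤n {N})) (0≤i*j (ℤ.+≤+ (z≤n {2})) (ℤ.+≤+ (z≤n {q-1})))) ,
    subst (X ℤ.* X ℤ.≤_) (regroup (+ N) t r (Φ L)) sieve
    where
    X = ∑[ i < N ] H L i ℤ.* β (2 * i)
    -- `N` is the length of a list and does not compute to `2 * M`. The ranges of summation and the
    -- periods are therefore abstracted and transported together along `N≡2*half`, whereas the `N`
    -- inside `β`, `κ` and `ρ` stays as it is.
    P : ℕ → Set
    P K = Periodic K β → (∀ i → ∑< K (D i) ℤ.≤ + 2 ℤ.* t) →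
      (∀ i j → (∑[ k < K ] β (2 * i + k) ℤ.* β (2 * j + k)) ≡ κ ℤ.* D i j ℤ.- ρ) → Valid K L →
      (∑[ i < K ] H L i ℤ.* β (2 * i)) ℤ.* (∑[ i < K ] H L i ℤ.* β (2 * i)) ℤ.≤ + 2 ℤ.* (κ ℤ.* (+ 2 ℤ.* t)) ℤ.* (Φ L ℤ.* Φ L)
    at-2half : P (2 * half)
    at-2half per row Γ v′ = large-sieve half (ℕ.pred N) β
      (trans (ℕₚ.suc-pred N {{ℕ.≢-nonZero N≢0}}) N≡2*half) per D κ ρ (+ 2 ℤ.* t)
      (0≤i*j (0≤i² (+ N)) (0≤i*j (ℤ.+≤+ (z≤n {q-1})) 0≤r)) 0≤ρ (λ i j → 0≤ind _) (λ i j → ind-cong _ _ sym sym) row Γ L v′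
    sieve : X ℤ.* X ℤ.≤ + 2 ℤ.* (κ ℤ.* (+ 2 ℤ.* t)) ℤ.* (Φ L ℤ.* Φ L)
    sieve = subst P (sym N≡2*half) at-2half β-periodic D-row ∑ββ v
    regroup : ∀ N t r p → + 2 ℤ.* (N ℤ.* N ℤ.* (t ℤ.* r) ℤ.* (+ 2 ℤ.* t)) ℤ.* (p ℤ.* p) ≡
      (p ℤ.* (N ℤ.* (+ 2 ℤ.* t))) ℤ.* (p ℤ.* (N ℤ.* (+ 2 ℤ.* t))) ℤ.* r
    regroup = solve-∀

  0<+N : 0ℤ ℤ.< + N
  0<+N = ℤ.+<+ (ℕₚ.n≢0⇒n>0 N≢0)

  count : ℕ → ℤ
  count m = ∑[ i < N ] ind (gcd i m ℕ.≟ 1) ℤ.* b (2 * i)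

  -- The sieve is run over all primes of `m`, starting from the empty modulus. The constant part `A`
  -- of `β` is summed exactly by `∑-free` and becomes the main term, after which the scale `N`
  -- cancels from both sides.
  product-bound : ∀ m → m ≢ 0 → m ∣ N → let L = primes m in
    Bounded r (+ product L ℤ.* count m ℤ.- A ℤ.* Φ L) (+ (2 ^ length L) ℤ.* (Φ L ℤ.* (+ 2 ℤ.* t)))
  product-bound m m≢0 m∣N = bounded-cancel (+ N) 0<+N (subst₂ (Bounded r) lhs (rhs (+ N) (+ (2 ^ length L)) (Φ L) t)
    (sieve-bound N (λ i → β (2 * i)) r (+ N ℤ.* (+ 2 ℤ.* t)) 0≤r H-bound L []
      (subst (Valid N) (sym (++-identityʳ L)) (primes-valid m∣N))))
    where
    open ≡-Reasoning
    L = primes m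
    R = + product L
    rhs : ∀ N w p t → w ℤ.* (p ℤ.* (1ℤ ℤ.* (N ℤ.* (+ 2 ℤ.* t)))) ≡ N ℤ.* (w ℤ.* (p ℤ.* (+ 2 ℤ.* t)))
    rhs = solve-∀
    pointwise : ∀ f N b A → f ℤ.* (1ℤ ℤ.* (N ℤ.* b ℤ.- A)) ≡ N ℤ.* (f ℤ.* b) ℤ.- A ℤ.* f
    pointwise = solve-∀
    regroup : ∀ R N c A f → R ℤ.* (N ℤ.* c ℤ.- A ℤ.* f) ≡ N ℤ.* (R ℤ.* c) ℤ.- A ℤ.* (R ℤ.* f)
    regroup = solve-∀
    factor : ∀ R N c A p → N ℤ.* (R ℤ.* c) ℤ.- A ℤ.* (p ℤ.* N) ≡ N ℤ.* (R ℤ.* c ℤ.- A ℤ.* p)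
    factor = solve-∀
    count≡ : (∑[ i < N ] free L i ℤ.* b (2 * i)) ≡ count m
    count≡ = ∑-cong (downFrom N) (λ i → cong (ℤ._* b (2 * i)) (free-primes m m≢0 i))
    lhs : R ℤ.* (∑[ i < N ] free L i ℤ.* (1ℤ ℤ.* β (2 * i))) ≡ + N ℤ.* (R ℤ.* count m ℤ.- A ℤ.* Φ L)
    lhs = begin
      R ℤ.* (∑[ i < N ] free L i ℤ.* (1ℤ ℤ.* β (2 * i)))
        ≡⟨ cong (R ℤ.*_) (trans (∑-cong (downFrom N) (λ i → pointwise (free L i) (+ N) (b (2 * i)) A))
             (trans (∑-- (downFrom N) _ _) (cong₂ ℤ._-_ (trans (∑-*ˡ (downFrom N) (+ N) _) (cong (+ N ℤ.*_) count≡)) (∑-*ˡ (downFrom N) A (free L))))) ⟩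
      R ℤ.* (+ N ℤ.* count m ℤ.- A ℤ.* ∑< N (free L))
        ≡⟨ regroup R (+ N) (count m) A (∑< N (free L)) ⟩
      + N ℤ.* (R ℤ.* count m) ℤ.- A ℤ.* (R ℤ.* ∑< N (free L))
        ≡⟨ cong (λ u → + N ℤ.* (R ℤ.* count m) ℤ.- A ℤ.* u) (∑-free L (primes-valid m∣N)) ⟩
      + N ℤ.* (R ℤ.* count m) ℤ.- A ℤ.* (Φ L ℤ.* + N)
        ≡⟨ factor R (+ N) (count m) A (Φ L) ⟩
      + N ℤ.* (R ℤ.* count m ℤ.- A ℤ.* Φ L) ∎

  -- Passes from the radical of `m` to `m`: after multiplication by `m`, `φ-product` turns `Φ L · m`
  -- into `product L · φ m` on both sides, and `product L` cancels.
  count-bound : ∀ m → m ≢ 0 → m ∣ N →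
    Bounded r (+ m ℤ.* count m ℤ.- A ℤ.* + φ m) (+ φ m ℤ.* + (2 * W m * q-1))
  count-bound m m≢0 m∣N = bounded-mono 0≤r c≤ (bounded-cancel R 0<R
    (subst₂ (Bounded r) lhs rhs (bounded-* (+ m) (ℤ.+≤+ z≤n) (product-bound m m≢0 m∣N))))
    where
    open ≡-Reasoning
    L = primes m
    R = + product L
    ω = + (2 ^ length L)
    0<R : 0ℤ ℤ.< R
    0<R = ℤ.+<+ (productOfPrimes≥1 (primes-prime m))
    expand : ∀ m R c A p → m ℤ.* (R ℤ.* c ℤ.- A ℤ.* p) ≡ m ℤ.* (R ℤ.* c) ℤ.- A ℤ.* (p ℤ.* m)
    expand = solve-∀
    collect : ∀ m R c A f → m ℤ.* (R ℤ.* c) ℤ.- A ℤ.* (R ℤ.* f) ≡ R ℤ.* (m ℤ.* c ℤ.- A ℤ.* f)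
    collect = solve-∀
    lhs : + m ℤ.* (R ℤ.* count m ℤ.- A ℤ.* Φ L) ≡ R ℤ.* (+ m ℤ.* count m ℤ.- A ℤ.* + φ m)
    lhs = trans (expand (+ m) R (count m) A (Φ L))
      (trans (cong (λ u → + m ℤ.* (R ℤ.* count m) ℤ.- A ℤ.* u) (sym (φ-product m m≢0))) (collect (+ m) R (count m) A (+ φ m)))
    expand′ : ∀ m w p t → m ℤ.* (w ℤ.* (p ℤ.* (+ 2 ℤ.* t))) ≡ p ℤ.* m ℤ.* (w ℤ.* (+ 2 ℤ.* t))
    expand′ = solve-∀
    rhs : + m ℤ.* (ω ℤ.* (Φ L ℤ.* (+ 2 ℤ.* t))) ≡ R ℤ.* (+ φ m ℤ.* (ω ℤ.* (+ 2 ℤ.* t)))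
    rhs = trans (expand′ (+ m) ω (Φ L) t) (trans (cong (ℤ._* (ω ℤ.* (+ 2 ℤ.* t))) (sym (φ-product m m≢0))) (ℤₚ.*-assoc R (+ φ m) _))
    c≤ : + φ m ℤ.* (ω ℤ.* (+ 2 ℤ.* t)) ℤ.≤ + φ m ℤ.* + (2 * W m * q-1)
    c≤ = ℤₚ.*-monoˡ-≤-nonNeg (+ φ m) (subst (ℤ._≤ + (2 * W m * q-1)) ω≡
      (ℤ.+≤+ (ℕₚ.*-monoˡ-≤ q-1 (ℕₚ.*-monoʳ-≤ 2 (2^ω≤W m m≢0)))))
      where
      swap : ∀ w t → + 2 ℤ.* w ℤ.* t ≡ w ℤ.* (+ 2 ℤ.* t)
      swap = solve-∀
      ω≡ : + (2 * 2 ^ length L * q-1) ≡ ω ℤ.* (+ 2 ℤ.* t)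
      ω≡ = trans (ℤₚ.pos-* (2 * 2 ^ length L) q-1) (trans (cong (ℤ._* t) (ℤₚ.pos-* 2 (2 ^ length L))) (swap ω t))

-- Passage to the rational statement

ι : ℤ → ℚ
ι i = i ℚ./ 1

toℚᵘ-ι : ∀ i → ℚ.toℚᵘ (ι i) ℚᵘ.≃ mkℚᵘ i 0
toℚᵘ-ι i = ℚₚ.toℚᵘ-fromℚᵘ (mkℚᵘ i 0)

ι-* : ∀ i j → ι (i ℤ.* j) ≡ ι i *ℚ ι j
ι-* i j = ℚₚ.toℚᵘ-injective (ℚᵘₚ.≃-trans (toℚᵘ-ι (i ℤ.* j)) (ℚᵘₚ.≃-sym
  (ℚᵘₚ.≃-trans (ℚₚ.toℚᵘ-homo-* (ι i) (ι j)) (ℚᵘₚ.*-cong (toℚᵘ-ι i) (toℚᵘ-ι j)))))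

ι-- : ∀ i j → ι (i ℤ.- j) ≡ ι i ℚ.- ι j
ι-- i j = ℚₚ.toℚᵘ-injective (ℚᵘₚ.≃-trans (toℚᵘ-ι (i ℤ.- j)) (ℚᵘₚ.≃-sym
  (ℚᵘₚ.≃-trans (ℚₚ.toℚᵘ-homo-+ (ι i) (ℚ.- ι j))
  (ℚᵘₚ.≃-trans (ℚᵘₚ.+-cong (toℚᵘ-ι i) (ℚᵘₚ.≃-trans (ℚₚ.toℚᵘ-homo‿- (ι j)) (ℚᵘₚ.-‿cong (toℚᵘ-ι j))))
    (*≡* (lemma i j))))))
  where
  lemma : ∀ i j → (i ℤ.* 1ℤ ℤ.+ ℤ.- j ℤ.* 1ℤ) ℤ.* 1ℤ ≡ (i ℤ.- j) ℤ.* 1ℤ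
  lemma = solve-∀

ι-mono-≤ : ∀ {i j} → i ℤ.≤ j → ι i ℚ.≤ ι j
ι-mono-≤ {i} {j} i≤j = ℚₚ.toℚᵘ-cancel-≤ (ℚᵘₚ.≤-respˡ-≃ (ℚᵘₚ.≃-sym (toℚᵘ-ι i)) (ℚᵘₚ.≤-respʳ-≃ (ℚᵘₚ.≃-sym (toℚᵘ-ι j))
  (*≤* (subst₂ ℤ._≤_ (sym (ℤₚ.*-identityʳ i)) (sym (ℤₚ.*-identityʳ j)) i≤j))))

θ*m≡φ : ∀ m → m ≢ 0 → θ m *ℚ ι (+ m) ≡ ι (+ φ m)
θ*m≡φ zero      m≢0 = contradiction refl m≢0
θ*m≡φ m@(suc m-1) _ = ℚₚ.toℚᵘ-injective (ℚᵘₚ.≃-trans (ℚₚ.toℚᵘ-homo-* (θ m) (ι (+ m)))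
  (ℚᵘₚ.≃-trans (ℚᵘₚ.*-cong (ℚₚ.toℚᵘ-fromℚᵘ (mkℚᵘ (+ φ m) m-1)) (toℚᵘ-ι (+ m)))
  (ℚᵘₚ.≃-trans (*≡* cross) (ℚᵘₚ.≃-sym (toℚᵘ-ι (+ φ m))))))
  where
  cross : (+ φ m ℤ.* + m) ℤ.* 1ℤ ≡ + φ m ℤ.* + (m * 1)
  cross = trans (ℤₚ.*-identityʳ _) (cong (λ k → + φ m ℤ.* + k) (sym (ℕₚ.*-identityʳ m)))

-- The bound at hand is two-sided, so the squared alternative holds whatever the sign of the
-- difference. It is `m²` times the inequality sought, because `θ m` times `m` is `φ m`.
bounded⇒GeMinusSqrt : ∀ {r x A c} m → m ≢ 0 → Bounded r (+ m ℤ.* x ℤ.- A ℤ.* + φ m) (+ φ m ℤ.* c) →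
  GeMinusSqrt (ι x) (θ m *ℚ ι A) (θ m *ℚ ι c) (ι r)
bounded⇒GeMinusSqrt {r} {x} {A} {c} zero      m≢0 bounded    = contradiction refl m≢0
bounded⇒GeMinusSqrt {r} {x} {A} {c} m@(suc _) m≢0 (_ , le) = inj₂ (ℚₚ.*-cancelˡ-≤-pos (μ *ℚ μ) {{0<μ²}}
  (subst₂ ℚ._≤_ (trans (ι-square (+ m) x A (+ φ m)) (trans (cong (λ f → (f *ℚ ι A ℚ.- μ *ℚ ι x) *ℚ (f *ℚ ι A ℚ.- μ *ℚ ι x)) (sym (θ*m≡φ m m≢0))) (lhs (θ m) μ (ι A) (ι x))))
    (trans (trans (ι-* (fc ℤ.* fc) r) (cong (_*ℚ ι r) (trans (ι-* fc fc) (cong₂ _*ℚ_ ι-fc ι-fc)))) (rhs (θ m) μ (ι c) (ι r)))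
    (ι-mono-≤ le)))
  where
  open Data.Rational.Solver.+-*-Solver
  μ = ι (+ m)
  fc = + φ m ℤ.* c
  0<μ² : ℚ.Positive (μ *ℚ μ)
  0<μ² = ℚₚ.pos*pos⇒pos μ {{ℚₚ.normalize-pos m 1}} μ {{ℚₚ.normalize-pos m 1}}
  ι-fc : ι fc ≡ (θ m *ℚ μ) *ℚ ι c
  ι-fc = trans (ι-* (+ φ m) c) (cong (_*ℚ ι c) (sym (θ*m≡φ m m≢0)))
  ι-square : ∀ m x A f → ι ((m ℤ.* x ℤ.- A ℤ.* f) ℤ.* (m ℤ.* x ℤ.- A ℤ.* f)) ≡ (ι f *ℚ ι A ℚ.- ι m *ℚ ι x) *ℚ (ι f *ℚ ι A ℚ.- ι m *ℚ ι x)
  ι-square m x A f = trans (cong ι (flip m x A f)) (trans (ι-* d d) (cong₂ _*ℚ_ ι-d ι-d))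
    where
    d = f ℤ.* A ℤ.- m ℤ.* x
    flip : ∀ m x A f → (m ℤ.* x ℤ.- A ℤ.* f) ℤ.* (m ℤ.* x ℤ.- A ℤ.* f) ≡ (f ℤ.* A ℤ.- m ℤ.* x) ℤ.* (f ℤ.* A ℤ.- m ℤ.* x)
    flip = solve-∀
    ι-d : ι d ≡ ι f *ℚ ι A ℚ.- ι m *ℚ ι x
    ι-d = trans (ι-- (f ℤ.* A) (m ℤ.* x)) (cong₂ ℚ._-_ (ι-* f A) (ι-* m x))
  lhs : ∀ θ μ A x → ((θ *ℚ μ) *ℚ A ℚ.- μ *ℚ x) *ℚ ((θ *ℚ μ) *ℚ A ℚ.- μ *ℚ x) ≡ (μ *ℚ μ) *ℚ ((θ *ℚ A ℚ.- x) *ℚ (θ *ℚ A ℚ.- x))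
  lhs = solve 4 (λ θ μ A x → ((θ :* μ) :* A :- μ :* x) :* ((θ :* μ) :* A :- μ :* x) := (μ :* μ) :* ((θ :* A :- x) :* (θ :* A :- x))) refl
  rhs : ∀ θ μ c r → (((θ *ℚ μ) *ℚ c) *ℚ ((θ *ℚ μ) *ℚ c)) *ℚ r ≡ (μ *ℚ μ) *ℚ (((θ *ℚ c) *ℚ (θ *ℚ c)) *ℚ r)
  rhs = solve 4 (λ θ μ c r → (((θ :* μ) :* c) :* ((θ :* μ) :* c)) :* r := (μ :* μ) :* (((θ :* c) :* (θ :* c)) :* r)) refl

-- From exponents back to field elements

ind-× : {P Q R : Set} (d : Dec P) (e : Dec Q) (f : Dec R) → (P → Q × R) → (Q → R → P) → ind d ≡ ind e ℤ.* ind f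
ind-× d (yes q) (yes r) to from = ind-yes d (from q r)
ind-× d (yes q) (no ¬r) to from = ind-no d (¬r ∘ proj₂ ∘ to)
ind-× d (no ¬q) f       to from = ind-no d (¬q ∘ proj₁ ∘ to)

∈⇒0<length : {A : Set} {x : A} {xs : List A} → x ∈ xs → 0 < length xs
∈⇒0<length {xs = _ ∷ _} _ = s≤s z≤n

geometric : ∀ a k → ∃ λ c → suc a ^ k ≡ suc (c * a)
geometric a zero    = 0 , refl
geometric a (suc k) with geometric a k
... | c , e = suc (c + a * c) , trans (cong (suc a *_) e) (lemma a c)
  where
  lemma : ∀ a c → suc a * suc (c * a) ≡ suc (suc (c + a * c) * a)
  lemma = +-*-Solver.solve 2 (λ a c → (con 1 :+ a) :* (con 1 :+ c :* a) := con 1 :+ (con 1 :+ (c :+ a :* c)) :* a) refl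
    where open +-*-Solver

divℕ-*≡ : ∀ {q} → 1 < q → ∀ n → divℕ (q ^ n ∸ 1) (q ∸ 1) * (q ∸ 1) ≡ q ^ n ∸ 1
divℕ-*≡ {suc (suc a)} (s≤s (s≤s _)) n with geometric (suc a) n
... | c , e = m/n*n≡m (divides c (cong (_∸ 1) e))

φ≢0 : ∀ m → m ≢ 0 → 0 < φ m
φ≢0 m m≢0 = ∈⇒0<length (∈-filter⁺ (λ k → gcd (suc k) m ℕ.≟ 1) (∈-upTo⁺ (ℕₚ.n≢0⇒n>0 m≢0)) (gcd-zeroˡ m))

module FreeElements (F : FiniteField) (q n-2 : ℕ) (q-prime-power : IsPrimePower q)
  (size≡ : FiniteField.size F ≡ q ^ suc (suc n-2)) (2∤q : 2 ∤ q) where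

  open FieldTheory F
  open Generator F
  open Trace F q (suc n-2) q-prime-power size≡
  open Count F q n-2 q-prime-power size≡ 2∤q

  N≡q^n∸1 : N ≡ q ^ n ∸ 1
  N≡q^n∸1 = cong (_∸ 1) (trans (sym size≡1+units) size≡)

  Q : ℕ
  Q = divℕ (q ^ n ∸ 1) q-1

  Q*[q-1]≡N : Q * q-1 ≡ N
  Q*[q-1]≡N = trans (divℕ-*≡ 1<q n) (sym N≡q^n∸1)

  Q∣N : Q ∣ N
  Q∣N = divides q-1 (trans (sym Q*[q-1]≡N) (ℕₚ.*-comm Q q-1))

  ∣N⇒≢0 : ∀ {m} → m ∣ N → m ≢ 0
  ∣N⇒≢0 (divides c N≡) refl = N≢0 (trans N≡ (ℕₚ.*-zeroʳ c))

  square-power : ∀ i → g ↑ i ⊗ g ↑ i ≡ g ↑ (2 * i)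
  square-power i = trans (sym (↑-+ g i i)) (cong (λ k → g ↑ (i + k)) (sym (ℕₚ.+-identityʳ i)))

  𝒩≡count : ∀ m → m ∣ N → (dec : Decidable (Counted q n m 0#)) → + FiniteField.𝒩 F q n m 0# dec ≡ count m
  𝒩≡count m m∣N dec = begin
    + length (filter dec elems)                              ≡⟨ sym (∑-ind≡length-filter dec elems) ⟩
    (∑[ x ∈ elems ] ind (dec x))                             ≡⟨ ∑-elems (λ x → ind (dec x)) ⟩
    ind (dec 0#) ℤ.+ (∑[ i < N ] ind (dec (g ↑ i)))          ≡⟨ cong₂ ℤ._+_ (ind-no (dec 0#) (λ counted → proj₁ counted refl))
                                                               (∑-cong (downFrom N) (λ i → ind-× (dec (g ↑ i)) (gcd i m ℕ.≟ 1) _ (to i) (from i))) ⟩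
    0ℤ ℤ.+ count m                                           ≡⟨ ℤₚ.+-identityˡ (count m) ⟩
    count m                                                  ∎
    where
    open ≡-Reasoning
    to : ∀ i → Counted q n m 0# (g ↑ i) → gcd i m ≡ 1 × tr (g ↑ (2 * i)) ≡ 0#
    to i (_ , free , e) = proj₁ (free⇔coprime m m∣N i) free , trans (cong tr (sym (square-power i))) e
    from : ∀ i → gcd i m ≡ 1 → tr (g ↑ (2 * i)) ≡ 0# → Counted q n m 0# (g ↑ i)
    from i gcd≡1 e = g↑≢0 i , proj₂ (free⇔coprime m m∣N i) gcd≡1 , trans (cong tr (square-power i)) e

  lower-bound : ∀ m → m ∣ Q → (dec : Decidable (Counted q n m 0#)) →
    GeMinusSqrt (toℚ (FiniteField.𝒩 F q n m 0# dec)) (θ m *ℚ toℚ (q ^ suc n-2)) (θ m *ℚ toℚ (2 * W m * q-1)) (toℚ (q ^ n-2))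
  lower-bound m m∣Q dec = subst₂ (λ x a → GeMinusSqrt (ι x) (θ m *ℚ ι a) (θ m *ℚ toℚ (2 * W m * q-1)) (ι r))
    (sym (𝒩≡count m m∣N dec)) (sym A≡) (bounded⇒GeMinusSqrt {A = A} m (∣N⇒≢0 m∣N) (count-bound m (∣N⇒≢0 m∣N) m∣N))
    where
    m∣N : m ∣ N
    m∣N = ∣-trans m∣Q Q∣N

  good? : Decidable (λ i → gcd i Q ≡ 1 × tr (g ↑ (2 * i)) ≡ 0#)
  good? i with gcd i Q ℕ.≟ 1 | tr (g ↑ (2 * i)) ≟ꟳ 0#
  ... | yes a | yes b = yes (a , b)
  ... | no ¬a | _     = no (¬a ∘ proj₁)
  ... | _     | no ¬b = no (¬b ∘ proj₂)

  -- If no exponent qualified, `count Q` would vanish and `count-bound` would reduce, after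
  -- cancelling `φ Q`, to `A² ≤ w² r`. As `A² = q^n · r`, this contradicts `w² < q^n`.
  Q-free-exponent : (2 * W Q * q-1) ^ 2 < q ^ n → ∃ λ i → gcd i Q ≡ 1 × tr (g ↑ (2 * i)) ≡ 0#
  Q-free-exponent large with search good? (downFrom N)
  ... | inj₁ (i , _ , good) = i , good
  ... | inj₂ none = contradiction c²r<A² (ℤₚ.≤⇒≯ A²≤)
    where
    w : ℕ
    w = 2 * W Q * q-1
    count≡0 : count Q ≡ 0ℤ
    count≡0 = trans (∑-cong-∈ (downFrom N) (λ i i∈ → trans (sym (ind-× (good? i) (gcd i Q ℕ.≟ 1) (tr (g ↑ (2 * i)) ≟ꟳ 0#) id (λ a b → (a , b)))) (ind-no (good? i) (All.lookup none i∈))))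
      (trans (∑-const (downFrom N) 0ℤ) (ℤₚ.*-zeroʳ (+ length (downFrom N))))
    bounded : Bounded r (ℤ.- A) (+ w)
    bounded = bounded-cancel (+ φ Q) (ℤ.+<+ (φ≢0 Q (∣N⇒≢0 Q∣N)))
      (subst (λ x → Bounded r x (+ φ Q ℤ.* + w)) (trans (cong (λ c → + Q ℤ.* c ℤ.- A ℤ.* + φ Q) count≡0) (simplify (+ Q) A (+ φ Q)))
        (count-bound Q (∣N⇒≢0 Q∣N) Q∣N))
      where
      simplify : ∀ m A f → m ℤ.* 0ℤ ℤ.- A ℤ.* f ≡ f ℤ.* (ℤ.- A)
      simplify = solve-∀
    A²≤ : (ℤ.- A) ℤ.* (ℤ.- A) ℤ.≤ + w ℤ.* + w ℤ.* r
    A²≤ = Bounded.a²≤c²r bounded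
    q^n≡ : + (q ^ n) ℤ.* r ≡ (ℤ.- A) ℤ.* (ℤ.- A)
    q^n≡ = trans (cong (ℤ._* r) (trans (ℤₚ.pos-* q (q ^ suc n-2)) (cong₂ ℤ._*_ q≡1+t A≡))) (square t r)
      where
      square : ∀ t r → (1ℤ ℤ.+ t) ℤ.* ((1ℤ ℤ.+ t) ℤ.* r) ℤ.* r ≡ (ℤ.- ((1ℤ ℤ.+ t) ℤ.* r)) ℤ.* (ℤ.- ((1ℤ ℤ.+ t) ℤ.* r))
      square = solve-∀
    w²≡ : + (w ^ 2) ≡ + w ℤ.* + w
    w²≡ = trans (cong (λ k → + (w * k)) (ℕₚ.*-identityʳ w)) (ℤₚ.pos-* w w)
    c²r<A² : + w ℤ.* + w ℤ.* r ℤ.< (ℤ.- A) ℤ.* (ℤ.- A)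
    c²r<A² = subst₂ ℤ._<_ (cong (ℤ._* r) w²≡) q^n≡ (ℤₚ.*-monoʳ-<-pos r {{ℤ.positive (ℤ.+<+ (0<q^ n-2))}} (ℤ.+<+ large))

  primitive-exists : (2 * W Q * q-1) ^ 2 < q ^ n → (dec : Decidable (Counted q n (q ^ n ∸ 1) 0#)) →
    0 < FiniteField.𝒩 F q n (q ^ n ∸ 1) 0# dec
  primitive-exists large dec with Q-free-exponent large
  ... | i , gcd≡1 , tr≡0 with coprime-lift i Q N Q∣N N≢0 gcd≡1
  ...   | s , gcd≡1′ = ∈⇒0<length (∈-filter⁺ dec (complete (g ↑ e))
    (g↑≢0 e , proj₂ (free⇔coprime (q ^ n ∸ 1) (subst (_∣ N) N≡q^n∸1 ∣-refl) e) (subst (λ k → gcd e k ≡ 1) N≡q^n∸1 gcd≡1′) , tr[ξ²]≡0))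
    where
    open ≡-Reasoning
    e : ℕ
    e = i + Q * s
    c : Carrier
    -- The square of the correcting factor `g ↑ (Q * s)`. It lies in F_q because `Q (q − 1) = N`, so
    -- it comes out of the trace of the square and a zero trace stays zero.
    c = g ↑ (2 * s * Q)
    cK : InK c
    cK = inK-unit (begin
      c ↑ q-1                        ≡⟨ sym (↑-* g q-1 (2 * s * Q)) ⟩
      g ↑ (q-1 * (2 * s * Q))        ≡⟨ cong (g ↑_) (trans (swap q-1 (2 * s) Q) (cong (2 * s *_) Q*[q-1]≡N)) ⟩
      g ↑ (2 * s * N)                ≡⟨ ↑-multiple (2 * s) N (x↑#units≡1 generator≢0) ⟩
      1#                             ∎)
      where
      swap : ∀ a b c → a * (b * c) ≡ b * (c * a)
      swap = +-*-Solver.solve 3 (λ a b c → a :* (b :* c) := b :* (c :* a)) refl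
        where open +-*-Solver
    tr[ξ²]≡0 : tr (g ↑ e ⊗ g ↑ e) ≡ 0#
    tr[ξ²]≡0 = begin
      tr (g ↑ e ⊗ g ↑ e)                        ≡⟨ cong tr (trans (square-power e) (cong (g ↑_) (expand i Q s))) ⟩
      tr (g ↑ (2 * s * Q + 2 * i))              ≡⟨ cong tr (↑-+ g (2 * s * Q) (2 * i)) ⟩
      tr (c ⊗ g ↑ (2 * i))                      ≡⟨ tr-⊗ cK (g ↑ (2 * i)) ⟩
      c ⊗ tr (g ↑ (2 * i))                      ≡⟨ trans (cong (c ⊗_) tr≡0) (R.zeroʳ c) ⟩
      0#                                        ∎
      where
      expand : ∀ i Q s → 2 * (i + Q * s) ≡ 2 * s * Q + 2 * i
      expand = +-*-Solver.solve 3 (λ i Q s → con 2 :* (i :+ Q :* s) := con 2 :* s :* Q :+ con 2 :* i) refl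
        where open +-*-Solver

theorem5p8 : (F : FiniteField) (q n : ℕ)
    → IsPrimePower q → ¬ (2 ∣ q) → 3 ≤ n
    → FiniteField.size F ≡ q ^ n
    → 2 ∣ ((q ^ n ∸ 1) Data.Nat./ 2)
    → (∀ (m : ℕ) → m ∣ divℕ (q ^ n ∸ 1) (q ∸ 1)
    → (dec : Decidable (FiniteField.Counted F q n m (FiniteField.0# F)))
    → GeMinusSqrt (toℚ (FiniteField.𝒩 F q n m (FiniteField.0# F) dec))
    (θ m *ℚ toℚ (q ^ (n ∸ 1)))
    (θ m *ℚ toℚ (2 * W m * (q ∸ 1)))
    (toℚ (q ^ (n ∸ 2))))
    × ((2 * W (divℕ (q ^ n ∸ 1) (q ∸ 1)) * (q ∸ 1)) ^ 2 < q ^ n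
    → (dec : Decidable (FiniteField.Counted F q n (q ^ n ∸ 1) (FiniteField.0# F)))
    → 0 < FiniteField.𝒩 F q n (q ^ n ∸ 1) (FiniteField.0# F) dec)
theorem5p8 F q (suc (suc n-2)) q-prime-power 2∤q (s≤s (s≤s _)) size≡ _ = lower-bound , primitive-exists
  where open FreeElements F q n-2 q-prime-power size≡ 2∤q
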